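{- Let $C_E$ be the edit cost function with vertex insertion cost $0$, vertex deletion cost $0$, vertex relabeling cost $\infty$, edge insertion cost $1$, edge deletion cost $1$, and edge relabeling cost $2$. There is a polynomial-time algorithm that, given two unlabeled graphs $G_1$ and $G_2$ such that $G_1$ is a path and $G_2$ is a tree, computes the graph edit distance $\mathrm{GED}(G_1,G_2;C_E)$. (Equivalently, for labeled graphs, the same holds for the cost function obtained from $C_E$ by setting the vertex and edge relabeling costs to $0$.)
   Context: Graphs are finite, simple and undirected; trees are unrooted and unordered. A labeled graph is a graph $G=(V,E)$ with a labeling function $\ell\colon V\cup E\to\Sigma$, where $\Sigma$ is a finite alphabet; unlabeled graphs are graphs without labels (equivalently, all vertices carry one common label and all edges carry one common label, so no relabeling ever occurs). Isomorphisms preserve adjacency, non-adjacency, and all labels. Graph edit distance. An edit operation is an insertion, deletion, or relabeling of a vertex or an edge, with a non-negative cost given by a cost function $C$; the relabeling cost is charged when the labels do not match (leaving a label unchanged costs $0$). An edit path $\gamma=(o_1,\dots,o_k)$ from $G_1$ to $G_2$ is a sequence of edit operations transforming $G_1$ into a graph isomorphic to $G_2$ (intermediate graphs may be arbitrary graphs), with cost $C(\gamma)=\sum_i C(o_i)$. A restricted edit path is an edit path in which a vertex can only be deleted after its incident edges have been deleted, an edge can only be inserted if its endpoints exist, each vertex and each edge is edited at most once, and deleting and reinserting an edge between relabeled (i.e. substituted) vertices is forbidden. Then $\mathrm{GED}(G_1,G_2;C)=\min_{\gamma} C(\gamma)$ over all restricted edit paths $\gamma$ from $G_1$ to $G_2$.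 It is a known fact that this is equivalent to the node map formulation: the minimum, over all bijections $\phi$ from a subset $U_1\subseteq V_1$ to a subset $U_2\subseteq V_2$, of the total induced cost, where vertices in $U_1$ are mapped (relabeled if the labels differ), vertices of $V_1\setminus U_1$ are deleted, vertices of $V_2\setminus U_2$ are inserted, an edge $(u,v)\in E_1$ with $u,v\in U_1$ and $(\phi(u),\phi(v))\in E_2$ is kept (relabeled if the labels differ), all other edges of $E_1$ are deleted, and all other edges of $E_2$ are inserted. -}

module Defs where

open import Data.Bool.Base using (if_then_else_)
open import Data.Empty using (⊥)
open import Data.Fin.Base using (Fin; toℕ)
import Data.Fin.Properties as Fin
open import Data.Fin.Permutation using (Permutation′; _⟨$⟩ʳ_)
open import Data.List.Base using (List; []; _∷_; _∷ʳ_; length; map; foldr; foldl; tabulate)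
open import Data.List.Relation.Unary.AllPairs using (AllPairs)
open import Data.List.Relation.Unary.Linked using (Linked)
open import Data.List.Relation.Unary.Unique.Propositional using (Unique)
open import Data.Maybe using (Maybe; just; nothing; zipWith; Is-just)
open import Data.Nat.Base using (ℕ; zero; suc; _+_; _*_; _^_; _≤_; ∣_-_∣)
import Data.Nat.Properties as ℕ
open import Data.Product.Base using (Σ; ∃; ∃-syntax; _×_; _,_)
open import Data.Sum.Base using (_⊎_; inj₁; inj₂)
import Data.Sum.Properties as Sum
open import Data.Unit.Base using (⊤)
open import Data.Vec.Base as Vec using (Vec; []; _∷_)
open import Function.Bundles using (_⇔_)
open import Function.Definitions using (Injective)
open import Relation.Binary.Construct.Add.Supremum.NonStrict _≤_ using (_≤⁺_)
open import Relation.Binary.Construct.Closure.ReflexiveTransitive using (Star)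
open import Relation.Binary.Definitions using (DecidableEquality)
open import Relation.Binary.PropositionalEquality.Core using (_≡_; _≢_)
open import Relation.Nullary.Construct.Add.Supremum using (_⁺; ⊤⁺; [_])
open import Relation.Nullary.Decidable.Core using (Dec; does; _×-dec_; _⊎-dec_)
open import Relation.Nullary.Negation.Core using (¬_)

------------------------------------------------------------------------
-- Graphs

-- Finite simple undirected graphs whose vertices and edges are labelled by the
-- alphabet Fin s.  `elab u v` is `just` the label of the edge uv, or `nothing`
-- if u and v are not adjacent.
record Graph (s : ℕ) : Set where
  field
    order  : ℕ
    vlab   : Fin order → Fin s
    elab   : Fin order → Fin order → Maybe (Fin s)
    sym    : ∀ u v → elab u v ≡ elab v u
    irrefl : ∀ u → elab u u ≡ nothing

  Adj : Fin order → Fin order → Set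
  Adj u v = Is-just (elab u v)

-- All vertices carry one common label, and so do all edges.
UnlabeledGraph : Set
UnlabeledGraph = Graph 1

module _ {s : ℕ} (G : Graph s) where
  open Graph G

  IsPath : Set
  IsPath = 1 ≤ order ×
    Σ (Permutation′ order) λ π →
      ∀ u v → Adj u v ⇔ ∣ toℕ (π ⟨$⟩ʳ u) - toℕ (π ⟨$⟩ʳ v) ∣ ≡ 1

  Connected : Set
  Connected = ∀ u v → Star Adj u v

  IsCycle : Fin order → List (Fin order) → Set
  IsCycle v vs = 2 ≤ length vs × Unique (v ∷ vs) × Linked Adj (v ∷ (vs ∷ʳ v))

  Acyclic : Set
  Acyclic = ∀ v vs → ¬ IsCycle v vs

  IsTree : Set
  IsTree = 1 ≤ order × Connected × Acyclic

------------------------------------------------------------------------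
-- Edit costs

-- ℕ with an added infinity ⊤⁺.
Cost : Set
Cost = ℕ ⁺

infixl 6 _+⁺_
_+⁺_ : Cost → Cost → Cost
_+⁺_ = zipWith _+_

record CostFunction : Set where
  field
    vIns vDel vRel : Cost
    eIns eDel eRel : Cost

C-E : CostFunction
C-E = record
  { vIns = [ 0 ] ; vDel = [ 0 ] ; vRel = ⊤⁺
  ; eIns = [ 1 ] ; eDel = [ 1 ] ; eRel = [ 2 ] }

C-E-freeRelabeling : CostFunction
C-E-freeRelabeling = record C-E { vRel = [ 0 ] ; eRel = [ 0 ] }

------------------------------------------------------------------------
-- Edit paths

-- During an edit path that starts from a graph of order n, vertices keep their
-- identity through a name: `inj₁ i` is the vertex i of the initial graph, and
-- the `inj₂ k` are names available for inserted vertices.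
Name : ℕ → Set
Name n = Fin n ⊎ ℕ

_≟_ : ∀ {n} → DecidableEquality (Name n)
_≟_ = Sum.≡-dec Fin._≟_ ℕ._≟_

module _ {n : ℕ} where

  SamePair : Name n → Name n → Name n → Name n → Set
  SamePair u v x y = (u ≡ x × v ≡ y) ⊎ (u ≡ y × v ≡ x)

  samePair? : ∀ u v x y → Dec (SamePair u v x y)
  samePair? u v x y = ((u ≟ x) ×-dec (v ≟ y)) ⊎-dec ((u ≟ y) ×-dec (v ≟ x))

module _ (n s : ℕ) where

  -- A graph on a set of names: `vertex x` is `nothing` for absent vertices.
  record State : Set where
    constructor state
    field
      vertex : Name n → Maybe (Fin s)
      edge   : Name n → Name n → Maybe (Fin s)

  data Op : Set where
    insV : Name n → Fin s → Op
    delV : Name n → Op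
    relV : Name n → Fin s → Op
    insE : Name n → Name n → Fin s → Op
    delE : Name n → Name n → Op
    relE : Name n → Name n → Fin s → Op

module _ {n s : ℕ} where
  open State

  setV : Name n → Maybe (Fin s) → State n s → State n s
  setV v a S = state (λ x → if does (v ≟ x) then a else vertex S x) (edge S)

  setE : Name n → Name n → Maybe (Fin s) → State n s → State n s
  setE u v a S =
    state (vertex S) (λ x y → if does (samePair? u v x y) then a else edge S x y)

  apply : State n s → Op n s → State n s
  apply S (insV v a)   = setV v (just a) S
  apply S (delV v)     = setV v nothing S
  apply S (relV v a)   = setV v (just a) S
  apply S (insE u v a) = setE u v (just a) S
  apply S (delE u v)   = setE u v nothing S
  apply S (relE u v a) = setE u v (just a) S

  Applicable : State n s → Op n s → Set
  Applicable S (insV v a)   = vertex S v ≡ nothing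
  Applicable S (delV v)     = Is-just (vertex S v) × (∀ w → edge S v w ≡ nothing)
  Applicable S (relV v a)   = ∃[ b ] vertex S v ≡ just b × a ≢ b
  Applicable S (insE u v a) =
    u ≢ v × Is-just (vertex S u) × Is-just (vertex S v) × edge S u v ≡ nothing
  Applicable S (delE u v)   = Is-just (edge S u v)
  Applicable S (relE u v a) = ∃[ b ] edge S u v ≡ just b × a ≢ b

  AllApplicable : State n s → List (Op n s) → Set
  AllApplicable S []       = ⊤
  AllApplicable S (o ∷ os) = Applicable S o × AllApplicable (apply S o) os

  target : Op n s → Name n ⊎ (Name n × Name n)
  target (insV v _)   = inj₁ v
  target (delV v)     = inj₁ v
  target (relV v _)   = inj₁ v
  target (insE u v _) = inj₂ (u , v)
  target (delE u v)   = inj₂ (u , v)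
  target (relE u v _) = inj₂ (u , v)

  SameTarget : Name n ⊎ (Name n × Name n) → Name n ⊎ (Name n × Name n) → Set
  SameTarget (inj₁ v)       (inj₁ x)       = v ≡ x
  SameTarget (inj₂ (u , v)) (inj₂ (x , y)) = SamePair u v x y
  SameTarget _              _              = ⊥

  -- Each vertex and each edge is edited at most once.  An edge is identified
  -- with its unordered pair of endpoints, so this also forbids deleting and
  -- reinserting an edge between substituted vertices; and a vertex name cannot
  -- be reused after deletion, so inserted vertices are new vertices.
  EditedAtMostOnce : List (Op n s) → Set
  EditedAtMostOnce = AllPairs (λ o o′ → ¬ SameTarget (target o) (target o′))

  opCost : CostFunction → Op n s → Cost
  opCost C = λ where
      (insV _ _)   → vIns
      (delV _)     → vDel
      (relV _ _)   → vRel
      (insE _ _ _) → eIns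
      (delE _ _)   → eDel
      (relE _ _ _) → eRel
    where open CostFunction C

  pathCost : CostFunction → List (Op n s) → Cost
  pathCost C os = foldr _+⁺_ [ 0 ] (map (opCost C) os)

  record _≅_ (S : State n s) (H : Graph s) : Set where
    open Graph H
    field
      name       : Fin order → Name n
      injective  : Injective _≡_ _≡_ name
      surjective : ∀ x → Is-just (vertex S x) → ∃[ i ] name i ≡ x
      vertices   : ∀ i → vertex S (name i) ≡ just (vlab i)
      edges      : ∀ i j → edge S (name i) (name j) ≡ elab i j

initial : ∀ {s} (G : Graph s) → State (Graph.order G) s
initial {s} G = state vertex₀ edge₀
  where
    open Graph G
    vertex₀ : Name order → Maybe (Fin s)
    vertex₀ (inj₁ i) = just (vlab i)
    vertex₀ (inj₂ _) = nothing
    edge₀ : Name order → Name order → Maybe (Fin s)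
    edge₀ (inj₁ i) (inj₁ j) = elab i j
    edge₀ _        _        = nothing

record RestrictedEditPath {s : ℕ} (G₁ G₂ : Graph s) : Set where
  field
    ops        : List (Op (Graph.order G₁) s)
    applicable : AllApplicable (initial G₁) ops
    once       : EditedAtMostOnce ops
    result     : foldl apply (initial G₁) ops ≅ G₂

open RestrictedEditPath using (ops)

-- d is the minimum cost of a restricted edit path.
IsGED : ∀ {s} → CostFunction → Graph s → Graph s → Cost → Set
IsGED C G₁ G₂ d =
  (Σ (RestrictedEditPath G₁ G₂) λ γ → pathCost C (ops γ) ≡ d) ×
  (∀ (γ : RestrictedEditPath G₁ G₂) → d ≤⁺ pathCost C (ops γ))

------------------------------------------------------------------------
-- Model of computation

-- First-order call-by-value recursive programs over S-expressions (first-order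
-- pure LISP with the single atom nil), at unit cost per evaluation step.  Values
-- can be shared, so a step takes constant time on a pointer machine, and t steps
-- allocate at most t cells; polynomial time in this model is therefore polynomial
-- time on Turing machines, and conversely.
infixr 5 _∙_
data Data : Set where
  nil : Data
  _∙_ : Data → Data → Data

size : Data → ℕ
size nil     = 1
size (a ∙ b) = suc (size a + size b)

-- Terms with k free variables, calling functions with the given arities.  In
-- `case t e e′`, the branch e′ binds the head (variable 0) and the tail
-- (variable 1) of the value of t.
data Term {m : ℕ} (arity : Fin m → ℕ) (k : ℕ) : Set where
  var   : Fin k → Term arity k
  nil   : Term arity k
  cons  : Term arity k → Term arity k → Term arity k
  case  : Term arity k → Term arity k → Term arity (2 + k) → Term arity k
  local : Term arity k → Term arity (1 + k) → Term arity k
  call  : (f : Fin m) → Vec (Term arity k) (arity f) → Term arity k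

record Program : Set where
  field
    functions : ℕ
    arity     : Fin functions → ℕ
    body      : (f : Fin functions) → Term arity (arity f)
    main      : Term arity 1

module Evaluation (P : Program) where
  open Program P

  infix 4 _⊢_⇓_[_] _⊢_⇓*_[_]

  -- ρ ⊢ t ⇓ v [ c ]: in the environment ρ, t evaluates to v in c steps.
  mutual
    data _⊢_⇓_[_] {k} (ρ : Vec Data k) : Term arity k → Data → ℕ → Set where
      var : ∀ {x} → ρ ⊢ var x ⇓ Vec.lookup ρ x [ 1 ]
      nil : ρ ⊢ nil ⇓ nil [ 1 ]
      cons : ∀ {t u a b c d} →
        ρ ⊢ t ⇓ a [ c ] → ρ ⊢ u ⇓ b [ d ] →
        ρ ⊢ cons t u ⇓ a ∙ b [ suc (c + d) ]
      case-nil : ∀ {t e e′ v c d} →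
        ρ ⊢ t ⇓ nil [ c ] → ρ ⊢ e ⇓ v [ d ] →
        ρ ⊢ case t e e′ ⇓ v [ suc (c + d) ]
      case-cons : ∀ {t e e′ a b v c d} →
        ρ ⊢ t ⇓ a ∙ b [ c ] → (a ∷ b ∷ ρ) ⊢ e′ ⇓ v [ d ] →
        ρ ⊢ case t e e′ ⇓ v [ suc (c + d) ]
      local : ∀ {t u a v c d} →
        ρ ⊢ t ⇓ a [ c ] → (a ∷ ρ) ⊢ u ⇓ v [ d ] →
        ρ ⊢ local t u ⇓ v [ suc (c + d) ]
      call : ∀ {f ts vs v c d} →
        ρ ⊢ ts ⇓* vs [ c ] → vs ⊢ body f ⇓ v [ d ] →
        ρ ⊢ call f ts ⇓ v [ suc (c + d) ]

    data _⊢_⇓*_[_] {k} (ρ : Vec Data k) :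
        ∀ {l} → Vec (Term arity k) l → Vec Data l → ℕ → Set where
      []  : ρ ⊢ [] ⇓* [] [ 0 ]
      _∷_ : ∀ {l t v c d} {ts : Vec (Term arity k) l} {vs} →
        ρ ⊢ t ⇓ v [ c ] → ρ ⊢ ts ⇓* vs [ d ] →
        ρ ⊢ t ∷ ts ⇓* v ∷ vs [ c + d ]

  Run : Data → Data → ℕ → Set
  Run input output c = (input ∷ []) ⊢ main ⇓ output [ c ]

-- A single program that, on every input a satisfying the promise, halts within a
-- polynomial number of steps in the size of the encoding of a and outputs the
-- encoding of some b with `Output a b`.
PolynomialTime : {A B : Set} → (A → Data) → (B → Data) →
  (Promise : A → Set) → (Output : A → B → Set) → Set
PolynomialTime {A} encodeA encodeB Promise Output =
  Σ Program λ P → ∃[ c ] ∃[ k ] ∀ (a : A) → Promise a →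
    ∃[ b ] ∃[ t ]
      Output a b ×
      Evaluation.Run P (encodeA a) (encodeB b) t ×
      t ≤ c * size (encodeA a) ^ k

------------------------------------------------------------------------
-- Encodings

-- Unary numbers: the distances output are at most the total number of edges, so
-- this does not affect polynomial running time.
encodeℕ : ℕ → Data
encodeℕ zero    = nil
encodeℕ (suc n) = nil ∙ encodeℕ n

encodeList : List Data → Data
encodeList = foldr _∙_ nil

encodeLabel : ∀ {s} → Fin s → Data
encodeLabel a = encodeℕ (toℕ a)

encodeEntry : ∀ {s} → Maybe (Fin s) → Data
encodeEntry nothing  = nil
encodeEntry (just a) = encodeLabel a ∙ nil

-- The list of vertex labels, followed by the rows of the adjacency matrix.
encodeGraph : ∀ {s} → Graph s → Data
encodeGraph G =
  encodeList (tabulate λ u → encodeLabel (vlab u)) ∙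
  encodeList (tabulate λ u → encodeList (tabulate λ v → encodeEntry (elab u v)))
  where open Graph G

encodePair : ∀ {s} → Graph s × Graph s → Data
encodePair (G₁ , G₂) = encodeGraph G₁ ∙ encodeGraph G₂

PathAndTree : ∀ {s} → Graph s × Graph s → Set
PathAndTree (G₁ , G₂) = IsPath G₁ × IsTree G₂

GEDOutput : ∀ {s} → CostFunction → Graph s × Graph s → ℕ → Set
GEDOutput C (G₁ , G₂) d = IsGED C G₁ G₂ [ d ]

{-# OPTIONS --safe #-}

-- Vertex operations are free, so an edit path costs as many edge operations as it
-- performs, and the optimum keeps as many edges of the path as possible: if k edges
-- can be kept, the distance of a path on n and a tree on m vertices is
-- (n - 1 - k) + (m - 1 - k).  Reading off the images of the surviving vertices along
-- the path shows that k is the largest number of links (consecutive adjacent pairs)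
-- of a repetition-free list of at most n vertices of the tree, and every such list
-- is realised by an edit path.  Cutting a list at the edge between the root and a
-- child turns this maximum into a knapsack-like dynamic program over the rooted
-- tree, whose tables are combined by max-plus convolution.  An S-expression is
-- itself an ordered rooted tree, so the program first unfolds the adjacency matrix
-- of the tree into an S-expression by depth-first search and then recurses on it.
module Submission where

open import Defs
open import Data.Bool.Base using (true; false; if_then_else_)
open import Data.Fin.Base using (Fin; zero; suc; toℕ; fromℕ<)
open import Data.Fin.Permutation using (_⟨$⟩ʳ_; _⟨$⟩ˡ_; inverseˡ; inverseʳ)
import Data.Fin.Properties as Fin
open import Data.List.Base using
  ( List; []; _∷_; _++_; _∷ʳ_; _ʳ++_; length; map; mapMaybe; filter; replicate; tabulate
  ; allFin; foldl; concatMap)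
import Data.List.Membership.DecPropositional as DecMembership
open import Data.List.Membership.Propositional using (_∈_; _∉_)
open import Data.List.Membership.Propositional.Properties using
  (∈-++⁺ˡ; ∈-++⁺ʳ; ∈-++⁻; ∈-filter⁻; ∈-map⁺; ∈-map⁻; ∈-allFin; ∈-∃++)
import Data.List.Properties as List
open import Data.List.Relation.Binary.Permutation.Propositional using
  (_↭_; ↭-sym; ↭-trans; ↭⇒↭ₛ; prep)
import Data.List.Relation.Binary.Permutation.Propositional.Properties as ↭
import Data.List.Relation.Binary.Permutation.Setoid.Properties as ↭ₛ
open import Data.List.Relation.Unary.All as All using (All; []; _∷_)
import Data.List.Relation.Unary.All.Properties as All
open import Data.List.Relation.Unary.AllPairs as AllPairs₀ using (AllPairs; []; _∷_)
import Data.List.Relation.Unary.AllPairs.Properties as AllPairs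
open import Data.List.Relation.Unary.Any as Any using (Any; here; there)
import Data.List.Relation.Unary.Any.Properties as Any
open import Data.List.Relation.Unary.Linked using (Linked; []; [-]; _∷_)
open import Data.List.Relation.Unary.Unique.Propositional using (Unique)
import Data.List.Relation.Unary.Unique.Propositional.Properties as Unique
open import Data.Maybe using (Maybe; just; nothing; is-just; Is-just; _>>=_)
import Data.Maybe.Base as Maybe₀
open import Data.Maybe.Relation.Unary.Any as Maybe using (just)
open import Data.Nat.Base using
  ( ℕ; zero; suc; pred; _+_; _*_; _^_; _∸_; _⊔_; ∣_-_∣; _≡ᵇ_; _≤_; _<_; z≤n; s≤s; NonZero)
import Data.Nat.Properties as ℕ
open import Data.Nat.Tactic.RingSolver using (solve-∀)
open import Data.Product.Base using (∃; ∃₂; _×_; _,_; proj₁; proj₂)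
open import Data.Sum.Base as Sum using (_⊎_; inj₁; inj₂; [_,_]′)
open import Data.Sum.Properties using (inj₁-injective; inj₂-injective)
open import Data.Unit.Base using (⊤; tt)
open import Data.Vec.Base as Vec using (Vec; []; _∷_)
open import Function.Base using (_∘_; case_of_)
open import Function.Bundles using (Equivalence; mk⇔)
open import Function.Definitions using (Injective)
open import Relation.Binary.Construct.Add.Supremum.NonStrict _≤_ using
  (_≤⁺_; [_]; _≤⊤⁺; ≤⁺-trans)
open import Relation.Binary.Construct.Closure.ReflexiveTransitive using (Star; ε; _◅_)
open import Relation.Binary.PropositionalEquality using
  (_≡_; _≢_; refl; sym; trans; cong; cong₂; subst; subst₂; setoid)
open import Relation.Nullary.Construct.Add.Supremum using (⊤⁺; [_])
open import Relation.Nullary.Decidable using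
  (Dec; yes; no; does; ¬?; _×-dec_; does-⇔; dec-true; dec-false; decidable-stable)
open import Relation.Nullary.Negation using (¬_; contradiction)

-- Tables of the dynamic program

-- The path offers only n vertices, and k kept edges that form j separate paths in the tree use k +
-- j of them. So the resource to be shared out between subtrees is the number of vertices, and the
-- tables are indexed by it. A family of disjoint paths is handled as one list of vertices: the
-- paths are written one after another, and a boundary that happens to be an edge only adds a link.
-- Hence constructions bound the links from below only, and equality comes from the matching upper
-- bounds. The search remembers no visited vertices; it only avoids the parent. It is correct
-- because in an acyclic graph a walk that never turns straight back never repeats a vertex. This
-- one fact gives the disjointness of the branches, the absence of edges between them and the bound
-- on the depth. Both cost functions are covered by one argument: edge insertions and deletions cost
-- 1, and a relabeling is either free or, with a single label, impossible.

infix 8 _‼_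
_‼_ : List ℕ → ℕ → ℕ
[]      ‼ _     = 0
(x ∷ _) ‼ zero  = x
(_ ∷ f) ‼ suc i = f ‼ i

-- Pointwise maximum, cut to the length of the first argument, so that a second table shifted by
-- leading zeros may be longer.
merge : List ℕ → List ℕ → List ℕ
merge []      _       = []
merge (x ∷ f) []      = x ∷ f
merge (x ∷ f) (y ∷ g) = x ⊔ y ∷ merge f g

-- Max-plus convolution, row by row: the entry `x` for budget 0 contributes `x + g`, and the later
-- entries of `f` are shifted by one. The padding 0 has no split of the budget behind it, but never
-- exceeds a genuine entry.
conv : List ℕ → List ℕ → List ℕ
conv []      g = []
conv (x ∷ f) g = merge (map (x +_) g) (0 ∷ conv f g)

‼-map : ∀ {h : ℕ → ℕ} f {i} → i < length f → map h f ‼ i ≡ h (f ‼ i)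
‼-map (x ∷ f) {zero}  _         = refl
‼-map (x ∷ f) {suc i} (s≤s i<f) = ‼-map f i<f

‼-merge : ∀ f g {i} → i < length f → merge f g ‼ i ≡ f ‼ i ⊔ g ‼ i
‼-merge (x ∷ f) []      i<f               = sym (ℕ.⊔-identityʳ _)
‼-merge (x ∷ f) (y ∷ g) {zero}  _         = refl
‼-merge (x ∷ f) (y ∷ g) {suc i} (s≤s i<f) = ‼-merge f g i<f

length-merge : ∀ f g → length (merge f g) ≡ length f
length-merge []      g       = refl
length-merge (x ∷ f) []      = refl
length-merge (x ∷ f) (y ∷ g) = cong suc (length-merge f g)

length-conv : ∀ {n} f g → length f ≡ suc n → length (conv f g) ≡ length g
length-conv (x ∷ f) g _ = trans (length-merge (map (x +_) g) _) (List.length-map _ g)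

‼-conv-∷ : ∀ x f g {i} → i < length g →
  conv (x ∷ f) g ‼ i ≡ (x + g ‼ i) ⊔ ((0 ∷ conv f g) ‼ i)
‼-conv-∷ x f g i<g = trans
  (‼-merge (map (x +_) g) _ (subst (_ <_) (sym (List.length-map (x +_) g)) i<g))
  (cong (_⊔ _) (‼-map g i<g))

conv-attained : ∀ f g {w} → w < length f → w < length g →
  ∃₂ λ i j → i + j ≡ w × conv f g ‼ w ≡ f ‼ i + g ‼ j
conv-attained (x ∷ f) g {zero} _ 0<g =
  0 , 0 , refl , trans (‼-conv-∷ x f g 0<g) (ℕ.⊔-identityʳ _)
conv-attained (x ∷ f) g {suc w} (s≤s w<f) w<g
  with ‼-conv-∷ x f g w<g | conv-attained f g w<f (ℕ.<-trans (ℕ.n<1+n w) w<g)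
... | eq | i , j , i+j≡w , eq′ with ℕ.⊔-sel (x + g ‼ suc w) (conv f g ‼ w)
... | inj₁ sel = 0 , suc w , refl , trans eq sel
... | inj₂ sel = suc i , j , cong suc i+j≡w , trans eq (trans sel eq′)

conv-upper : ∀ f g i j → i < length f → i + j < length g →
  f ‼ i + g ‼ j ≤ conv f g ‼ (i + j)
conv-upper (x ∷ f) g zero j _ j<g =
  ℕ.≤-trans (ℕ.m≤m⊔n _ _) (ℕ.≤-reflexive (sym (‼-conv-∷ x f g j<g)))
conv-upper (x ∷ f) g (suc i) j (s≤s i<f) i+j<g =
  ℕ.≤-trans (conv-upper f g i j i<f (ℕ.<-trans (ℕ.n<1+n _) i+j<g))
    (ℕ.≤-trans (ℕ.m≤n⊔m _ _) (ℕ.≤-reflexive (sym (‼-conv-∷ x f g i+j<g))))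

-- Entry w of a table of a rooted tree t is the largest number of edges of a
-- family of disjoint paths in t: on at most w vertices for `free`; on the root
-- and at most w other vertices for `end` and `alone`, where the root is an end
-- of its path, respectively a path of its own.
record Tables : Set where
  constructor tables
  field
    free end alone : List ℕ

leafTables : List ℕ → Tables
leafTables z = tables z z z

joinTables : Tables → Tables → Tables
joinTables (tables fa ea _) (tables fb eb ab) = tables
  (merge (conv fa fb) (0 ∷ 0 ∷ map (1 +_) (conv ea eb)))
  (merge (conv fa eb) (0 ∷ map (1 +_) (conv ea ab)))
  (conv fa ab)

-- As a rooted tree, nil is a single vertex and a ∙ b is b with the root of a
-- attached to its root as a further child.
treeTables : List ℕ → Data → Tables
treeTables z nil     = leafTables z
treeTables z (a ∙ b) = joinTables (treeTables z a) (treeTables z b)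

zeros : ℕ → List ℕ
zeros n = replicate (suc n) 0

tableLengths : ∀ n t → let tables free end alone = treeTables (zeros n) t in
  length free ≡ suc n × length end ≡ suc n × length alone ≡ suc n
tableLengths n nil = let eq = List.length-replicate (suc n) in eq , eq , eq
tableLengths n (a ∙ b)
  with treeTables (zeros n) a | treeTables (zeros n) b | tableLengths n a | tableLengths n b
... | tables fa ea _ | tables fb eb ab | ∣fa∣ , _ , _ | ∣fb∣ , ∣eb∣ , ∣ab∣ =
  trans (length-merge (conv fa fb) _) (trans (length-conv fa fb ∣fa∣) ∣fb∣) ,
  trans (length-merge (conv fa eb) _) (trans (length-conv fa eb ∣fa∣) ∣eb∣) ,
  trans (length-conv fa ab ∣fa∣) ∣ab∣

-- Rooted trees inside a graph, and lists of vertices scored by their links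

infixr 5 _◃_
-- An S-expression read as a rooted tree, with the vertices written at the leaves: each leaf is one
-- vertex, and `a ◃ b` hangs `a` below the root of `b`.
data RTree (V : Set) : Set where
  leaf : V → RTree V
  _◃_  : RTree V → RTree V → RTree V

module _ {V : Set} where

  shape : RTree V → Data
  shape (leaf x) = nil
  shape (a ◃ b)  = shape a ∙ shape b

  root : RTree V → V
  root (leaf x) = x
  root (a ◃ b)  = root b

  vertices : RTree V → List V
  vertices (leaf x) = x ∷ []
  vertices (a ◃ b)  = vertices a ++ vertices b

  branches : RTree V → List (V × V)
  branches (leaf x) = []
  branches (a ◃ b)  = (root a , root b) ∷ branches a ++ branches b

  root∈vertices : ∀ t → root t ∈ vertices t
  root∈vertices (leaf x) = here refl
  root∈vertices (a ◃ b)  = ∈-++⁺ʳ (vertices a) (root∈vertices b)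

  unique-↭ : {xs ys : List V} → xs ↭ ys → Unique xs → Unique ys
  unique-↭ p = ↭ₛ.Unique-resp-↭ (setoid V) (↭⇒↭ₛ p)

module _ {s : ℕ} (G : Graph s) where
  open Graph G using (order; elab; Adj)

  adj? : ∀ u v → Dec (Adj u v)
  adj? u v = Maybe.dec (λ _ → yes tt) (elab u v)

  adj-sym : ∀ {u v} → Adj u v → Adj v u
  adj-sym {u} {v} = subst (Maybe.Any _) (Graph.sym G u v)

  -- The last condition of `node` makes the tree induced: a list can have a link between the two
  -- parts only where it steps between their roots.
  data Represents : RTree (Fin order) → Set where
    leaf : ∀ x → Represents (leaf x)
    node : ∀ {a b} → Represents a → Represents b →
      (∀ {x} → x ∈ vertices a → x ∉ vertices b) →
      Adj (root a) (root b) →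
      (∀ {x y} → x ∈ vertices a → y ∈ vertices b → Adj x y → x ≡ root a × y ≡ root b) →
      Represents (a ◃ b)

  link : Fin order → Fin order → ℕ
  link u v = if does (adj? u v) then 1 else 0

  headLink : Fin order → List (Fin order) → ℕ
  headLink x []      = 0
  headLink x (y ∷ _) = link x y

  links : List (Fin order) → ℕ
  links []      = 0
  links (x ∷ q) = headLink x q + links q

  link-yes : ∀ {u v} → Adj u v → link u v ≡ 1
  link-yes {u} {v} uv rewrite dec-true (adj? u v) uv = refl

  link-sym : ∀ u v → link u v ≡ link v u
  link-sym u v = cong (if_then 1 else 0)
    (does-⇔ (mk⇔ adj-sym adj-sym) (adj? u v) (adj? v u))

  links-++ : ∀ q r → links q + links r ≤ links (q ++ r)
  links-++ []          r = ℕ.≤-refl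
  links-++ (x ∷ [])    r = ℕ.m≤n+m (links r) (headLink x r)
  links-++ (x ∷ y ∷ q) r = ℕ.≤-trans
    (ℕ.≤-reflexive (ℕ.+-assoc (link x y) _ _)) (ℕ.+-monoʳ-≤ (link x y) (links-++ (y ∷ q) r))

  links-∷ : ∀ x q → links q ≤ links (x ∷ q)
  links-∷ x q = ℕ.m≤n+m _ _

  -- A list seen as a zipper at `x`: the part before `x` is read backwards, which by symmetry of
  -- adjacency does not change its links.
  links-ʳ++ : ∀ x q r → links (q ʳ++ (x ∷ r)) ≡ links (x ∷ q) + links (x ∷ r)
  links-ʳ++ x []      r = refl
  links-ʳ++ x (y ∷ q) r rewrite links-ʳ++ y q (x ∷ r) | link-sym y x =
    rearrange (headLink y q + links q) (link x y) _
    where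
    rearrange : ∀ a b c → a + (b + c) ≡ b + a + c
    rearrange = solve-∀

  module _ {P : Fin order → Set} (P? : ∀ x → Dec (P x)) where

    SameSide : Fin order → Fin order → Set
    SameSide x y = Adj x y → (P x × P y) ⊎ (¬ P x × ¬ P y)

    -- Linked neighbours lie on the same side, so they stay consecutive after filtering. Filtering
    -- may also bring adjacent vertices together, hence only an inequality.
    links-filter : ∀ q → Linked SameSide q →
      links q ≤ links (filter P? q) + links (filter (¬? ∘ P?) q)
    links-filter []       _   = z≤n
    links-filter (x ∷ []) [-] = z≤n
    links-filter (x ∷ y ∷ q) (xy ∷ yq) with links-filter (y ∷ q) yq | adj? x y
    ... | ih | no ¬adj = ℕ.≤-trans ih (grow (P? x))
      where
      grow : Dec (P x) → links (filter P? (y ∷ q)) + links (filter (¬? ∘ P?) (y ∷ q)) ≤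
        links (filter P? (x ∷ y ∷ q)) + links (filter (¬? ∘ P?) (x ∷ y ∷ q))
      grow (yes px) rewrite List.filter-accept P? {xs = y ∷ q} px
        | List.filter-reject (¬? ∘ P?) {xs = y ∷ q} (λ ¬px → ¬px px) =
        ℕ.+-monoˡ-≤ _ (links-∷ x (filter P? (y ∷ q)))
      grow (no ¬px) rewrite List.filter-reject P? {xs = y ∷ q} ¬px
        | List.filter-accept (¬? ∘ P?) {xs = y ∷ q} ¬px =
        ℕ.+-monoʳ-≤ (links (filter P? (y ∷ q))) (links-∷ x (filter (¬? ∘ P?) (y ∷ q)))
    ... | ih | yes adj with xy adj
    ... | inj₁ (px , py)
      rewrite List.filter-accept P? {xs = y ∷ q} px
      | List.filter-reject (¬? ∘ P?) {xs = y ∷ q} (λ ¬px → ¬px px)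
      | List.filter-accept P? {xs = q} py | link-yes adj = s≤s ih
    ... | inj₂ (¬px , ¬py)
      rewrite List.filter-accept (¬? ∘ P?) {xs = y ∷ q} ¬px
      | List.filter-reject P? {xs = y ∷ q} ¬px
      | List.filter-accept (¬? ∘ P?) {xs = q} ¬py | link-yes adj =
      ℕ.≤-trans (s≤s ih) (ℕ.≤-reflexive (sym (ℕ.+-suc _ _)))

-- Correctness of the tables: every entry is attained and is an upper bound

module Optimality {s : ℕ} (G : Graph s) (n : ℕ) where
  open Graph G using (order; elab; Adj)
  private
    V = Fin order
    Tree = RTree V
    ℓ = links G
    z = zeros n

    tablesOf : Tree → Tables
    tablesOf t = treeTables z (shape t)

    free′ end′ alone′ : Tree → List ℕ
    free′ t  = Tables.free (tablesOf t)
    end′ t   = Tables.end (tablesOf t)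
    alone′ t = Tables.alone (tablesOf t)

  private
    module _ (t : Tree) where
      len = tableLengths n (shape t)
      free< : ∀ {w} → w ≤ n → w < length (free′ t)
      free< w≤n = subst (_ <_) (sym (proj₁ len)) (s≤s w≤n)
      end< : ∀ {w} → w ≤ n → w < length (end′ t)
      end< w≤n = subst (_ <_) (sym (proj₁ (proj₂ len))) (s≤s w≤n)
      alone< : ∀ {w} → w ≤ n → w < length (alone′ t)
      alone< w≤n = subst (_ <_) (sym (proj₂ (proj₂ len))) (s≤s w≤n)

    conv< : ∀ f g → length f ≡ suc n → length g ≡ suc n → ∀ {w} → w ≤ n → w < length (conv f g)
    conv< f g ∣f∣ ∣g∣ w≤n = subst (_ <_) (sym (trans (length-conv f g ∣f∣) ∣g∣)) (s≤s w≤n)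

    module _ (a b : Tree) where
      endend< : ∀ {w} → w ≤ n → w < length (conv (end′ a) (end′ b))
      endend< = conv< (end′ a) (end′ b) (proj₁ (proj₂ (len a))) (proj₁ (proj₂ (len b)))

      endalone< : ∀ {w} → w ≤ n → w < length (conv (end′ a) (alone′ b))
      endalone< = conv< (end′ a) (alone′ b) (proj₁ (proj₂ (len a))) (proj₂ (proj₂ (len b)))

      free-node : ∀ {w} → w ≤ n → free′ (a ◃ b) ‼ w ≡
        conv (free′ a) (free′ b) ‼ w ⊔ (0 ∷ 0 ∷ map (1 +_) (conv (end′ a) (end′ b))) ‼ w
      free-node w≤n = ‼-merge (conv (free′ a) (free′ b)) _
        (conv< (free′ a) (free′ b) (proj₁ (len a)) (proj₁ (len b)) w≤n)

      end-node : ∀ {w} → w ≤ n → end′ (a ◃ b) ‼ w ≡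
        conv (free′ a) (end′ b) ‼ w ⊔ (0 ∷ map (1 +_) (conv (end′ a) (alone′ b))) ‼ w
      end-node w≤n = ‼-merge (conv (free′ a) (end′ b)) _
        (conv< (free′ a) (end′ b) (proj₁ (len a)) (proj₁ (proj₂ (len b))) w≤n)

  record Within (t : Tree) (q : List V) (w : ℕ) : Set where
    constructor within
    field
      unique : Unique q
      inside : All (_∈ vertices t) q
      short  : length q ≤ w

  private
    within-↭ : ∀ {t q r w} → q ↭ r → Within t q w → Within t r w
    within-↭ p (within u i l) =
      within (unique-↭ p u) (↭.All-resp-↭ p i) (subst (_≤ _) (↭.↭-length p) l)

    within-++ : ∀ {a b q r i j w} → (∀ {x} → x ∈ vertices a → x ∉ vertices b) →
      i + j ≡ w → Within a q i → Within b r j → Within (a ◃ b) (q ++ r) w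
    within-++ {a} {b} {q} {r} disj refl (within u i l) (within u′ i′ l′) = within
      (Unique.++⁺ u u′ λ (x∈q , x∈r) → disj (All.lookup i x∈q) (All.lookup i′ x∈r))
      (All.++⁺ (All.map ∈-++⁺ˡ i) (All.map (∈-++⁺ʳ (vertices a)) i′))
      (ℕ.≤-trans (ℕ.≤-reflexive (List.length-++ q)) (ℕ.+-mono-≤ l l′))

    within-tail : ∀ {t x q w} → Within t (x ∷ q) (suc w) → Within t q w
    within-tail (within (_ ∷ u) (_ ∷ i) (s≤s l)) = within u i l

    -- An entry is a lower bound for its witness because concatenation can create links by chance.
    -- In `Alone` the root still has to avoid `q`, but a link from it to `q` is not counted.
    Free End Alone : Tree → ℕ → ℕ → Set
    Free t w e  = ∃ λ q → Within t q w × e ≤ ℓ q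
    End t w e   = ∃ λ q → Within t (root t ∷ q) (suc w) × e ≤ ℓ (root t ∷ q)
    Alone t w e = ∃ λ q → Within t (root t ∷ q) (suc w) × e ≤ ℓ q

    singleton-within : ∀ t w → Within t (root t ∷ []) (suc w)
    singleton-within t w = within ([] ∷ []) (root∈vertices t ∷ []) (s≤s z≤n)

    empty-within : ∀ t w → Within t [] w
    empty-within t w = within [] [] z≤n

    zeros‼ : ∀ k w → replicate k 0 ‼ w ≡ 0
    zeros‼ zero    w       = refl
    zeros‼ (suc k) zero    = refl
    zeros‼ (suc k) (suc w) = zeros‼ k w

    ⊔-elim : (P : ℕ → Set) → ∀ {e} x y → e ≡ x ⊔ y → P x → P y → P e
    ⊔-elim P x y eq px py with ℕ.⊔-sel x y
    ... | inj₁ sel = subst P (sym (trans eq sel)) px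
    ... | inj₂ sel = subst P (sym (trans eq sel)) py

  attained : ∀ t → Represents G t → ∀ {w} → w ≤ n →
    Free t w (free′ t ‼ w) × End t w (end′ t ‼ w) × Alone t w (alone′ t ‼ w)
  attained (leaf x) _ {w} w≤n =
    ([] , empty-within _ w , zero≤) ,
    ([] , singleton-within (leaf x) w , zero≤) ,
    ([] , singleton-within (leaf x) w , zero≤)
    where
    zero≤ : ∀ {e} → z ‼ w ≤ e
    zero≤ = subst (_≤ _) (sym (zeros‼ (suc n) w)) z≤n
  attained (a ◃ b) (node Ra Rb disj adj cross) = λ w≤n →
      ⊔-elim (Free (a ◃ b) _) _ _ (free-node a b w≤n) (freeSeparate w≤n) (freeJoined w≤n)
    , ⊔-elim (End (a ◃ b) _) _ _ (end-node a b w≤n) (endSeparate w≤n) (endJoined w≤n)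
    , aloneSeparate w≤n
    where
    ra = root a
    rb = root b

    split : ∀ {f g} w → w < length f → w < length g →
      ∃₂ λ i j → i + j ≡ w × i ≤ w × j ≤ w × conv f g ‼ w ≡ f ‼ i + g ‼ j
    split {f} {g} w w<f w<g with conv-attained f g w<f w<g
    ... | i , j , refl , eq = i , j , refl , ℕ.m≤m+n i j , ℕ.m≤n+m j i , eq

    freeSeparate : ∀ {w} → w ≤ n → Free (a ◃ b) w (conv (free′ a) (free′ b) ‼ w)
    freeSeparate {w} w≤n with split {free′ a} {free′ b} w (free< a w≤n) (free< b w≤n)
    ... | i , j , ij , i≤w , j≤w , eq rewrite eq
      with attained a Ra (ℕ.≤-trans i≤w w≤n) | attained b Rb (ℕ.≤-trans j≤w w≤n)
    ... | (q , q-in , q-links) , _ | (r , r-in , r-links) , _ =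
      q ++ r , within-++ disj ij q-in r-in ,
      ℕ.≤-trans (ℕ.+-mono-≤ q-links r-links) (links-++ G q r)

    freeJoined : ∀ {w} → w ≤ n →
      Free (a ◃ b) w ((0 ∷ 0 ∷ map (1 +_) (conv (end′ a) (end′ b))) ‼ w)
    freeJoined {zero}  _ = [] , empty-within _ _ , z≤n
    freeJoined {suc zero} _ = [] , empty-within _ _ , z≤n
    freeJoined {suc (suc w)} 2+w≤n
      with w≤n ← ℕ.≤-trans (ℕ.m≤n+m w 2) 2+w≤n
      with split {end′ a} {end′ b} w (end< a w≤n) (end< b w≤n)
    ... | i , j , refl , i≤w , j≤w , eq
      rewrite ‼-map {1 +_} (conv (end′ a) (end′ b)) {i + j} (endend< a b w≤n) | eq
      with attained a Ra (ℕ.≤-trans i≤w w≤n) | attained b Rb (ℕ.≤-trans j≤w w≤n)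
    ... | _ , (q , q-in , q-links) , _ | _ , (r , r-in , r-links) , _ =
      -- Both lists begin with their root; reversing the one in a places its root next to the root
      -- of b.
      q ʳ++ (ra ∷ rb ∷ r) ,
      within-↭ (↭-trans (↭-sym (↭.shift ra q (rb ∷ r))) (↭.++↭ʳ++ q (ra ∷ rb ∷ r)))
        (within-++ disj (cong suc (ℕ.+-suc i j)) q-in r-in) ,
      (begin
        1 + (end′ a ‼ i + end′ b ‼ j)       ≤⟨ s≤s (ℕ.+-mono-≤ q-links r-links) ⟩
        1 + (ℓ (ra ∷ q) + ℓ (rb ∷ r))       ≡⟨ ℕ.+-suc _ _ ⟨
        ℓ (ra ∷ q) + (1 + ℓ (rb ∷ r))       ≡⟨ cong (λ l → ℓ (ra ∷ q) + (l + ℓ (rb ∷ r))) (link-yes G adj) ⟨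
        ℓ (ra ∷ q) + ℓ (ra ∷ rb ∷ r)        ≡⟨ links-ʳ++ G ra q (rb ∷ r) ⟨
        ℓ (q ʳ++ (ra ∷ rb ∷ r))             ∎)
      where open ℕ.≤-Reasoning

    endSeparate : ∀ {w} → w ≤ n → End (a ◃ b) w (conv (free′ a) (end′ b) ‼ w)
    endSeparate {w} w≤n with split {free′ a} {end′ b} w (free< a w≤n) (end< b w≤n)
    ... | i , j , ij , i≤w , j≤w , eq rewrite eq
      with attained a Ra (ℕ.≤-trans i≤w w≤n) | attained b Rb (ℕ.≤-trans j≤w w≤n)
    ... | (q , q-in , q-links) , _ | _ , (r , r-in , r-links) , _ =
      -- The list in b comes first, so that the root of b remains at the head.
      r ++ q ,
      within-↭ (↭.++-comm q (rb ∷ r)) (within-++ disj (trans (ℕ.+-suc i j) (cong suc ij)) q-in r-in) ,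
      ℕ.≤-trans (ℕ.+-mono-≤ q-links r-links)
        (ℕ.≤-trans (ℕ.≤-reflexive (ℕ.+-comm (ℓ q) _)) (links-++ G (rb ∷ r) q))

    endJoined : ∀ {w} → w ≤ n →
      End (a ◃ b) w ((0 ∷ map (1 +_) (conv (end′ a) (alone′ b))) ‼ w)
    endJoined {zero} _ = [] , singleton-within (a ◃ b) 0 , z≤n
    endJoined {suc w} 1+w≤n
      with w≤n ← ℕ.≤-trans (ℕ.n≤1+n w) 1+w≤n
      with split {end′ a} {alone′ b} w (end< a w≤n) (alone< b w≤n)
    ... | i , j , refl , i≤w , j≤w , eq
      rewrite ‼-map {1 +_} (conv (end′ a) (alone′ b)) {i + j} (endalone< a b w≤n) | eq
      with attained a Ra (ℕ.≤-trans i≤w w≤n) | attained b Rb (ℕ.≤-trans j≤w w≤n)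
    ... | _ , (q , q-in , q-links) , _ | _ , _ , (r , r-in , r-links) =
      -- The head `rb` is followed directly by `ra`; the links of `r` do not involve `rb`, so `r`
      -- can be moved behind the path from a.
      (ra ∷ q) ++ r ,
      within-↭ (↭.shift rb (ra ∷ q) r) (within-++ disj (cong suc (ℕ.+-suc i j)) q-in r-in) ,
      (begin
        1 + (end′ a ‼ i + alone′ b ‼ j)  ≤⟨ s≤s (ℕ.+-mono-≤ q-links r-links) ⟩
        1 + (ℓ (ra ∷ q) + ℓ r)           ≤⟨ s≤s (links-++ G (ra ∷ q) r) ⟩
        1 + ℓ (ra ∷ q ++ r)              ≡⟨ cong (_+ ℓ (ra ∷ q ++ r)) (link-yes G (adj-sym G adj)) ⟨
        ℓ (rb ∷ ra ∷ q ++ r)             ∎)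
      where open ℕ.≤-Reasoning

    aloneSeparate : ∀ {w} → w ≤ n → Alone (a ◃ b) w (conv (free′ a) (alone′ b) ‼ w)
    aloneSeparate {w} w≤n with split {free′ a} {alone′ b} w (free< a w≤n) (alone< b w≤n)
    ... | i , j , ij , i≤w , j≤w , eq rewrite eq
      with attained a Ra (ℕ.≤-trans i≤w w≤n) | attained b Rb (ℕ.≤-trans j≤w w≤n)
    ... | (q , q-in , q-links) , _ | _ , _ , (r , r-in , r-links) =
      q ++ r ,
      within-↭ (↭.shift rb q r) (within-++ disj (trans (ℕ.+-suc i j) (cong suc ij)) q-in r-in) ,
      ℕ.≤-trans (ℕ.+-mono-≤ q-links r-links) (links-++ G q r)

  open DecMembership (Fin._≟_ {order}) using (_∈?_)

  module _ (x y : V) where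

    Avoids : V → V → Set
    Avoids u v = ¬ (u ≡ x × v ≡ y) × ¬ (u ≡ y × v ≡ x)

    -- In the second case q or its reversal is the reversal of q₁ followed by x, y and q₂.
    data StepView (q : List V) : Set where
      avoids : Linked Avoids q → StepView q
      steps  : ∀ q₁ q₂ → x ∷ y ∷ q₁ ++ q₂ ↭ q → ℓ q ≡ ℓ (x ∷ q₁) + (link G x y + ℓ (y ∷ q₂)) → StepView q

    private
      fromZipper : ∀ q₁ q₂ → StepView (q₁ ʳ++ (x ∷ y ∷ q₂)) × StepView (q₂ ʳ++ (y ∷ x ∷ q₁))
      fromZipper q₁ q₂ =
        steps q₁ q₂
          (↭-trans (↭-sym (↭-trans (↭.shift x q₁ (y ∷ q₂)) (prep x (↭.shift y q₁ q₂))))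
            (↭.++↭ʳ++ q₁ (x ∷ y ∷ q₂)))
          (links-ʳ++ G x q₁ (y ∷ q₂)) ,
        steps q₁ q₂
          (↭-trans (↭-sym (↭-trans (↭.shift y q₂ (x ∷ q₁))
              (↭-trans (prep y (↭.shift x q₂ q₁))
                (↭-trans (↭.shift x (y ∷ []) (q₂ ++ q₁)) (prep x (prep y (↭.++-comm q₂ q₁)))))))
            (↭.++↭ʳ++ q₂ (y ∷ x ∷ q₁)))
          (trans (links-ʳ++ G y q₂ (x ∷ q₁))
            (trans (cong (λ l → ℓ (y ∷ q₂) + (l + ℓ (x ∷ q₁))) (link-sym G y x))
              (rearrange (ℓ (y ∷ q₂)) (link G x y) _)))
        where
        rearrange : ∀ a b c → a + (b + c) ≡ c + (b + a)
        rearrange = solve-∀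

      -- The scanned prefix is kept reversed in `p`, so that a hit in either direction is already a
      -- zipper. For a step from `y` to `x` the two halves exchange their roles.
      search : ∀ p q → Linked Avoids q ⊎ StepView (p ʳ++ q)
      search p []       = inj₁ []
      search p (u ∷ []) = inj₁ [-]
      search p (u ∷ v ∷ q) with (u Fin.≟ x) ×-dec (v Fin.≟ y) | (u Fin.≟ y) ×-dec (v Fin.≟ x) | search (u ∷ p) (v ∷ q)
      ... | yes (refl , refl) | _ | _ = inj₂ (proj₁ (fromZipper p q))
      ... | no _ | yes (refl , refl) | _ = inj₂ (proj₂ (fromZipper q p))
      ... | no f | no g | inj₁ l = inj₁ ((f , g) ∷ l)
      ... | no f | no g | inj₂ e = inj₂ e

    stepView : ∀ q → StepView q
    stepView q with search [] q
    ... | inj₁ l = avoids l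
    ... | inj₂ v = v

  private
    module Join {a b : Tree} (Ra : Represents G a) (Rb : Represents G b)
        (disj : ∀ {x} → x ∈ vertices a → x ∉ vertices b)
        (adj : Adj (root a) (root b))
        (cross : ∀ {x y} → x ∈ vertices a → y ∈ vertices b → Adj x y → x ≡ root a × y ≡ root b) where

      ra = root a
      rb = root b

      inA? : ∀ x → Dec (x ∈ vertices a)
      inA? x = x ∈? vertices a

      partA partB : List V → List V
      partA = filter inA?
      partB = filter (¬? ∘ inA?)

      in-b : ∀ {x} → x ∈ vertices (a ◃ b) → x ∉ vertices a → x ∈ vertices b
      in-b x∈ x∉a with ∈-++⁻ (vertices a) x∈
      ... | inj₁ x∈a = contradiction x∈a x∉a
      ... | inj₂ x∈b = x∈b

      rb∉a : rb ∉ vertices a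
      rb∉a rb∈a = disj rb∈a (root∈vertices b)

      partA-ra : ∀ q → partA (ra ∷ q) ≡ ra ∷ partA q
      partA-ra q = List.filter-accept inA? {xs = q} (root∈vertices a)

      partB-ra : ∀ q → partB (ra ∷ q) ≡ partB q
      partB-ra q = List.filter-reject (¬? ∘ inA?) {xs = q} (λ ra∉a → ra∉a (root∈vertices a))

      partA-rb : ∀ q → partA (rb ∷ q) ≡ partA q
      partA-rb q = List.filter-reject inA? {xs = q} rb∉a

      partB-rb : ∀ q → partB (rb ∷ q) ≡ rb ∷ partB q
      partB-rb q = List.filter-accept (¬? ∘ inA?) {xs = q} rb∉a

      length-parts : ∀ q → length (partA q) + length (partB q) ≡ length q
      length-parts []      = refl
      length-parts (x ∷ q) with inA? x
      ... | yes _ = cong suc (length-parts q)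
      ... | no _  = trans (ℕ.+-suc _ _) (cong suc (length-parts q))

      -- The part in a receives exactly its length as budget and the part in b all the rest, so that
      -- the two budgets add up to w as the convolution requires.
      parts : ∀ {q w} → Within (a ◃ b) q w →
        ∃₂ λ i j → i + j ≡ w × Within a (partA q) i × Within b (partB q) j
      parts {q} {w} (within u i l) =
        length (partA q) , w ∸ length (partA q) ,
        ℕ.m+[n∸m]≡n (ℕ.≤-trans (List.length-filter inA? q) l) ,
        within (Unique.filter⁺ inA? u)
          (All.tabulate (λ x∈ → proj₂ (∈-filter⁻ inA? {xs = q} x∈))) ℕ.≤-refl ,
        within (Unique.filter⁺ (¬? ∘ inA?) u)
          (All.tabulate (λ x∈ → let x∈q , x∉a = ∈-filter⁻ (¬? ∘ inA?) {xs = q} x∈ in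
            in-b (All.lookup i x∈q) x∉a))
          (ℕ.m+n≤o⇒m≤o∸n _
            (subst (_≤ w) (sym (trans (ℕ.+-comm _ (length (partA q))) (length-parts q))) l))

      positive : ∀ {t x q k} → Within t (x ∷ q) k → ∃ λ k′ → k ≡ suc k′
      positive (within _ _ (s≤s _)) = _ , refl

      partsEnd : ∀ q {w} → Within (a ◃ b) (rb ∷ q) (suc w) →
        ∃₂ λ i j → i + j ≡ w × Within a (partA q) i × Within b (rb ∷ partB q) (suc j)
      partsEnd q wq with parts wq
      ... | i , j , ij , wa , wb rewrite partA-rb q | partB-rb q with positive wb
      ... | j , refl = i , j , ℕ.suc-injective (trans (sym (ℕ.+-suc i j)) ij) , wa , wb

      partsEndJoined : ∀ q {w} → Within (a ◃ b) (rb ∷ ra ∷ q) (suc w) →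
        ∃₂ λ i j → suc (i + j) ≡ w × Within a (ra ∷ partA q) (suc i) × Within b (rb ∷ partB q) (suc j)
      partsEndJoined q wq with partsEnd (ra ∷ q) wq
      ... | i , j , ij , wa , wb rewrite partA-ra q | partB-ra q with positive wa
      ... | i , refl = i , j , ij , wa , wb

      -- After the cut between the roots, each half may still visit both sides. The pieces in a are
      -- collected into one list headed by `ra`, those in b into one headed by `rb`; the two roots
      -- account for the shift by two.
      partsJoined : ∀ q₁ q₂ {w} → Within (a ◃ b) (ra ∷ rb ∷ q₁ ++ q₂) w →
        ∃₂ λ i j → suc (suc (i + j)) ≡ w ×
          Within a (ra ∷ partA q₁ ++ partA q₂) (suc i) × Within b (rb ∷ partB q₂ ++ partB q₁) (suc j)
      partsJoined q₁ q₂ {suc w} wq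
        with partsEndJoined (q₁ ++ q₂) (within-↭ (↭.shift rb (ra ∷ []) (q₁ ++ q₂)) wq)
      ... | i , j , ij , wa , wb
        rewrite List.filter-++ inA? q₁ q₂ | List.filter-++ (¬? ∘ inA?) q₁ q₂ =
        i , j , cong suc ij , wa , within-↭ (prep rb (↭.++-comm (partB q₁) (partB q₂))) wb
      partsJoined q₁ q₂ {zero} (within _ _ ())

      -- A link that changes sides would be the edge between the roots, by `cross`, and such a step
      -- is avoided; so the sides can be filtered apart without losing a link.
      noStep : ∀ q → All (_∈ vertices (a ◃ b)) q → Linked (Avoids ra rb) q →
        ℓ q ≤ ℓ (partA q) + ℓ (partB q)
      noStep q inside avoid = links-filter G inA? q (sameSide inside avoid)
        where
        side : ∀ {x y} → x ∈ vertices (a ◃ b) → y ∈ vertices (a ◃ b) → Avoids ra rb x y →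
          SameSide G inA? x y
        side {x} {y} x∈ y∈ (f , g) xy with inA? x | inA? y
        ... | yes x∈a | yes y∈a = inj₁ (x∈a , y∈a)
        ... | no  x∉a | no  y∉a = inj₂ (x∉a , y∉a)
        ... | yes x∈a | no  y∉a = contradiction (cross x∈a (in-b y∈ y∉a) xy) f
        ... | no  x∉a | yes y∈a with cross y∈a (in-b x∈ x∉a) (adj-sym G xy)
        ... | y≡ra , x≡rb = contradiction (x≡rb , y≡ra) g
        sameSide : ∀ {q} → All (_∈ vertices (a ◃ b)) q → Linked (Avoids ra rb) q →
          Linked (SameSide G inA?) q
        sameSide _                 []      = []
        sameSide _                 [-]     = [-]
        sameSide (x∈ ∷ y∈ ∷ inside) (p ∷ l) = side x∈ y∈ p ∷ sameSide (y∈ ∷ inside) l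

      -- For the pieces of a repetition-free list: a piece that lacks one of the roots cannot step
      -- between them.
      avoid-without : ∀ {c} → (c ≡ ra ⊎ c ≡ rb) → ∀ {q} → All (_≢ c) q → Linked (Avoids ra rb) q
      avoid-without c []       = []
      avoid-without c (_ ∷ []) = [-]
      avoid-without (inj₁ refl) (x≢ ∷ y≢ ∷ q) =
        (x≢ ∘ proj₁ , y≢ ∘ proj₂) ∷ avoid-without (inj₁ refl) (y≢ ∷ q)
      avoid-without (inj₂ refl) (x≢ ∷ y≢ ∷ q) =
        (y≢ ∘ proj₂ , x≢ ∘ proj₁) ∷ avoid-without (inj₂ refl) (y≢ ∷ q)

      ra≢rb : ra ≢ rb
      ra≢rb eq = disj (root∈vertices a) (subst (_∈ vertices b) (sym eq) (root∈vertices b))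

      ≢-sym : ∀ {x} {q : List V} → All (λ y → ¬ x ≡ y) q → All (_≢ x) q
      ≢-sym = All.map (λ ne eq → ne (sym eq))

      module Bounds (upA : ∀ {w} → w ≤ n →
                 (∀ {q} → Within a q w → ℓ q ≤ free′ a ‼ w) ×
                 (∀ {q} → Within a (ra ∷ q) (suc w) → ℓ (ra ∷ q) ≤ end′ a ‼ w) ×
                 (∀ {q} → Within a (ra ∷ q) (suc w) → ℓ q ≤ alone′ a ‼ w))
               (upB : ∀ {w} → w ≤ n →
                 (∀ {q} → Within b q w → ℓ q ≤ free′ b ‼ w) ×
                 (∀ {q} → Within b (rb ∷ q) (suc w) → ℓ (rb ∷ q) ≤ end′ b ‼ w) ×
                 (∀ {q} → Within b (rb ∷ q) (suc w) → ℓ q ≤ alone′ b ‼ w)) where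

        separateFree : ∀ {q i j} → i + j ≤ n → Within a (partA q) i → Within b (partB q) j →
          ℓ (partA q) + ℓ (partB q) ≤ conv (free′ a) (free′ b) ‼ (i + j)
        separateFree {q} {i} {j} ij≤n wa wb = ℕ.≤-trans
          (ℕ.+-mono-≤ (proj₁ (upA (ℕ.m+n≤o⇒m≤o i ij≤n)) wa) (proj₁ (upB (ℕ.m+n≤o⇒n≤o i ij≤n)) wb))
          (conv-upper (free′ a) (free′ b) i j (free< a (ℕ.m+n≤o⇒m≤o i ij≤n)) (free< b ij≤n))

        upFree : ∀ {w} → w ≤ n → ∀ {q} → Within (a ◃ b) q w → ℓ q ≤ free′ (a ◃ b) ‼ w
        upFree {w} w≤n {q} wq with stepView ra rb q
        ... | avoids l with parts wq
        ... | i , j , refl , wa , wb =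
          ℕ.≤-trans (noStep q (Within.inside wq) l) (ℕ.≤-trans (separateFree {q} w≤n wa wb)
            (ℕ.≤-trans (ℕ.m≤m⊔n _ _) (ℕ.≤-reflexive (sym (free-node a b w≤n)))))
        upFree {w} w≤n {q} wq | steps q₁ q₂ perm eq
          with within-↭ (↭-sym perm) wq
        ... | wr with partsJoined q₁ q₂ wr | wr
        ... | i , j , refl , wa , wb | within ((_ ∷ ra∉) ∷ rb∉ ∷ _) (ra∈ ∷ rb∈ ∷ inside) _ = begin
          ℓ q                                              ≡⟨ eq ⟩
          ℓ (ra ∷ q₁) + (link G ra rb + ℓ (rb ∷ q₂))       ≡⟨ cong (λ l → ℓ (ra ∷ q₁) + (l + ℓ (rb ∷ q₂))) (link-yes G adj) ⟩
          -- Each half lacks the opposite root, so it can be filtered by side.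
          ℓ (ra ∷ q₁) + (1 + ℓ (rb ∷ q₂))                  ≤⟨ ℕ.+-mono-≤ left (s≤s right) ⟩
          (ℓ (ra ∷ partA q₁) + ℓ (partB q₁)) + (1 + (ℓ (partA q₂) + ℓ (rb ∷ partB q₂)))
                                                           ≡⟨ rearrange (ℓ (ra ∷ partA q₁)) _ _ _ ⟩
          1 + ((ℓ (ra ∷ partA q₁) + ℓ (partA q₂)) + (ℓ (rb ∷ partB q₂) + ℓ (partB q₁)))
                                                           ≤⟨ s≤s (ℕ.+-mono-≤ (links-++ G (ra ∷ partA q₁) (partA q₂)) (links-++ G (rb ∷ partB q₂) (partB q₁))) ⟩
          1 + (ℓ (ra ∷ partA q₁ ++ partA q₂) + ℓ (rb ∷ partB q₂ ++ partB q₁))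
                                                           ≤⟨ s≤s (ℕ.+-mono-≤ (proj₁ (proj₂ (upA i≤n)) wa) (proj₁ (proj₂ (upB j≤n)) wb)) ⟩
          1 + (end′ a ‼ i + end′ b ‼ j)                    ≤⟨ s≤s (conv-upper (end′ a) (end′ b) i j (end< a i≤n) (end< b ij≤n)) ⟩
          1 + conv (end′ a) (end′ b) ‼ (i + j)             ≡⟨ ‼-map (conv (end′ a) (end′ b)) (endend< a b ij≤n) ⟨
          map (1 +_) (conv (end′ a) (end′ b)) ‼ (i + j)    ≤⟨ ℕ.m≤n⊔m _ _ ⟩
          conv (free′ a) (free′ b) ‼ suc (suc (i + j)) ⊔ map (1 +_) (conv (end′ a) (end′ b)) ‼ (i + j)
                                                           ≡⟨ free-node a b w≤n ⟨
          free′ (a ◃ b) ‼ suc (suc (i + j))                ∎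
          where
          open ℕ.≤-Reasoning
          ij≤n : i + j ≤ n
          ij≤n = ℕ.≤-trans (ℕ.m≤n+m (i + j) 2) w≤n
          i≤n : i ≤ n
          i≤n = ℕ.m+n≤o⇒m≤o i ij≤n
          j≤n : j ≤ n
          j≤n = ℕ.m+n≤o⇒n≤o i ij≤n
          rearrange : ∀ x y z u → (x + y) + (1 + (z + u)) ≡ 1 + ((x + z) + (u + y))
          rearrange = solve-∀
          left : ℓ (ra ∷ q₁) ≤ ℓ (ra ∷ partA q₁) + ℓ (partB q₁)
          left = subst (λ r → ℓ (ra ∷ q₁) ≤ ℓ r + ℓ (partB q₁)) (partA-ra q₁)
            (subst (λ r → ℓ (ra ∷ q₁) ≤ ℓ (partA (ra ∷ q₁)) + ℓ r) (partB-ra q₁)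
              (noStep (ra ∷ q₁) (ra∈ ∷ All.++⁻ˡ q₁ inside)
                (avoid-without (inj₂ refl) (ra≢rb ∷ ≢-sym (All.++⁻ˡ q₁ rb∉)))))
          right : ℓ (rb ∷ q₂) ≤ ℓ (partA q₂) + ℓ (rb ∷ partB q₂)
          right = subst (λ r → ℓ (rb ∷ q₂) ≤ ℓ (partA q₂) + ℓ r) (partB-rb q₂)
            (subst (λ r → ℓ (rb ∷ q₂) ≤ ℓ r + ℓ (partB (rb ∷ q₂))) (partA-rb q₂)
              (noStep (rb ∷ q₂) (rb∈ ∷ All.++⁻ʳ q₁ inside)
                (avoid-without (inj₁ refl) ((ra≢rb ∘ sym) ∷ ≢-sym (All.++⁻ʳ q₁ ra∉)))))

        upAlone : ∀ {w} → w ≤ n → ∀ {q} → Within (a ◃ b) (rb ∷ q) (suc w) → ℓ q ≤ alone′ (a ◃ b) ‼ w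
        upAlone {w} w≤n {q} wq with partsEnd q wq | wq
        ... | i , j , refl , wa , wb | within (rb∉ ∷ _) (_ ∷ inside) _ =
          ℕ.≤-trans (noStep q inside (avoid-without (inj₂ refl) (≢-sym rb∉)))
          (ℕ.≤-trans (ℕ.+-mono-≤ (proj₁ (upA i≤n) wa) (proj₂ (proj₂ (upB j≤n)) wb))
            (conv-upper (free′ a) (alone′ b) i j (free< a i≤n) (alone< b w≤n)))
          where
          i≤n = ℕ.m+n≤o⇒m≤o i w≤n
          j≤n = ℕ.m+n≤o⇒n≤o i w≤n

        -- As `rb` stands at the head, a step between the roots can only be the first one. If it
        -- occurs, the remainder lacks `rb`, and its part in b is bounded by `alone`.
        upEnd : ∀ {w} → w ≤ n → ∀ {q} → Within (a ◃ b) (rb ∷ q) (suc w) →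
          ℓ (rb ∷ q) ≤ end′ (a ◃ b) ‼ w
        upEnd {w} w≤n {q} wq@(within (rb∉ ∷ u) (rb∈ ∷ inside) l) = go q refl
          where
          separate : Linked (Avoids ra rb) (rb ∷ q) → ℓ (rb ∷ q) ≤ end′ (a ◃ b) ‼ w
          separate avoid with noStep (rb ∷ q) (rb∈ ∷ inside) avoid | partsEnd q wq
          ... | bound | i , j , refl , wa , wb rewrite partA-rb q | partB-rb q =
            ℕ.≤-trans bound
            (ℕ.≤-trans (ℕ.+-mono-≤ (proj₁ (upA i≤n) wa) (proj₁ (proj₂ (upB j≤n)) wb))
            (ℕ.≤-trans (conv-upper (free′ a) (end′ b) i j (free< a i≤n) (end< b w≤n))
            (ℕ.≤-trans (ℕ.m≤m⊔n _ _) (ℕ.≤-reflexive (sym (end-node a b w≤n))))))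
            where
            i≤n = ℕ.m+n≤o⇒m≤o i w≤n
            j≤n = ℕ.m+n≤o⇒n≤o i w≤n
          go : ∀ q′ → q′ ≡ q → ℓ (rb ∷ q) ≤ end′ (a ◃ b) ‼ w
          go [] refl = separate [-]
          go (x ∷ q′) refl with x Fin.≟ ra
          ... | no x≢ra = separate
            ((ra≢rb ∘ sym ∘ proj₁ , x≢ra ∘ proj₂) ∷ avoid-without (inj₂ refl) (≢-sym rb∉))
          ... | yes refl with partsEndJoined q′ wq | ≢-sym rb∉
          ... | i , j , refl , wa , wb | _ ∷ rb∉q′ = begin
            link G rb ra + ℓ (ra ∷ q′)                      ≡⟨ cong (_+ ℓ (ra ∷ q′)) (link-yes G (adj-sym G adj)) ⟩
            1 + ℓ (ra ∷ q′)                                 ≤⟨ s≤s (noStep (ra ∷ q′) inside (avoid-without (inj₂ refl) (ra≢rb ∷ rb∉q′))) ⟩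
            1 + (ℓ (partA (ra ∷ q′)) + ℓ (partB (ra ∷ q′))) ≡⟨ cong₂ (λ x y → 1 + (ℓ x + ℓ y)) (partA-ra q′) (partB-ra q′) ⟩
            1 + (ℓ (ra ∷ partA q′) + ℓ (partB q′))          ≤⟨ s≤s (ℕ.+-mono-≤ (proj₁ (proj₂ (upA i≤n)) wa) (proj₂ (proj₂ (upB j≤n)) wb)) ⟩
            1 + (end′ a ‼ i + alone′ b ‼ j)                 ≤⟨ s≤s (conv-upper (end′ a) (alone′ b) i j (end< a i≤n) (alone< b ij≤n)) ⟩
            1 + conv (end′ a) (alone′ b) ‼ (i + j)          ≡⟨ ‼-map (conv (end′ a) (alone′ b)) (endalone< a b ij≤n) ⟨
            map (1 +_) (conv (end′ a) (alone′ b)) ‼ (i + j) ≤⟨ ℕ.m≤n⊔m _ _ ⟩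
            conv (free′ a) (end′ b) ‼ suc (i + j) ⊔ map (1 +_) (conv (end′ a) (alone′ b)) ‼ (i + j)
                                                            ≡⟨ end-node a b w≤n ⟨
            end′ (a ◃ b) ‼ suc (i + j)                      ∎
            where
            open ℕ.≤-Reasoning
            ij≤n : i + j ≤ n
            ij≤n = ℕ.≤-trans (ℕ.n≤1+n _) w≤n
            i≤n = ℕ.m+n≤o⇒m≤o i ij≤n
            j≤n = ℕ.m+n≤o⇒n≤o i ij≤n

  bounded : ∀ t → Represents G t → ∀ {w} → w ≤ n →
    (∀ {q} → Within t q w → ℓ q ≤ free′ t ‼ w) ×
    (∀ {q} → Within t (root t ∷ q) (suc w) → ℓ (root t ∷ q) ≤ end′ t ‼ w) ×
    (∀ {q} → Within t (root t ∷ q) (suc w) → ℓ q ≤ alone′ t ‼ w)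
  bounded (leaf x) _ w≤n =
    (λ {q} → single q) , (λ {q} → single (x ∷ q)) , λ {q} w → single q (within-tail w)
    where
    single : ∀ {k c} q → Within (leaf x) q k → ℓ q ≤ c
    single []          _ = z≤n
    single (_ ∷ [])    _ = z≤n
    single (_ ∷ _ ∷ _) (within ((x≢y ∷ _) ∷ _) (here refl ∷ here refl ∷ _) _) = contradiction refl x≢y
  bounded (a ◃ b) (node Ra Rb disj adj cross) w≤n = upFree w≤n , upEnd w≤n , upAlone w≤n
    where
    open Join Ra Rb disj adj cross
    open Bounds (bounded a Ra) (bounded b Rb)

-- Counting vertices, and edges up to orientation

module _ {A : Set} {_≈_ : A → A → Set}
    (≈-sym : ∀ {x y} → x ≈ y → y ≈ x) (≈-trans : ∀ {x y z} → x ≈ y → y ≈ z → x ≈ z) where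

  private
    delete : ∀ {P Q : A → Set} {ys} → (p : Any P ys) → Any Q ys →
      (∀ {y} → P y → ¬ Q y) → Any Q (ys Any.─ p)
    delete (here px)  (here qx) distinct = contradiction qx (distinct px)
    delete (here px)  (there q) distinct = q
    delete (there p)  (here qx) distinct = here qx
    delete (there p)  (there q) distinct = there (delete p q distinct)

    length-─ : ∀ {P : A → Set} {ys} (p : Any P ys) → length ys ≡ suc (length (ys Any.─ p))
    length-─ (here _)  = refl
    length-─ (there p) = cong suc (length-─ p)

  -- The relation is arbitrary so that edges can be counted up to orientation. The partner of `x` is
  -- removed from `ys`; distinctness ensures that no later entry loses its partner.
  pigeonhole : ∀ {xs ys} → AllPairs (λ x y → ¬ x ≈ y) xs → All (λ x → Any (x ≈_) ys) xs →
    length xs ≤ length ys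
  pigeonhole []                 []         = z≤n
  pigeonhole (x≉ ∷ distinct) (x∈ys ∷ xs⊆ys) rewrite length-─ x∈ys =
    s≤s (pigeonhole distinct (All.zipWith (λ { (x≉y , y∈ys) →
      delete x∈ys y∈ys (λ x≈z y≈z → x≉y (≈-trans x≈z (≈-sym y≈z))) }) (x≉ , xs⊆ys)))

unique-length : ∀ {A : Set} {xs ys : List A} → Unique xs → All (_∈ ys) xs → length xs ≤ length ys
unique-length = pigeonhole sym trans

SameEdge : {A : Set} → A × A → A × A → Set
SameEdge (u , v) (x , y) = (u ≡ x × v ≡ y) ⊎ (u ≡ y × v ≡ x)

sameEdge-sym : ∀ {A : Set} {e f : A × A} → SameEdge e f → SameEdge f e
sameEdge-sym (inj₁ (refl , refl)) = inj₁ (refl , refl)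
sameEdge-sym (inj₂ (refl , refl)) = inj₂ (refl , refl)

sameEdge-trans : ∀ {A : Set} {e f g : A × A} → SameEdge e f → SameEdge f g → SameEdge e g
sameEdge-trans (inj₁ (refl , refl)) fg = fg
sameEdge-trans (inj₂ (refl , refl)) (inj₁ (refl , refl)) = inj₂ (refl , refl)
sameEdge-trans (inj₂ (refl , refl)) (inj₂ (refl , refl)) = inj₁ (refl , refl)

Distinct : {A : Set} → List (A × A) → Set
Distinct = AllPairs (λ e f → ¬ SameEdge e f)

length-vertices : ∀ {V : Set} (t : RTree V) → length (vertices t) ≡ suc (length (branches t))
length-vertices (leaf x) = refl
length-vertices (a ◃ b)
  rewrite List.length-++ (vertices a) {vertices b} | List.length-++ (branches a) {branches b}
  | length-vertices a | length-vertices b = cong suc (ℕ.+-suc _ _)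

branches-inside : ∀ {V : Set} (t : RTree V) →
  All (λ (x , y) → x ∈ vertices t × y ∈ vertices t) (branches t)
branches-inside (leaf x) = []
branches-inside (a ◃ b) =
  (∈-++⁺ˡ (root∈vertices a) , ∈-++⁺ʳ (vertices a) (root∈vertices b)) ∷
  All.++⁺ (All.map (λ (x , y) → ∈-++⁺ˡ x , ∈-++⁺ˡ y) (branches-inside a))
    (All.map (λ (x , y) → ∈-++⁺ʳ (vertices a) x , ∈-++⁺ʳ (vertices a) y) (branches-inside b))

conses : Data → ℕ
conses nil     = 0
conses (a ∙ b) = suc (conses a + conses b)

conses-shape : ∀ {V : Set} (t : RTree V) → conses (shape t) ≡ length (branches t)
conses-shape (leaf x) = refl
conses-shape (a ◃ b) = cong suc (trans (cong₂ _+_ (conses-shape a) (conses-shape b))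
  (sym (List.length-++ (branches a))))

module _ {s : ℕ} (G : Graph s) where
  open Graph G using (order; elab; Adj)
  private
    V = Fin order

  vertices-unique : ∀ {t} → Represents G t → Unique (vertices t)
  vertices-unique (leaf x) = [] ∷ []
  vertices-unique (node Ra Rb disj _ _) =
    Unique.++⁺ (vertices-unique Ra) (vertices-unique Rb) (λ (x∈a , x∈b) → disj x∈a x∈b)

  branches-adj : ∀ {t} → Represents G t → All (λ (x , y) → Adj x y) (branches t)
  branches-adj (leaf x) = []
  branches-adj (node Ra Rb _ adj _) = adj ∷ All.++⁺ (branches-adj Ra) (branches-adj Rb)

  -- Together with `branches-adj` and `branches-distinct`, this makes `branches` an enumeration of
  -- the edges within the tree, each once up to orientation.
  branches-complete : ∀ {t} → Represents G t → ∀ {x y} → x ∈ vertices t → y ∈ vertices t →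
    Adj x y → Any (SameEdge (x , y)) (branches t)
  branches-complete (leaf x) (here refl) (here refl) adj
    rewrite Graph.irrefl G x with () ← adj
  branches-complete {a ◃ b} (node Ra Rb disj _ cross) x∈ y∈ adj
    with ∈-++⁻ (vertices a) x∈ | ∈-++⁻ (vertices a) y∈
  ... | inj₁ x∈a | inj₁ y∈a = there (Any.++⁺ˡ (branches-complete Ra x∈a y∈a adj))
  ... | inj₂ x∈b | inj₂ y∈b = there (Any.++⁺ʳ (branches a) (branches-complete Rb x∈b y∈b adj))
  ... | inj₁ x∈a | inj₂ y∈b = here (inj₁ (cross x∈a y∈b adj))
  ... | inj₂ x∈b | inj₁ y∈a with cross y∈a x∈b (adj-sym G adj)
  ... | y≡ , x≡ = here (inj₂ (x≡ , y≡))

  branches-distinct : ∀ {t} → Represents G t → Distinct (branches t)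
  branches-distinct (leaf x) = []
  branches-distinct {a ◃ b} (node Ra Rb disj _ _) =
    All.++⁺ (All.map notA (branches-inside a)) (All.map notB (branches-inside b)) ∷
    AllPairs.++⁺ (branches-distinct Ra) (branches-distinct Rb)
      (All.map (λ in-a → All.map (apart in-a) (branches-inside b)) (branches-inside a))
    where
    notA : ∀ {e} → proj₁ e ∈ vertices a × proj₂ e ∈ vertices a → ¬ SameEdge (root a , root b) e
    notA (_ , y∈a) (inj₁ (_ , refl)) = disj y∈a (root∈vertices b)
    notA (x∈a , _) (inj₂ (_ , refl)) = disj x∈a (root∈vertices b)
    notB : ∀ {e} → proj₁ e ∈ vertices b × proj₂ e ∈ vertices b → ¬ SameEdge (root a , root b) e
    notB (x∈b , _) (inj₁ (refl , _)) = disj (root∈vertices a) x∈b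
    notB (_ , y∈b) (inj₂ (refl , _)) = disj (root∈vertices a) y∈b
    apart : ∀ {e f} → proj₁ e ∈ vertices a × proj₂ e ∈ vertices a →
      proj₁ f ∈ vertices b × proj₂ f ∈ vertices b → ¬ SameEdge e f
    apart (x∈a , _) (x∈b , _) (inj₁ (refl , _)) = disj x∈a x∈b
    apart (x∈a , _) (_ , y∈b) (inj₂ (refl , _)) = disj x∈a y∈b

  -- Depth-first search in an acyclic graph

  Child : V → V → V → Set
  Child u p v = Adj u v × v ≢ p

  child? : ∀ u p v → Dec (Child u p v)
  child? u p v = adj? G u v ×-dec ¬? (v Fin.≟ p)

  mutual
    -- f bounds the depth of the search; p is the parent of u, and p = u at the root.
    searchTree : ℕ → V → V → List V → RTree V
    searchTree f u p []       = leaf u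
    searchTree f u p (v ∷ vs) with child? u p v
    ... | yes _ = subtree f v u ◃ searchTree f u p vs
    ... | no _  = searchTree f u p vs

    subtree : ℕ → V → V → RTree V
    subtree zero    v u = leaf v
    subtree (suc f) v u = searchTree f v u (allFin order)

  root-searchTree : ∀ f u p vs → root (searchTree f u p vs) ≡ u
  root-searchTree f u p []       = refl
  root-searchTree f u p (v ∷ vs) with child? u p v
  ... | yes _ = root-searchTree f u p vs
  ... | no _  = root-searchTree f u p vs

  root-subtree : ∀ f v u → root (subtree f v u) ≡ v
  root-subtree zero    v u = refl
  root-subtree (suc f) v u = root-searchTree f v u (allFin order)

  -- Non-backtracking walks
  data NonBacktracking : List V → Set where
    one  : ∀ {x} → NonBacktracking (x ∷ [])
    two  : ∀ {x y} → Adj x y → NonBacktracking (x ∷ y ∷ [])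
    step : ∀ {x y z l} → Adj x y → x ≢ z → NonBacktracking (y ∷ z ∷ l) →
      NonBacktracking (x ∷ y ∷ z ∷ l)

  private
    adj⇒≢ : ∀ {x y} → Adj x y → x ≢ y
    adj⇒≢ {x} adj refl rewrite Graph.irrefl G x with () ← adj

    Differ : List V → List V → Set
    Differ (x ∷ _) (y ∷ _) = x ≢ y
    Differ _       _       = ⊤

    -- Two walks from `x` with different first steps form one walk through `x`. The entries of `a`
    -- move over one by one, and non-backtracking of `x ∷ a` renews `Differ` at each new pivot.
    glue : ∀ x a b → NonBacktracking (x ∷ a) → NonBacktracking (x ∷ b) → Differ a b →
      NonBacktracking (a ʳ++ (x ∷ b))
    glue x []      b _  nb _  = nb
    glue x (y ∷ a) b na nb ne = glue y a (x ∷ b) (tail na) (extend b (adj-sym G (first na)) nb ne) (differ na)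
      where
      first : ∀ {x y l} → NonBacktracking (x ∷ y ∷ l) → Adj x y
      first (two xy)      = xy
      first (step xy _ _) = xy
      tail : ∀ {x y l} → NonBacktracking (x ∷ y ∷ l) → NonBacktracking (y ∷ l)
      tail (two _)      = one
      tail (step _ _ l) = l
      differ : ∀ {a} → NonBacktracking (x ∷ y ∷ a) → Differ a (x ∷ b)
      differ (two _)       = tt
      differ (step _ ne _) = ne ∘ sym
      extend : ∀ {x y} b → Adj y x → NonBacktracking (x ∷ b) → Differ (y ∷ a) b →
        NonBacktracking (y ∷ x ∷ b)
      extend []      yx _  _  = two yx
      extend (z ∷ b) yx nb ne = step yx ne nb

    linked : ∀ {l} → NonBacktracking l → Linked Adj l
    linked one           = [-]
    linked (two xy)      = xy ∷ [-]
    linked (step xy _ l) = xy ∷ linked l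

    prefix : ∀ {x} l {m} → Linked Adj (l ++ x ∷ m) → Linked Adj (l ∷ʳ x)
    prefix []          _        = [-]
    prefix (y ∷ [])    (p ∷ _)  = p ∷ [-]
    prefix (y ∷ z ∷ l) (p ∷ ps) = p ∷ prefix (z ∷ l) ps

    unique-prefix : ∀ l {m : List V} → Unique (l ++ m) → Unique l
    unique-prefix []      _        = []
    unique-prefix (x ∷ l) (x∉ ∷ u) = All.++⁻ˡ l x∉ ∷ unique-prefix l u

  module _ (acyclic : Acyclic G) where

    -- The tail is repetition-free by induction, so a second occurrence of `x` closes the entries up
    -- to it to a cycle; at least `y` and `z` lie between.
    nonBacktracking⇒unique : ∀ {l} → NonBacktracking l → Unique l
    nonBacktracking⇒unique one      = [] ∷ []
    nonBacktracking⇒unique (two xy) = (adj⇒≢ xy ∷ []) ∷ [] ∷ []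
    nonBacktracking⇒unique nb@(step {x} {y} {z} {l} xy x≢z yz)
      with nonBacktracking⇒unique yz
    ... | u = (adj⇒≢ xy ∷ x≢z ∷ All.¬Any⇒All¬ l x∉l) ∷ u
      where
      x∉l : x ∉ l
      x∉l x∈l with ∈-∃++ x∈l
      ... | l₁ , l₂ , refl = acyclic x (y ∷ z ∷ l₁)
        ( s≤s (s≤s z≤n)
        , ((adj⇒≢ xy ∷ x≢z ∷ All.¬Any⇒All¬ l₁ λ x∈l₁ → apart l₁ u x∈l₁) ∷ unique-prefix (y ∷ z ∷ l₁) u)
        , prefix (x ∷ y ∷ z ∷ l₁) (linked nb))
        where
        apart : ∀ l₁ → Unique (y ∷ z ∷ l₁ ++ x ∷ l₂) → x ∉ l₁
        apart l₁ (_ ∷ _ ∷ u) x∈l₁ = twice l₁ u x∈l₁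
          where
          twice : ∀ l₁ → Unique (l₁ ++ x ∷ l₂) → x ∉ l₁
          twice (w ∷ l₁) (w∉ ∷ u) (here refl) = All.lookup w∉ (∈-++⁺ʳ l₁ (here refl)) refl
          twice (w ∷ l₁) (_ ∷ u)  (there x∈)  = twice l₁ u x∈

    -- If `x` and `y` were adjacent, prepending `y` would give a non-backtracking walk that visits
    -- `y` twice.
    chordless : ∀ {x w l y} → NonBacktracking (x ∷ w ∷ l) → y ∈ l → x ≢ y × ¬ Adj x y
    chordless {x} {w} {l} {y} nb y∈l with nonBacktracking⇒unique nb
    ... | (_ ∷ x∉l) ∷ w∉l ∷ _ = All.lookup x∉l y∈l , λ xy →
      case nonBacktracking⇒unique (step (adj-sym G xy) (λ y≡w → All.lookup w∉l y∈l (sym y≡w)) nb) of λ where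
        ((_ ∷ _ ∷ y∉l) ∷ _) → All.lookup y∉l y∈l refl

    -- Certifies that `x` lies in the branch that leaves `u` through `v`. The last vertex is exposed
    -- in `ends` because it heads the walk when this is reversed.
    record Walk (u v x : V) : Set where
      constructor walk
      field
        {after before}  : List V
        nonBacktracking : NonBacktracking (u ∷ v ∷ after)
        ends            : v ∷ after ≡ before ∷ʳ x

      x∈ : x ∈ v ∷ after
      x∈ = subst (x ∈_) (sym ends) (∈-++⁺ʳ before (here refl))

    walk-≢ : ∀ {u v x} → Walk u v x → u ≢ x
    walk-≢ w with nonBacktracking⇒unique (Walk.nonBacktracking w)
    ... | u∉ ∷ _ = All.lookup u∉ (Walk.x∈ w)

    walk-adj : ∀ {u v x} → Walk u v x → Adj u x → x ≡ v
    walk-adj w@(walk nb _) ux with Walk.x∈ w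
    ... | here x≡v  = x≡v
    ... | there x∈l = contradiction ux (proj₂ (chordless nb x∈l))

    -- The first walk reversed and the second glue at `u` to a walk from `x` that later visits `y`,
    -- with at least one vertex in between; `chordless` applies.
    walks-apart : ∀ {u v v′ x y} → v ≢ v′ → Walk u v x → Walk u v′ y → x ≢ y × ¬ Adj x y
    walks-apart {u} {v} {v′} {x} {y} v≢v′ (walk {l} {m} nb eq) w@(walk {l′} nb′ _) =
      close (subst NonBacktracking (trans (cong (_ʳ++ (u ∷ v′ ∷ l′)) eq) (List.++-ʳ++ m))
        (glue u (v ∷ l) (v′ ∷ l′) nb nb′ v≢v′)) (second m u (v′ ∷ l′) (Walk.x∈ w))
      where
      second : ∀ m u b → y ∈ b → ∃₂ λ w r → m ʳ++ (u ∷ b) ≡ w ∷ r × y ∈ r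
      second []      u b y∈b = u , b , refl , y∈b
      second (w ∷ m) u b y∈b = second m w (u ∷ b) (there y∈b)
      close : ∀ {r} → NonBacktracking (x ∷ r) → ∃₂ (λ w r′ → r ≡ w ∷ r′ × y ∈ r′) → x ≢ y × ¬ Adj x y
      close nb (_ , _ , refl , y∈) = chordless nb y∈

    mutual
      searchTree-walks : ∀ f u p vs {x} → x ∈ vertices (searchTree f u p vs) →
        x ≡ u ⊎ ∃ λ v → v ∈ vs × v ≢ p × Walk u v x
      searchTree-walks f u p []       (here x≡u) = inj₁ x≡u
      searchTree-walks f u p (v ∷ vs) x∈ with child? u p v
      ... | no _ = later (searchTree-walks f u p vs x∈)
      ... | yes (uv , v≢p) with ∈-++⁻ (vertices (subtree f v u)) x∈
      ... | inj₁ x∈v = inj₂ (v , here refl , v≢p , subtree-walks f uv x∈v)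
      ... | inj₂ x∈u = later (searchTree-walks f u p vs x∈u)

      private
        later : ∀ {u p v vs x} → x ≡ u ⊎ (∃ λ w → w ∈ vs × w ≢ p × Walk u w x) →
          x ≡ u ⊎ ∃ λ w → w ∈ v ∷ vs × w ≢ p × Walk u w x
        later (inj₁ x≡u)              = inj₁ x≡u
        later (inj₂ (w , w∈vs , wW)) = inj₂ (w , there w∈vs , wW)

      subtree-walks : ∀ f {u v x} → Adj u v → x ∈ vertices (subtree f v u) → Walk u v x
      subtree-walks zero    uv (here refl) = walk {before = []} (two uv) refl
      subtree-walks (suc f) {u} {v} uv x∈ with searchTree-walks f v u (allFin order) x∈
      ... | inj₁ refl = walk {before = []} (two uv) refl
      ... | inj₂ (w , _ , w≢u , walk {before = m} nb eq) =
        walk {before = v ∷ m} (step uv (w≢u ∘ sym) nb) (cong (v ∷_) eq)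

    mutual
      -- Distinct entries of `vs` are distinct first steps away from `u`, so `walks-apart` separates
      -- the new branch from the later ones, both in vertices and in edges.
      searchTree-represents : ∀ f u p {vs} → Unique vs → Represents G (searchTree f u p vs)
      searchTree-represents f u p {[]}     _ = leaf u
      searchTree-represents f u p {v ∷ vs} (v∉vs ∷ unique) with child? u p v
      ... | no _ = searchTree-represents f u p unique
      ... | yes (uv , _) = node (subtree-represents f v u) (searchTree-represents f u p unique)
        (λ x∈v x∈u → case searchTree-walks f u p vs x∈u of λ where
          (inj₁ refl) → walk-≢ (subtree-walks f uv x∈v) refl
          (inj₂ (w , w∈vs , _ , W)) →
            proj₁ (walks-apart (All.lookup v∉vs w∈vs) (subtree-walks f uv x∈v) W) refl)
        (subst₂ Adj (sym (root-subtree f v u)) (sym (root-searchTree f u p vs)) (adj-sym G uv))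
        (λ x∈v y∈u xy → case searchTree-walks f u p vs y∈u of λ where
          (inj₁ refl) →
            trans (walk-adj (subtree-walks f uv x∈v) (adj-sym G xy)) (sym (root-subtree f v u)) ,
            sym (root-searchTree f u p vs)
          (inj₂ (w , w∈vs , _ , W)) → contradiction xy
            (proj₂ (walks-apart (All.lookup v∉vs w∈vs) (subtree-walks f uv x∈v) W)))

      subtree-represents : ∀ f v u → Represents G (subtree f v u)
      subtree-represents zero    v u = leaf v
      subtree-represents (suc f) v u = searchTree-represents f v u (Unique.allFin⁺ order)

    module _ {f : ℕ} {u p : V} where
      child∈ : ∀ {v vs} → v ∈ vs → Child u p v → v ∈ vertices (searchTree f u p vs)
      child∈ {v} {_ ∷ vs} (here refl) uv with child? u p v
      ... | yes _ = ∈-++⁺ˡ (subst (_∈ vertices (subtree f v u)) (root-subtree f v u)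
                      (root∈vertices (subtree f v u)))
      ... | no ¬uv = contradiction uv ¬uv
      child∈ {v} {w ∷ vs} (there v∈) uv with child? u p w
      ... | yes _ = ∈-++⁺ʳ _ (child∈ v∈ uv)
      ... | no  _ = child∈ v∈ uv

      u∈ : ∀ vs → u ∈ vertices (searchTree f u p vs)
      u∈ vs = subst (_∈ vertices (searchTree f u p vs)) (root-searchTree f u p vs)
        (root∈vertices (searchTree f u p vs))

    -- h is the walk from u back to the root of the search.
    Extends : List V → V → V → Set
    Extends h u p = ∀ {v} → Child u p v → NonBacktracking (v ∷ u ∷ h)

    extend : ∀ {u v h} → NonBacktracking (v ∷ u ∷ h) → Extends (u ∷ h) v u
    extend nb (vw , w≢u) = step (adj-sym G vw) w≢u nb

    extend-root : ∀ {r} → Extends [] r r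
    extend-root (rv , _) = two (adj-sym G rv)

    -- Why the depth bound is never hit: the walk back to the root has no repetitions.
    short-history : ∀ {v l} → NonBacktracking (v ∷ l) → ¬ order ≤ length l
    short-history nb order≤ = ℕ.<-irrefl refl (ℕ.≤-trans
      (ℕ.≤-trans (unique-length (nonBacktracking⇒unique nb) (All.tabulate λ {x} _ → ∈-allFin x))
        (ℕ.≤-reflexive (List.length-tabulate (λ i → i)))) order≤)

    mutual
      -- The vertex `u` is exempt because `vs` may be only the end of its row. Depth spent is
      -- balanced by the growing history: once `f` is used up, `u ∷ h` would be too long for a walk
      -- that can still be extended.
      searchTree-closed : ∀ f {u p h} vs → Extends h u p → order ≤ f + length (u ∷ h) →
        ∀ {x y} → x ∈ vertices (searchTree f u p vs) → Adj x y →
        x ≡ u ⊎ y ∈ vertices (searchTree f u p vs)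
      searchTree-closed f []       ext fuel (here x≡u) xy = inj₁ x≡u
      searchTree-closed f {u} {p} (v ∷ vs) ext fuel x∈ xy with child? u p v
      ... | no _ = searchTree-closed f vs ext fuel x∈ xy
      ... | yes uv with ∈-++⁻ (vertices (subtree f v u)) x∈
      ... | inj₂ x∈u with searchTree-closed f vs ext fuel x∈u xy
      ... | inj₁ x≡u = inj₁ x≡u
      ... | inj₂ y∈  = inj₂ (∈-++⁺ʳ _ y∈)
      searchTree-closed f {u} {p} (v ∷ vs) ext fuel x∈ xy | yes uv | inj₁ x∈v
        with subtree-closed f (ext uv) fuel x∈v xy
      ... | inj₁ refl = inj₂ (∈-++⁺ʳ _ (u∈ vs))
      ... | inj₂ y∈   = inj₂ (∈-++⁺ˡ y∈)

      subtree-closed : ∀ f {u v h} → NonBacktracking (v ∷ u ∷ h) → order ≤ f + length (u ∷ h) →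
        ∀ {x y} → x ∈ vertices (subtree f v u) → Adj x y → y ≡ u ⊎ y ∈ vertices (subtree f v u)
      subtree-closed zero nb fuel = contradiction fuel (short-history nb)
      subtree-closed (suc f) {u} {v} {h} nb fuel {x} {y} x∈ xy
        with searchTree-closed f {v} {u} {u ∷ h} (allFin order) (extend nb)
          (subst (order ≤_) (sym (ℕ.+-suc f _)) fuel) x∈ xy
      ... | inj₂ y∈   = inj₂ y∈
      ... | inj₁ refl with y Fin.≟ u
      ... | yes y≡u = inj₁ y≡u
      ... | no  y≢u = inj₂ (child∈ (∈-allFin y) (xy , y≢u))

    spanningTree : V → RTree V
    spanningTree r = searchTree order r r (allFin order)

    spanningTree-represents : ∀ r → Represents G (spanningTree r)
    spanningTree-represents r = searchTree-represents order r r (Unique.allFin⁺ order)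

    spanningTree-complete : Connected G → ∀ r x → x ∈ vertices (spanningTree r)
    spanningTree-complete connected r x = reach (connected r x) (u∈ (allFin order))
      where
      closed : ∀ {x y} → x ∈ vertices (spanningTree r) → Adj x y → y ∈ vertices (spanningTree r)
      closed {x} {y} x∈ xy with searchTree-closed order {r} {r} {[]} (allFin order)
        extend-root (ℕ.m≤m+n order 1) x∈ xy
      ... | inj₂ y∈   = y∈
      ... | inj₁ refl = child∈ (∈-allFin y) (xy , λ y≡r → adj⇒≢ xy (sym y≡r))
      reach : ∀ {x y} → Star Adj x y → x ∈ vertices (spanningTree r) → y ∈ vertices (spanningTree r)
      reach ε         x∈ = x∈
      reach (xy ◅ ys) x∈ = reach ys (closed x∈ xy)

-- The path as a list of its vertices from end to end

steps : {A : Set} → List A → List (A × A)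
steps []          = []
steps (x ∷ [])    = []
steps (x ∷ y ∷ q) = (x , y) ∷ steps (y ∷ q)

length-steps : ∀ {A : Set} (q : List A) → length (steps q) ≡ pred (length q)
length-steps []          = refl
length-steps (x ∷ [])    = refl
length-steps (x ∷ y ∷ q) = cong suc (length-steps (y ∷ q))

steps-inside : ∀ {A : Set} (q : List A) → All (λ (x , y) → x ∈ q × y ∈ q) (steps q)
steps-inside []          = []
steps-inside (x ∷ [])    = []
steps-inside (x ∷ y ∷ q) = (here refl , there (here refl)) ∷
  All.map (λ (a , b) → there a , there b) (steps-inside (y ∷ q))

steps-distinct : ∀ {A : Set} {q : List A} → Unique q → Distinct (steps q)
steps-distinct []                = []
steps-distinct ([] ∷ _)          = []
steps-distinct {q = x ∷ y ∷ q} (x∉ ∷ unique@(_ ∷ _)) =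
  All.map (λ { (a∈ , b∈) → λ where
      (inj₁ (x≡a , _)) → All.lookup x∉ a∈ x≡a
      (inj₂ (x≡b , _)) → All.lookup x∉ b∈ x≡b })
    (steps-inside (y ∷ q))
  ∷ steps-distinct unique

steps-tabulate : ∀ {A : Set} {k} (f : Fin k → A) {P : A × A → Set} →
  (∀ i j → toℕ j ≡ suc (toℕ i) → P (f i , f j)) → All P (steps (tabulate f))
steps-tabulate {k = zero}        f p = []
steps-tabulate {k = suc zero}    f p = []
steps-tabulate {k = suc (suc k)} f p = p zero (suc zero) refl ∷
  steps-tabulate (λ i → f (suc i)) (λ i j eq → p (suc i) (suc j) (cong suc eq))

∈-steps-tabulate : ∀ {A : Set} {k} (f : Fin k → A) i j → toℕ j ≡ suc (toℕ i) →
  (f i , f j) ∈ steps (tabulate f)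
∈-steps-tabulate {k = suc (suc k)} f zero (suc zero) refl = here refl
∈-steps-tabulate {k = suc (suc k)} f (suc i) (suc j) eq =
  there (∈-steps-tabulate (λ i → f (suc i)) i j (ℕ.suc-injective eq))

record PathList {s} (G : Graph s) : Set where
  open Graph G using (order; Adj)
  field
    list     : List (Fin order)
    unique   : Unique list
    length-list : length list ≡ order
    adjacent : All (λ (u , v) → Adj u v) (steps list)
    complete : ∀ {u v} → Adj u v → Any (SameEdge (u , v)) (steps list)

pathList : ∀ {s} (G : Graph s) → IsPath G → PathList G
pathList G (_ , π , adj⇔) = record
  { list     = tabulate at
  ; unique   = Unique.tabulate⁺ (λ {i} {j} eq →
      trans (sym (inverseʳ π)) (trans (cong (π ⟨$⟩ʳ_) eq) (inverseʳ π)))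
  ; length-list = List.length-tabulate at
  ; adjacent = steps-tabulate at (λ i j eq → Equivalence.from (adj⇔ (at i) (at j))
      (trans (cong₂ (λ a b → ∣ toℕ a - toℕ b ∣) (inverseʳ π) (inverseʳ π)) (consecutive eq)))
  ; complete = λ {u} {v} uv →
      [ (λ eq → Any.map (λ { refl → inj₁ (refl , refl) }) (step∈ u v eq))
      , (λ eq → Any.map (λ { refl → inj₂ (refl , refl) }) (step∈ v u eq)) ]′
        (split (toℕ (π ⟨$⟩ʳ u)) (toℕ (π ⟨$⟩ʳ v)) (Equivalence.to (adj⇔ u v) uv))
  }
  where
  open Graph G using (order; Adj)
  at : Fin order → Fin order
  at = π ⟨$⟩ˡ_
  consecutive : ∀ {a b} → b ≡ suc a → ∣ a - b ∣ ≡ 1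
  consecutive {a} refl = trans (cong ∣ a -_∣ (ℕ.+-comm 1 a)) (ℕ.∣m-m+n∣≡n a 1)
  split : ∀ a b → ∣ a - b ∣ ≡ 1 → b ≡ suc a ⊎ a ≡ suc b
  split zero    b       eq = inj₁ eq
  split (suc a) zero    eq = inj₂ eq
  split (suc a) (suc b) eq = Sum.map (cong suc) (cong suc) (split a b eq)
  step∈ : ∀ u v → toℕ (π ⟨$⟩ʳ v) ≡ suc (toℕ (π ⟨$⟩ʳ u)) → (u , v) ∈ steps (tabulate at)
  step∈ u v eq = subst₂ (λ a b → (a , b) ∈ steps (tabulate at)) (inverseˡ π) (inverseˡ π)
    (∈-steps-tabulate at (π ⟨$⟩ʳ u) (π ⟨$⟩ʳ v) eq)

-- Invariants of edit paths, and which edges they must touch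

just? : ∀ {A : Set} (x : Maybe A) → Dec (Is-just x)
just? = Maybe.dec (λ _ → yes tt)

¬just⇒nothing : ∀ {A : Set} {x : Maybe A} → ¬ Is-just x → x ≡ nothing
¬just⇒nothing {x = nothing} _  = refl
¬just⇒nothing {x = just _}  ¬j = contradiction (just tt) ¬j

nothing⇒¬just : ∀ {A : Set} {x : Maybe A} → x ≡ nothing → ¬ Is-just x
nothing⇒¬just refl ()

is-just-yes : ∀ {A : Set} {x : Maybe A} → Is-just x → is-just x ≡ true
is-just-yes (just _) = refl

is-just-no : ∀ {A : Set} {x : Maybe A} → ¬ Is-just x → is-just x ≡ false
is-just-no ¬j rewrite ¬just⇒nothing ¬j = refl

length-filter-¬ : ∀ {A : Set} {P : A → Set} (P? : ∀ x → Dec (P x)) xs →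
  length (filter (¬? ∘ P?) xs) + length (filter P? xs) ≡ length xs
length-filter-¬ P? []       = refl
length-filter-¬ P? (x ∷ xs) with P? x
... | yes _ = trans (ℕ.+-suc _ _) (cong suc (length-filter-¬ P? xs))
... | no _  = cong suc (length-filter-¬ P? xs)

distinct-map : ∀ {A B : Set} {f : A → B} → (∀ {x y} → f x ≡ f y → x ≡ y) → ∀ {es} →
  Distinct es → Distinct (map (λ (x , y) → f x , f y) es)
distinct-map f-inj distinct = AllPairs.map⁺ (AllPairs₀.map (λ ne eq → ne (reflect eq)) distinct)
  where
  reflect : ∀ {e e′} → SameEdge _ _ → SameEdge e e′
  reflect (inj₁ (p , q)) = inj₁ (f-inj p , f-inj q)
  reflect (inj₂ (p , q)) = inj₂ (f-inj p , f-inj q)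

sameEdge-map : ∀ {A B : Set} {f : A → B} {e e′} → SameEdge e e′ →
  SameEdge (f (proj₁ e) , f (proj₂ e)) (f (proj₁ e′) , f (proj₂ e′))
sameEdge-map (inj₁ (refl , refl)) = inj₁ (refl , refl)
sameEdge-map (inj₂ (refl , refl)) = inj₂ (refl , refl)

if-yes : ∀ {P A : Set} (d : Dec P) {a b : A} → P → (if does d then a else b) ≡ a
if-yes d p rewrite dec-true d p = refl

if-no : ∀ {P A : Set} (d : Dec P) {a b : A} → ¬ P → (if does d then a else b) ≡ b
if-no d ¬p rewrite dec-false d ¬p = refl

module _ {n s : ℕ} where
  open State

  Symmetric : State n s → Set
  Symmetric S = ∀ x y → edge S x y ≡ edge S y x

  record WellFormed (S : State n s) : Set where
    field
      symmetric : Symmetric S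
      endpoints : ∀ {x y} → Is-just (edge S x y) → Is-just (vertex S x)

  samePair-flip : ∀ (u v x y : Name n) → does (samePair? u v x y) ≡ does (samePair? u v y x)
  samePair-flip u v x y =
    does-⇔ (mk⇔ Sum.swap Sum.swap) (samePair? u v x y) (samePair? u v y x)

  setV-hit : ∀ v {a} (S : State n s) → vertex (setV v a S) v ≡ a
  setV-hit v S = if-yes (v ≟ v) refl

  setV-miss : ∀ {v a x} (S : State n s) → v ≢ x → vertex (setV v a S) x ≡ vertex S x
  setV-miss {v} {x = x} S v≢x = if-no (v ≟ x) v≢x

  setE-hit : ∀ {u v a x y} (S : State n s) → SamePair u v x y → edge (setE u v a S) x y ≡ a
  setE-hit {u} {v} {x = x} {y} S same = if-yes (samePair? u v x y) same

  setE-miss : ∀ {u v a x y} (S : State n s) → ¬ SamePair u v x y → edge (setE u v a S) x y ≡ edge S x y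
  setE-miss {u} {v} {x = x} {y} S ¬same = if-no (samePair? u v x y) ¬same

  setE-symmetric : ∀ u v a (S : State n s) → Symmetric S → Symmetric (setE u v a S)
  setE-symmetric u v a S S-sym x y =
    cong₂ (λ b e → if b then a else e) (samePair-flip u v x y) (S-sym x y)

  apply-symmetric : ∀ (S : State n s) o → Symmetric S → Symmetric (apply S o)
  apply-symmetric S (insV _ _)   S-sym = S-sym
  apply-symmetric S (delV _)     S-sym = S-sym
  apply-symmetric S (relV _ _)   S-sym = S-sym
  apply-symmetric S (insE u v a) S-sym = setE-symmetric u v (just a) S S-sym
  apply-symmetric S (delE u v)   S-sym = setE-symmetric u v nothing S S-sym
  apply-symmetric S (relE u v a) S-sym = setE-symmetric u v (just a) S S-sym

  -- The endpoints stay present because a vertex is deleted only when isolated, and an edge is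
  -- inserted only between present vertices.
  apply-wellFormed : ∀ (S : State n s) o → Applicable S o → WellFormed S → WellFormed (apply S o)
  apply-wellFormed S o app wf = record
    { symmetric = apply-symmetric S o symmetric ; endpoints = ends o app }
    where
    open WellFormed wf
    setV-just : ∀ v a x → Is-just (vertex S x) → Is-just (vertex (setV v (just a) S) x)
    setV-just v a x j with v ≟ x
    ... | yes refl = just tt
    ... | no v≢x   = j
    setE-just : ∀ u v a {x y} → Is-just (vertex S u) → Is-just (vertex S v) →
      Is-just (edge (setE u v a S) x y) → Is-just (vertex S x)
    setE-just u v a {x} {y} ju jv e with samePair? u v x y
    ... | yes (inj₁ (refl , _)) = ju
    ... | yes (inj₂ (_ , refl)) = jv
    ... | no ¬same = endpoints (subst Is-just (setE-miss S ¬same) e)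
    delE-just : ∀ u v {x y} → Is-just (edge (setE u v nothing S) x y) → Is-just (vertex S x)
    delE-just u v {x} {y} e with samePair? u v x y
    ... | yes same = contradiction e (nothing⇒¬just (setE-hit S same))
    ... | no ¬same = endpoints (subst Is-just (setE-miss S ¬same) e)
    ends : ∀ o → Applicable S o → ∀ {x y} → Is-just (edge (apply S o) x y) → Is-just (vertex (apply S o) x)
    ends (insV v a) _ {x} e = setV-just v a x (endpoints e)
    ends (relV v a) _ {x} e = setV-just v a x (endpoints e)
    ends (delV v) (_ , isolated) {x} {y} e with v ≟ x
    ... | yes refl = contradiction e (nothing⇒¬just (isolated y))
    ... | no _     = endpoints e
    ends (insE u v a) (_ , ju , jv , _) e = setE-just u v (just a) ju jv e
    ends (delE u v) _ e = delE-just u v e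
    ends (relE u v a) (b , eq , _) e = setE-just u v (just a) (endpoints uv)
      (endpoints (subst Is-just (symmetric u v) uv)) e
      where
      uv : Is-just (edge S u v)
      uv = subst Is-just (sym eq) (just tt)

  foldl-wellFormed : ∀ os (S : State n s) → AllApplicable S os → WellFormed S →
    WellFormed (foldl apply S os)
  foldl-wellFormed []       S _            wf = wf
  foldl-wellFormed (o ∷ os) S (app , apps) wf =
    foldl-wellFormed os (apply S o) apps (apply-wellFormed S o app wf)

  -- The operations of cost 1. Edge relabelings are left out: they do not change adjacency.
  edgeTargets : List (Op n s) → List (Name n × Name n)
  edgeTargets []                = []
  edgeTargets (insE u v _ ∷ os) = (u , v) ∷ edgeTargets os
  edgeTargets (delE u v ∷ os)   = (u , v) ∷ edgeTargets os
  edgeTargets (_ ∷ os)          = edgeTargets os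

  private
    untouched : ∀ {u v a} (S : State n s) {x y} → ¬ SameEdge (x , y) (u , v) →
      edge (setE u v a S) x y ≡ edge S x y
    untouched S ¬same = setE-miss S (¬same ∘ sameEdge-sym)

    sameEdge? : ∀ (e f : Name n × Name n) → Dec (SameEdge e f)
    sameEdge? (u , v) (x , y) = samePair? u v x y

  -- Only insertions and deletions change whether a pair is an edge, since a relabeled edge is
  -- present both before and after. Symmetry covers pairs named in the opposite order.
  untargeted : ∀ os (S : State n s) → AllApplicable S os → WellFormed S → ∀ x y →
    Any (SameEdge (x , y)) (edgeTargets os) ⊎
    is-just (edge S x y) ≡ is-just (edge (foldl apply S os) x y)
  untargeted [] S _ wf x y = inj₂ refl
  untargeted (o ∷ os) S (app , apps) wf x y = combine o app
    (untargeted os (apply S o) apps (apply-wellFormed S o app wf) x y)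
    where
    combine : ∀ o → Applicable S o →
      Any (SameEdge (x , y)) (edgeTargets os) ⊎
        is-just (edge (apply S o) x y) ≡ is-just (edge (foldl apply (apply S o) os) x y) →
      Any (SameEdge (x , y)) (edgeTargets (o ∷ os)) ⊎
        is-just (edge S x y) ≡ is-just (edge (foldl apply (apply S o) os) x y)
    combine (insV _ _) _ r = r
    combine (delV _)   _ r = r
    combine (relV _ _) _ r = r
    combine (insE u v a) _ (inj₁ any) = inj₁ (there any)
    combine (insE u v a) _ (inj₂ eq) with sameEdge? (x , y) (u , v)
    ... | yes same = inj₁ (here same)
    ... | no ¬same = inj₂ (trans (cong is-just (sym (untouched {u} {v} {just a} S ¬same))) eq)
    combine (delE u v) _ (inj₁ any) = inj₁ (there any)
    combine (delE u v) _ (inj₂ eq) with sameEdge? (x , y) (u , v)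
    ... | yes same = inj₁ (here same)
    ... | no ¬same = inj₂ (trans (cong is-just (sym (untouched {u} {v} {nothing} S ¬same))) eq)
    combine (relE u v a) _ (inj₁ any) = inj₁ any
    combine (relE u v a) (b , uv , _) (inj₂ eq) = inj₂ (trans relabelled eq)
      where
      relabelled : is-just (edge S x y) ≡ is-just (edge (setE u v (just a) S) x y)
      relabelled with samePair? u v x y
      ... | no ¬same = cong is-just (sym (setE-miss S ¬same))
      ... | yes same = trans (before same) (cong is-just (sym (setE-hit S same)))
        where
        before : SamePair u v x y → is-just (edge S x y) ≡ true
        before (inj₁ (refl , refl)) = cong is-just uv
        before (inj₂ (refl , refl)) = cong is-just (trans (WellFormed.symmetric wf x y) uv)

record UnitEdgeCosts (C : CostFunction) : Set where
  open CostFunction C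
  field
    vIns≡0 : vIns ≡ [ 0 ]
    vDel≡0 : vDel ≡ [ 0 ]
    eIns≡1 : eIns ≡ [ 1 ]
    eDel≡1 : eDel ≡ [ 1 ]

edgeTargets≤pathCost : ∀ {n s C} → UnitEdgeCosts C → (os : List (Op n s)) →
  [ length (edgeTargets os) ] ≤⁺ pathCost C os
edgeTargets≤pathCost {C = C} unit = bound
  where
  open UnitEdgeCosts unit
  free : ∀ d {k c} → [ k ] ≤⁺ c → [ k ] ≤⁺ d +⁺ c
  free ⊤⁺    _       = _ ≤⊤⁺
  free [ d ] [ k≤c ] = [ ℕ.≤-trans k≤c (ℕ.m≤n+m _ d) ]
  free [ d ] (_ ≤⊤⁺) = _ ≤⊤⁺
  charged : ∀ {d k c} → d ≡ [ 1 ] → [ k ] ≤⁺ c → [ suc k ] ≤⁺ d +⁺ c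
  charged refl [ k≤c ] = [ s≤s k≤c ]
  charged refl (_ ≤⊤⁺) = _ ≤⊤⁺
  bound : ∀ os → [ length (edgeTargets os) ] ≤⁺ pathCost C os
  bound []                = [ z≤n ]
  bound (insV _ _ ∷ os)   = free _ (bound os)
  bound (delV _ ∷ os)     = free _ (bound os)
  bound (relV _ _ ∷ os)   = free _ (bound os)
  bound (insE _ _ _ ∷ os) = charged eIns≡1 (bound os)
  bound (delE _ _ ∷ os)   = charged eDel≡1 (bound os)
  bound (relE _ _ _ ∷ os) = free _ (bound os)

any-filter : ∀ {A : Set} {P Q : A → Set} (Q? : ∀ x → Dec (Q x)) → (∀ {x} → P x → Q x) → ∀ {xs} →
  Any P xs → Any P (filter Q? xs)
any-filter Q? P⇒Q {x ∷ xs} (here px) rewrite List.filter-accept Q? {xs = xs} (P⇒Q px) = here px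
any-filter Q? P⇒Q {x ∷ xs} (there p) with does (Q? x)
... | true  = there (any-filter Q? P⇒Q p)
... | false = any-filter Q? P⇒Q p

module _ {n s : ℕ} where
  open State

  edgeAt : State n s → Name n × Name n → Maybe (Fin s)
  edgeAt S (x , y) = edge S x y

  edgeAt-cong : ∀ S → Symmetric S → ∀ {e f} → SameEdge e f → edgeAt S e ≡ edgeAt S f
  edgeAt-cong S S-sym (inj₁ (refl , refl)) = refl
  edgeAt-cong S S-sym (inj₂ (refl , refl)) = S-sym _ _

initial-wellFormed : ∀ {s} (G : Graph s) → WellFormed (initial G)
initial-wellFormed G = record
  { symmetric = λ { (inj₁ u) (inj₁ v) → Graph.sym G u v
                  ; (inj₁ _) (inj₂ _) → refl
                  ; (inj₂ _) (inj₁ _) → refl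
                  ; (inj₂ _) (inj₂ _) → refl }
  ; endpoints = λ { {inj₁ u} {inj₁ v} _ → just tt }
  }

initial-edge : ∀ {s} (G : Graph s) {e} → Is-just (edgeAt (initial G) e) →
  ∃₂ λ u v → e ≡ (inj₁ u , inj₁ v) × Graph.Adj G u v
initial-edge G {inj₁ u , inj₁ v} adj = u , v , refl , adj

module Preimage {m n : ℕ} (name : Fin m → Name n) (injective : Injective _≡_ _≡_ name) where

  preimage : Name n → Maybe (Fin m)
  preimage x with Fin.any? (λ i → name i ≟ x)
  ... | yes (i , _) = just i
  ... | no _        = nothing

  preimage-just : ∀ {x i} → preimage x ≡ just i → name i ≡ x
  preimage-just {x} eq with Fin.any? (λ i → name i ≟ x)
  preimage-just refl | yes (i , name-i) = name-i

  preimage-name : ∀ i → preimage (name i) ≡ just i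
  preimage-name i with Fin.any? (λ j → name j ≟ name i)
  ... | yes (j , eq) = cong just (injective eq)
  ... | no none      = contradiction (i , refl) none

-- The lower bound on every restricted edit path

module Distance {s : ℕ} (G₁ G₂ : Graph s) (path : PathList G₁)
    (t : RTree (Fin (Graph.order G₂))) (rep : Represents G₂ t)
    (total : ∀ x → x ∈ vertices t) where

  open State
  open Graph G₁ using () renaming (order to n)
  open Graph G₂ using () renaming (order to m)
  open PathList path renaming (list to ps)

  pathEdges : List (Name n × Name n)
  pathEdges = map (λ (u , v) → inj₁ u , inj₁ v) (steps ps)

  treeEdges : (Fin m → Name n) → List (Name n × Name n)
  treeEdges name = map (λ (i , j) → name i , name j) (branches t)

  pathEdges-distinct : Distinct pathEdges
  pathEdges-distinct = distinct-map inj₁-injective (steps-distinct unique)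

  ∈-pathEdges : ∀ {e} → e ∈ pathEdges → Is-just (edgeAt (initial G₁) e)
  ∈-pathEdges e∈ with ∈-map⁻ _ e∈
  ... | (u , v) , uv∈ , refl = All.lookup adjacent uv∈

  pathEdges-complete : ∀ {u v} → Graph.Adj G₁ u v → Any (SameEdge (inj₁ u , inj₁ v)) pathEdges
  pathEdges-complete uv = Any.map⁺ (Any.map sameEdge-map (complete uv))

  length-pathEdges : length pathEdges ≡ pred n
  length-pathEdges = trans (List.length-map _ (steps ps))
    (trans (length-steps ps) (cong pred length-list))

  length-treeEdges : ∀ name → length (treeEdges name) ≡ pred m
  length-treeEdges name = trans (List.length-map _ (branches t))
    (cong pred (trans (sym (length-vertices t)) length-total))
    where
    length-allFin : length (allFin m) ≡ m
    length-allFin = List.length-tabulate (λ i → i)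
    length-total : length (vertices t) ≡ m
    length-total = ℕ.≤-antisym
      (subst (length (vertices t) ≤_) length-allFin
        (unique-length (vertices-unique G₂ rep) (All.tabulate λ {x} _ → ∈-allFin x)))
      (subst (_≤ length (vertices t)) length-allFin
        (unique-length (Unique.allFin⁺ m) (All.tabulate λ {x} _ → total x)))

  module Compare (S : State n s) (iso : S ≅ G₂) (wf : WellFormed S) where
    open _≅_ iso
    open WellFormed wf

    old? : ∀ e → Dec (Is-just (edgeAt (initial G₁) e))
    old? e = just? (edgeAt (initial G₁) e)

    kept? : ∀ e → Dec (Is-just (edgeAt S e))
    kept? e = just? (edgeAt S e)

    deleted kept inserted common : List (Name n × Name n)
    deleted  = filter (¬? ∘ kept?) pathEdges
    kept     = filter kept? pathEdges
    inserted = filter (¬? ∘ old?) (treeEdges name)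
    common   = filter old? (treeEdges name)

    treeEdges-distinct : Distinct (treeEdges name)
    treeEdges-distinct = distinct-map injective (branches-distinct G₂ rep)

    ∈-treeEdges : ∀ {e} → e ∈ treeEdges name → Is-just (edgeAt S e)
    ∈-treeEdges e∈ with ∈-map⁻ _ e∈
    ... | (i , j) , ij∈ , refl = subst Is-just (sym (edges i j)) (All.lookup (branches-adj G₂ rep) ij∈)

    treeEdges-complete : ∀ {e} → Is-just (edgeAt S e) → Any (SameEdge e) (treeEdges name)
    treeEdges-complete {x , y} xy
      with surjective x (endpoints xy) | surjective y (endpoints (subst Is-just (symmetric x y) xy))
    ... | i , refl | j , refl = Any.map⁺ (Any.map sameEdge-map
      (branches-complete G₂ rep (total i) (total j) (subst Is-just (edges i j) xy)))

    -- Path edges that are still present and tree edges that were present initially are the same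
    -- edges up to orientation. So one number is subtracted from both edge counts.
    length-kept : length kept ≡ length common
    length-kept = ℕ.≤-antisym
      (pigeonhole sameEdge-sym sameEdge-trans (AllPairs.filter⁺ kept? pathEdges-distinct)
        (All.tabulate λ {e} e∈ → let e∈path , e-kept = ∈-filter⁻ kept? {xs = pathEdges} e∈ in
          any-filter old?
            (λ same → subst Is-just (edgeAt-cong (initial G₁) (WellFormed.symmetric (initial-wellFormed G₁)) same)
              (∈-pathEdges e∈path))
            (treeEdges-complete {e} e-kept)))
      (pigeonhole sameEdge-sym sameEdge-trans (AllPairs.filter⁺ old? treeEdges-distinct)
        (All.tabulate λ {e} e∈ → let e∈tree , e-old = ∈-filter⁻ old? {xs = treeEdges name} e∈ in
          any-filter kept?
            (λ same → subst Is-just (edgeAt-cong S symmetric same) (∈-treeEdges e∈tree))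
            (old-complete {e} e-old)))
      where
      old-complete : ∀ {e} → Is-just (edgeAt (initial G₁) e) → Any (SameEdge e) pathEdges
      old-complete {e} e-old with initial-edge G₁ {e} e-old
      ... | u , v , refl , uv = pathEdges-complete uv

    length-deleted : length deleted ≡ pred n ∸ length kept
    length-deleted = trans (sym (ℕ.m+n∸n≡m _ (length kept)))
      (cong (_∸ length kept) (trans (length-filter-¬ kept? pathEdges) length-pathEdges))

    length-inserted : length inserted ≡ pred m ∸ length kept
    length-inserted = trans (sym (ℕ.m+n∸n≡m _ (length common)))
      (cong₂ _∸_ (trans (length-filter-¬ old? (treeEdges name)) (length-treeEdges name)) (sym length-kept))

    open Preimage name injective using (preimage; preimage-just; preimage-name)

    survivors : List (Fin n) → List (Fin m)
    survivors = mapMaybe (λ u → preimage (inj₁ u))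

    ∈-survivors : ∀ us {i} → i ∈ survivors us → ∃ λ u → u ∈ us × name i ≡ inj₁ u
    ∈-survivors (u ∷ us) i∈ with preimage (inj₁ u) in eq
    ... | nothing = let v , v∈ , name-i = ∈-survivors us i∈ in v , there v∈ , name-i
    ∈-survivors (u ∷ us) (here refl) | just i = u , here refl , preimage-just eq
    ∈-survivors (u ∷ us) (there i∈)  | just _ =
      let v , v∈ , name-i = ∈-survivors us i∈ in v , there v∈ , name-i

    survivors-unique : ∀ {us} → Unique us → Unique (survivors us)
    survivors-unique {[]}     []            = []
    survivors-unique {u ∷ us} (u∉ ∷ us-unique) with preimage (inj₁ u) in eq
    ... | nothing = survivors-unique us-unique
    ... | just i  = All.tabulate (λ j∈ i≡j → let v , v∈ , name-j = ∈-survivors us j∈ in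
        All.lookup u∉ v∈ (inj₁-injective
          (trans (sym (preimage-just eq)) (trans (cong name i≡j) name-j))))
      ∷ survivors-unique us-unique

    keptAlong : List (Fin n) → List (Name n × Name n)
    keptAlong us = filter kept? (map (λ (u , v) → inj₁ u , inj₁ v) (steps us))

    -- A kept edge has two surviving ends, which stay consecutive when the other vertices are
    -- dropped; dropping can only bring in further links.
    kept≤links : ∀ us → length (keptAlong us) ≤ links G₂ (survivors us)
    kept≤links []          = z≤n
    kept≤links (u ∷ [])    = z≤n
    kept≤links (u ∷ v ∷ us) with kept? (inj₁ u , inj₁ v) | kept≤links (v ∷ us)
    ... | no _ | ih = ℕ.≤-trans ih (grow (preimage (inj₁ u)) refl)
      where
      grow : ∀ p → p ≡ preimage (inj₁ u) → links G₂ (survivors (v ∷ us)) ≤ links G₂ (survivors (u ∷ v ∷ us))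
      grow nothing  eq rewrite sym eq = ℕ.≤-refl
      grow (just i) eq rewrite sym eq = links-∷ G₂ i (survivors (v ∷ us))
    ... | yes uv | ih
      with surjective (inj₁ u) (endpoints uv)
         | surjective (inj₁ v) (endpoints (subst Is-just (symmetric _ _) uv))
    ... | i , name-i | j , name-j
      rewrite trans (cong preimage (sym name-i)) (preimage-name i)
            | trans (cong preimage (sym name-j)) (preimage-name j)
            | link-yes G₂ (subst Is-just (trans (cong₂ (edge S) (sym name-i) (sym name-j)) (edges i j)) uv)
      = s≤s ih

  -- A pair that is an edge in only one of the initial and the final graph must be inserted or
  -- deleted, and distinct pairs require distinct operations of cost 1.
  lowerBound : ∀ {C} → UnitEdgeCosts C → ∀ {opt} →
    (∀ {q} → Unique q → length q ≤ n → links G₂ q ≤ opt) →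
    (γ : RestrictedEditPath G₁ G₂) →
    [ (pred n ∸ opt) + (pred m ∸ opt) ] ≤⁺ pathCost C (RestrictedEditPath.ops γ)
  lowerBound {C} unit {opt} optimal γ = ≤⁺-trans ℕ.≤-trans [ bound ] (edgeTargets≤pathCost unit ops)
    where
    open RestrictedEditPath γ
    S = foldl apply (initial G₁) ops
    open Compare S result (foldl-wellFormed ops (initial G₁) applicable (initial-wellFormed G₁))
    open _≅_ result using (name)

    kept≤opt : length kept ≤ opt
    kept≤opt = ℕ.≤-trans (kept≤links ps) (optimal (survivors-unique unique)
      (ℕ.≤-trans (List.length-mapMaybe _ ps) (ℕ.≤-reflexive length-list)))

    targeted : ∀ {e} → is-just (edgeAt (initial G₁) e) ≢ is-just (edgeAt S e) →
      Any (SameEdge e) (edgeTargets ops)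
    targeted {x , y} differ with untargeted ops (initial G₁) applicable (initial-wellFormed G₁) x y
    ... | inj₁ any = any
    ... | inj₂ eq  = contradiction eq differ

    differ-yes-no : ∀ {A : Set} {x y : Maybe A} → Is-just x → ¬ Is-just y → is-just x ≢ is-just y
    differ-yes-no jx ¬jy eq with trans (sym (is-just-yes jx)) (trans eq (is-just-no ¬jy))
    ... | ()

    bound : (pred n ∸ opt) + (pred m ∸ opt) ≤ length (edgeTargets ops)
    bound = begin
      (pred n ∸ opt) + (pred m ∸ opt)                   ≤⟨ ℕ.+-mono-≤ (ℕ.∸-monoʳ-≤ (pred n) kept≤opt) (ℕ.∸-monoʳ-≤ (pred m) kept≤opt) ⟩
      (pred n ∸ length kept) + (pred m ∸ length kept)   ≡⟨ cong₂ _+_ length-deleted length-inserted ⟨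
      length deleted + length inserted                  ≡⟨ List.length-++ deleted ⟨
      length (deleted ++ inserted)                      ≤⟨ pigeonhole sameEdge-sym sameEdge-trans changed-distinct changed-targeted ⟩
      length (edgeTargets ops)                          ∎
      where
      open ℕ.≤-Reasoning
      ∈-deleted : ∀ {e} → e ∈ deleted → Is-just (edgeAt (initial G₁) e) × ¬ Is-just (edgeAt S e)
      ∈-deleted e∈ = let e∈path , gone = ∈-filter⁻ (¬? ∘ kept?) {xs = pathEdges} e∈ in
        ∈-pathEdges e∈path , gone
      ∈-inserted : ∀ {e} → e ∈ inserted → Is-just (edgeAt S e) × ¬ Is-just (edgeAt (initial G₁) e)
      ∈-inserted e∈ = let e∈tree , new = ∈-filter⁻ (¬? ∘ old?) {xs = treeEdges name} e∈ in
        ∈-treeEdges e∈tree , new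
      changed-distinct : Distinct (deleted ++ inserted)
      changed-distinct = AllPairs.++⁺
        (AllPairs.filter⁺ (¬? ∘ kept?) pathEdges-distinct)
        (AllPairs.filter⁺ (¬? ∘ old?) treeEdges-distinct)
        (All.tabulate λ e∈ → All.tabulate λ f∈ same →
          proj₂ (∈-inserted f∈) (subst Is-just
            (edgeAt-cong (initial G₁) (WellFormed.symmetric (initial-wellFormed G₁)) same) (proj₁ (∈-deleted e∈))))
      changed-targeted : All (λ e → Any (SameEdge e) (edgeTargets ops)) (deleted ++ inserted)
      changed-targeted = All.++⁺
        (All.tabulate λ e∈ → let old , gone = ∈-deleted e∈ in targeted (differ-yes-no old gone))
        (All.tabulate λ e∈ → let kept , new = ∈-inserted e∈ in
          targeted (λ eq → differ-yes-no kept new (sym eq)))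

-- Edits towards a target state

Item : ℕ → Set
Item n = Name n ⊎ (Name n × Name n)

module _ {n s : ℕ} where
  open State

  value : State n s → Item n → Maybe (Fin s)
  value S (inj₁ x) = vertex S x
  value S (inj₂ e) = edgeAt S e

  set : Item n → Maybe (Fin s) → State n s → State n s
  set (inj₁ x)       = setV x
  set (inj₂ (x , y)) = setE x y

  sameTarget-sym : ∀ {z i : Item n} → SameTarget {n} {s} z i → SameTarget {n} {s} i z
  sameTarget-sym {inj₁ x} {inj₁ y} eq   = sym eq
  sameTarget-sym {inj₂ e} {inj₂ f} same = sameEdge-sym same

  sameTarget-trans : ∀ {z i j : Item n} → SameTarget {n} {s} z i → SameTarget {n} {s} i j →
    SameTarget {n} {s} z j
  sameTarget-trans {inj₁ x} {inj₁ y} {inj₁ z} eq   eq′   = trans eq eq′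
  sameTarget-trans {inj₂ e} {inj₂ f} {inj₂ g} same same′ = sameEdge-trans same same′

  sameTarget? : ∀ (z i : Item n) → Dec (SameTarget {n} {s} z i)
  sameTarget? (inj₁ x)       (inj₁ y)         = x ≟ y
  sameTarget? (inj₂ (u , v)) (inj₂ (x , y))   = samePair? u v x y
  sameTarget? (inj₁ x)       (inj₂ e)         = no λ ()
  sameTarget? (inj₂ e)       (inj₁ x)         = no λ ()

  value-cong : ∀ S → Symmetric S → ∀ {z i} → SameTarget {n} {s} z i → value S z ≡ value S i
  value-cong S S-sym {inj₁ x} {inj₁ y} eq   = cong (vertex S) eq
  value-cong S S-sym {inj₂ e} {inj₂ f} same = edgeAt-cong S S-sym same

  value-set-hit : ∀ z {a} S {i} → SameTarget {n} {s} z i → value (set z a S) i ≡ a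
  value-set-hit (inj₁ x)       S {inj₁ _} refl = setV-hit x S
  value-set-hit (inj₂ (x , y)) S {inj₂ _} same = setE-hit S same

  value-set-miss : ∀ z {a} S {i} → ¬ SameTarget {n} {s} z i → value (set z a S) i ≡ value S i
  value-set-miss (inj₁ x)       S {inj₁ _} ne    = setV-miss S ne
  value-set-miss (inj₂ (x , y)) S {inj₂ _} ¬same = setE-miss S ¬same
  value-set-miss (inj₁ x)       S {inj₂ _} _     = refl
  value-set-miss (inj₂ (x , y)) S {inj₁ _} _     = refl

  relabel : Item n → Fin s → Op n s
  relabel (inj₁ x)       b = relV x b
  relabel (inj₂ (x , y)) b = relE x y b

  edit : Item n → Maybe (Fin s) → Maybe (Fin s) → List (Op n s)
  edit z              nothing  nothing  = []
  edit (inj₁ x)       nothing  (just b) = insV x b ∷ []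
  edit (inj₁ x)       (just a) nothing  = delV x ∷ []
  edit (inj₂ (x , y)) nothing  (just b) = insE x y b ∷ []
  edit (inj₂ (x , y)) (just a) nothing  = delE x y ∷ []
  edit z              (just a) (just b) with b Fin.≟ a
  ... | yes _ = []
  ... | no _  = relabel z b ∷ []

  -- Hides which of the six operations occurs: an edit does nothing, or is one operation that sets
  -- `z` to the wanted value.
  data EditView (z : Item n) (a b : Maybe (Fin s)) : List (Op n s) → Set where
    keep   : a ≡ b → EditView z a b []
    change : ∀ o → target o ≡ z → (∀ S → apply S o ≡ set z b S) → EditView z a b (o ∷ [])

  editView : ∀ z a b → EditView z a b (edit z a b)
  editView (inj₁ x)       nothing  nothing  = keep refl
  editView (inj₂ e)       nothing  nothing  = keep refl
  editView (inj₁ x)       nothing  (just b) = change _ refl λ _ → refl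
  editView (inj₁ x)       (just a) nothing  = change _ refl λ _ → refl
  editView (inj₂ (x , y)) nothing  (just b) = change _ refl λ _ → refl
  editView (inj₂ (x , y)) (just a) nothing  = change _ refl λ _ → refl
  editView (inj₁ x) (just a) (just b) with b Fin.≟ a
  ... | yes refl = keep refl
  ... | no _     = change _ refl λ _ → refl
  editView (inj₂ (x , y)) (just a) (just b) with b Fin.≟ a
  ... | yes refl = keep refl
  ... | no _     = change _ refl λ _ → refl

  edit-hit : ∀ z {b} T → Symmetric T → ∀ {i} → SameTarget {n} {s} z i →
    value (foldl apply T (edit z (value T z) b)) i ≡ b
  edit-hit z {b} T T-sym {i} same with edit z (value T z) b | editView z (value T z) b
  ... | _ | keep eq         = trans (sym (value-cong T T-sym same)) eq
  ... | _ | change o _ sets = trans (cong (λ S → value S i) (sets T)) (value-set-hit z T same)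

  edit-miss : ∀ z a b T {i} → ¬ SameTarget {n} {s} z i →
    value (foldl apply T (edit z a b)) i ≡ value T i
  edit-miss z a b T {i} ¬same with edit z a b | editView z a b
  ... | _ | keep _          = refl
  ... | _ | change o _ sets = trans (cong (λ S → value S i) (sets T)) (value-set-miss z T ¬same)

  foldl-symmetric : ∀ os (T : State n s) → Symmetric T → Symmetric (foldl apply T os)
  foldl-symmetric []       T T-sym = T-sym
  foldl-symmetric (o ∷ os) T T-sym = foldl-symmetric os (apply T o) (apply-symmetric T o T-sym)

  allApplicable-++ : ∀ os {os′} (T : State n s) → AllApplicable T os →
    AllApplicable (foldl apply T os) os′ → AllApplicable T (os ++ os′)
  allApplicable-++ []       T _            apps′ = apps′
  allApplicable-++ (o ∷ os) T (app , apps) apps′ = app , allApplicable-++ os (apply T o) apps apps′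

  DistinctItems : List (Item n) → Set
  DistinctItems = AllPairs (λ z i → ¬ SameTarget {n} {s} z i)

  module Edits (S S′ : State n s) where

    editItem : Item n → List (Op n s)
    editItem z = edit z (value S z) (value S′ z)

    edits : List (Item n) → List (Op n s)
    edits = concatMap editItem

    edits-miss : ∀ Z T {i} → All (λ z → ¬ SameTarget {n} {s} z i) Z →
      value (foldl apply T (edits Z)) i ≡ value T i
    edits-miss []      T []            = refl
    edits-miss (z ∷ Z) T {i} (z≁i ∷ Z≁i) = trans
      (cong (λ T′ → value T′ i) (List.foldl-++ apply T (editItem z) (edits Z)))
      (trans (edits-miss Z _ Z≁i) (edit-miss z (value S z) (value S′ z) T z≁i))

    -- Edits are read off from `S` but carried out in later states `T`; the value at the item itself
    -- must not have changed in between.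
    Untouched : State n s → Item n → Set
    Untouched T z = value T z ≡ value S z

    edits-hit : Symmetric S′ → ∀ {Z} T → DistinctItems Z → All (Untouched T) Z → Symmetric T →
      ∀ {i} → Any (λ z → SameTarget {n} {s} z i) Z →
      value (foldl apply T (edits Z)) i ≡ value S′ i
    edits-hit S′-sym {z ∷ Z} T (z≁ ∷ distinct) (Tz ∷ TZ) T-sym {i} any =
      trans (cong (λ T′ → value T′ i) (List.foldl-++ apply T (editItem z) (edits Z))) (found any)
      where
      T₁ = foldl apply T (editItem z)
      found : Any (λ z → SameTarget {n} {s} z i) (z ∷ Z) →
        value (foldl apply T₁ (edits Z)) i ≡ value S′ i
      found (here same) = trans
        (edits-miss Z T₁ (All.map (λ z≁z′ same′ →
          z≁z′ (sameTarget-trans {z} {i} same (sameTarget-sym same′))) z≁))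
        (trans (subst (λ a → value (foldl apply T (edit z a (value S′ z))) i ≡ value S′ z) Tz
            (edit-hit z T T-sym same))
          (value-cong S′ S′-sym same))
      found (there any) = edits-hit S′-sym T₁ distinct
        (All.zipWith (λ (z≁z′ , Tz′) → trans (edit-miss z (value S z) (value S′ z) T z≁z′) Tz′) (z≁ , TZ))
        (foldl-symmetric (editItem z) T T-sym) any

    -- What an edit requires of the rest of the current state T.
    Allowed : State n s → Item n → Set
    Allowed T (inj₁ x)       = Is-just (vertex S x) → vertex S′ x ≡ nothing → ∀ y → edge T x y ≡ nothing
    Allowed T (inj₂ (x , y)) = edge S x y ≡ nothing → Is-just (edge S′ x y) →
      x ≢ y × Is-just (vertex T x) × Is-just (vertex T y)

    edit-applicable : ∀ z T → Untouched T z → Allowed T z → AllApplicable T (editItem z)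
    edit-applicable (inj₁ x) T Tz ok with vertex S x | vertex S′ x
    ... | nothing | nothing = tt
    ... | nothing | just b  = Tz , tt
    ... | just a  | nothing = (subst Is-just (sym Tz) (just tt) , ok (just tt) refl) , tt
    ... | just a  | just b with b Fin.≟ a
    ... | yes _  = tt
    ... | no b≢a = (a , Tz , b≢a) , tt
    edit-applicable (inj₂ (x , y)) T Tz ok with edge S x y | edge S′ x y
    ... | nothing | nothing = tt
    ... | nothing | just b  = let x≢y , jx , jy = ok refl (just tt) in (x≢y , jx , jy , Tz) , tt
    ... | just a  | nothing = subst Is-just (sym Tz) (just tt) , tt
    ... | just a  | just b with b Fin.≟ a
    ... | yes _  = tt
    ... | no b≢a = (a , Tz , b≢a) , tt

    -- Each item must be allowed in the state that the earlier edits leave behind. All that is known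
    -- of such a state is its agreement with `T` outside `Z`.
    edits-applicable : ∀ {Z} T → DistinctItems Z → All (Untouched T) Z →
      (∀ T′ → (∀ {i} → All (λ z → ¬ SameTarget {n} {s} z i) Z → value T′ i ≡ value T i) →
        All (Allowed T′) Z) →
      AllApplicable T (edits Z)
    edits-applicable {[]}    T _               _         allowed = tt
    edits-applicable {z ∷ Z} T (z≁ ∷ distinct) (Tz ∷ TZ) allowed = allApplicable-++ (editItem z) T
      (edit-applicable z T Tz (All.head (allowed T λ _ → refl)))
      (edits-applicable T₁ distinct
        (All.zipWith (λ (z≁z′ , Tz′) → trans (edit-miss z (value S z) (value S′ z) T z≁z′) Tz′) (z≁ , TZ))
        (λ T′ agree → All.tail (allowed T′ λ { (z≁i ∷ Z≁i) →
          trans (agree Z≁i) (edit-miss z (value S z) (value S′ z) T z≁i) })))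
      where
      T₁ = foldl apply T (editItem z)

    edits-targets : ∀ Z → All (λ o → target o ∈ Z) (edits Z)
    edits-targets []      = []
    edits-targets (z ∷ Z) = All.++⁺ first (All.map there (edits-targets Z))
      where
      first : All (λ o → target o ∈ z ∷ Z) (editItem z)
      first with editItem z | editView z (value S z) (value S′ z)
      ... | _ | keep _        = []
      ... | _ | change o eq _ = here eq ∷ []

    edits-once : ∀ {Z} → DistinctItems Z → EditedAtMostOnce (edits Z)
    edits-once []                          = []
    edits-once {z ∷ Z} (z≁ ∷ distinct)
      with editItem z | editView z (value S z) (value S′ z)
    ... | _ | keep _          = edits-once distinct
    ... | _ | change o refl _ =
      All.map (λ o′∈Z → All.lookup z≁ o′∈Z) (edits-targets Z) ∷ edits-once distinct

+⁺-assoc : ∀ a b c → (a +⁺ b) +⁺ c ≡ a +⁺ (b +⁺ c)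
+⁺-assoc ⊤⁺    _     _     = refl
+⁺-assoc [ _ ] ⊤⁺    _     = refl
+⁺-assoc [ _ ] [ _ ] ⊤⁺    = refl
+⁺-assoc [ a ] [ b ] [ c ] = cong [_] (ℕ.+-assoc a b c)

+⁺-identityˡ : ∀ a → [ 0 ] +⁺ a ≡ a
+⁺-identityˡ ⊤⁺    = refl
+⁺-identityˡ [ _ ] = refl

pathCost-++ : ∀ {n s} C (os os′ : List (Op n s)) →
  pathCost C (os ++ os′) ≡ pathCost C os +⁺ pathCost C os′
pathCost-++ C []       os′ = sym (+⁺-identityˡ _)
pathCost-++ C (o ∷ os) os′ = trans (cong (opCost C o +⁺_) (pathCost-++ C os os′))
  (sym (+⁺-assoc (opCost C o) _ _))

-- Vacuous for a single label, so that C-E is covered in the unlabeled case.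
FreeRelabelling : ℕ → CostFunction → Set
FreeRelabelling s C = ∀ {a b : Fin s} → a ≢ b → vRel ≡ [ 0 ] × eRel ≡ [ 0 ]
  where open CostFunction C

module _ {n s C} (unit : UnitEdgeCosts C) (free : FreeRelabelling s C) (S S′ : State n s) where
  open Edits S S′
  open UnitEdgeCosts unit

  vertexEdits-cost : ∀ xs → pathCost C (edits (map inj₁ xs)) ≡ [ 0 ]
  vertexEdits-cost []       = refl
  vertexEdits-cost (x ∷ xs) = trans (pathCost-++ C (editItem (inj₁ x)) _)
    (cong₂ _+⁺_ cost (vertexEdits-cost xs))
    where
    cost : pathCost C (editItem (inj₁ x)) ≡ [ 0 ]
    cost with State.vertex S x | State.vertex S′ x
    ... | nothing | nothing = refl
    ... | nothing | just _ rewrite vIns≡0 = refl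
    ... | just _ | nothing rewrite vDel≡0 = refl
    ... | just a | just b with b Fin.≟ a
    ... | yes _ = refl
    ... | no b≢a rewrite proj₁ (free b≢a) = refl

  deletions-cost : ∀ es → All (λ e → Is-just (edgeAt S e) × ¬ Is-just (edgeAt S′ e)) es →
    pathCost C (edits (map inj₂ es)) ≡ [ length es ]
  deletions-cost []       []             = refl
  deletions-cost (e ∷ es) ((old , gone) ∷ olds) = trans (pathCost-++ C (editItem (inj₂ e)) _)
    (cong₂ _+⁺_ cost (deletions-cost es olds))
    where
    cost : pathCost C (editItem (inj₂ e)) ≡ [ 1 ]
    cost with edgeAt S e | edgeAt S′ e
    ... | just _ | nothing rewrite eDel≡1 = refl
    ... | just _ | just _ = contradiction (just tt) gone
    cost | nothing | _ = case old of λ ()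

  -- Meant for the list of all tree edges: those already present are kept or relabeled for free, and
  -- only the others are charged.
  insertions-cost : ∀ es → All (λ e → Is-just (edgeAt S′ e)) es →
    pathCost C (edits (map inj₂ es)) ≡ [ length (filter (λ e → ¬? (just? (edgeAt S e))) es) ]
  insertions-cost []       []           = refl
  insertions-cost (e ∷ es) (new ∷ news) = trans (pathCost-++ C (editItem (inj₂ e)) _)
    (trans (cong (_ +⁺_) (insertions-cost es news)) cost)
    where
    old? : ∀ e → Dec (Is-just (edgeAt S e))
    old? e = just? (edgeAt S e)
    cost : pathCost C (editItem (inj₂ e)) +⁺ [ length (filter (¬? ∘ old?) es) ] ≡
      [ length (filter (¬? ∘ old?) (e ∷ es)) ]
    cost with edgeAt S e | edgeAt S′ e
    ... | nothing | just _ rewrite eIns≡1 = refl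
    ... | just a | just b with b Fin.≟ a
    ... | yes _ = refl
    ... | no b≢a rewrite proj₂ (free b≢a) = refl
    cost | _ | nothing = case new of λ ()

private
  anyOrAll : ∀ {A : Set} {P : A → Set} → (∀ x → Dec (P x)) → ∀ xs → Any P xs ⊎ All (λ x → ¬ P x) xs
  anyOrAll P? xs with Any.any? P? xs
  ... | yes any = inj₁ any
  ... | no none = inj₂ (All.¬Any⇒All¬ xs none)

-- An edit path that realises a given list of tree vertices

module Construction {s : ℕ} (G₁ G₂ : Graph s) (path : PathList G₁)
    (t : RTree (Fin (Graph.order G₂))) (rep : Represents G₂ t)
    (total : ∀ x → x ∈ vertices t) where

  open State
  open Graph G₁ using () renaming (order to n)
  open Graph G₂ using () renaming (order to m; vlab to vlab₂; elab to elab₂)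
  open PathList path renaming (list to ps)
  open Distance G₁ G₂ path t rep total

  -- Places the list `q` on the first vertices of the path; a tree vertex outside `q` becomes an
  -- inserted vertex, with its own number as name.
  align : List (Fin n) → List (Fin m) → Fin m → Name n
  align (u ∷ us) (x ∷ q) j = if does (j Fin.≟ x) then inj₁ u else align us q j
  align _        _       j = inj₂ (toℕ j)

  align-inj₁ : ∀ us q {j u} → align us q j ≡ inj₁ u → u ∈ us
  align-inj₁ (v ∷ us) (x ∷ q) {j} eq with does (j Fin.≟ x)
  align-inj₁ (v ∷ us) (x ∷ q) refl | true = here refl
  align-inj₁ (v ∷ us) (x ∷ q) eq | false = there (align-inj₁ us q eq)

  align-injective : ∀ us q → Unique us → ∀ {i j} → align us q i ≡ align us q j → i ≡ j
  align-injective []       q       _ eq = Fin.toℕ-injective (inj₂-injective eq)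
  align-injective (u ∷ us) []      _ eq = Fin.toℕ-injective (inj₂-injective eq)
  align-injective (u ∷ us) (x ∷ q) (u∉ ∷ us-unique) {i} {j} eq with i Fin.≟ x | j Fin.≟ x
  ... | yes i≡x | yes j≡x = trans i≡x (sym j≡x)
  ... | yes _   | no _    = contradiction refl (All.lookup u∉ (align-inj₁ us q (sym eq)))
  ... | no _    | yes _   = contradiction refl (All.lookup u∉ (align-inj₁ us q eq))
  ... | no _    | no _    = align-injective us q us-unique eq

  align-fresh : ∀ us q j → (∃ λ u → align us q j ≡ inj₁ u) ⊎ align us q j ≡ inj₂ (toℕ j)
  align-fresh []       q       j = inj₂ refl
  align-fresh (u ∷ us) []      j = inj₂ refl
  align-fresh (u ∷ us) (x ∷ q) j with does (j Fin.≟ x)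
  ... | true  = inj₁ (u , refl)
  ... | false = align-fresh us q j

  data Aligned (name : Fin m → Name n) : List (Fin n) → List (Fin m) → Set where
    []  : ∀ {us} → Aligned name us []
    _∷_ : ∀ {u us x q} → name x ≡ inj₁ u → Aligned name us q → Aligned name (u ∷ us) (x ∷ q)

  aligned : ∀ us q → Unique q → length q ≤ length us → Aligned (align us q) us q
  aligned us       []      _                _            = []
  aligned (u ∷ us) (x ∷ q) (x∉ ∷ q-unique) (s≤s ∣q∣≤) =
    if-yes (x Fin.≟ x) refl ∷
    shift (All.map (λ x≢y y≡x → x≢y (sym y≡x)) x∉) (aligned us q q-unique ∣q∣≤)
    where
    shift : ∀ {us′ q′} → All (λ y → y ≢ x) q′ →
      Aligned (align us q) us′ q′ → Aligned (align (u ∷ us) (x ∷ q)) us′ q′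
    shift _           []       = []
    shift (y≢x ∷ q≢x) (eq ∷ a) = trans (if-no (_ Fin.≟ x) y≢x) eq ∷ shift q≢x a

  module _ (q : List (Fin m)) (q-unique : Unique q) (short : length q ≤ n) where

    name : Fin m → Name n
    name = align ps q

    open Preimage name (align-injective ps q unique)

    final : State n s
    final = state (λ x → Maybe₀.map vlab₂ (preimage x))
      (λ x y → preimage x >>= λ i → preimage y >>= λ j → elab₂ i j)

    final-edge : ∀ i j → edge final (name i) (name j) ≡ elab₂ i j
    final-edge i j rewrite preimage-name i | preimage-name j = refl

    final-wellFormed : WellFormed final
    final-wellFormed = record { symmetric = symmetric′ ; endpoints = λ {x} {y} → endpoints′ x y }
      where
      symmetric′ : Symmetric final
      symmetric′ x y with preimage x | preimage y
      ... | just i  | just j  = Graph.sym G₂ i j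
      ... | just _  | nothing = refl
      ... | nothing | just _  = refl
      ... | nothing | nothing = refl
      endpoints′ : ∀ x y → Is-just (edge final x y) → Is-just (vertex final x)
      endpoints′ x y e with preimage x
      ... | just _ = just tt

    final-vertex : ∀ x → Is-just (vertex final x) → ∃ λ i → name i ≡ x
    final-vertex x j with preimage x in eq
    ... | just i = i , preimage-just eq

    isomorphic : ∀ {S} → (∀ x → vertex S x ≡ vertex final x) →
      (∀ x y → edge S x y ≡ edge final x y) → S ≅ G₂
    isomorphic eqV eqE = record
      { name       = name
      ; injective  = align-injective ps q unique
      ; surjective = λ x j → final-vertex x (subst Is-just (eqV x) j)
      ; vertices   = λ i → trans (eqV (name i)) (cong (Maybe₀.map vlab₂) (preimage-name i))
      ; edges      = λ i j → trans (eqE (name i) (name j)) (final-edge i j)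
      }

    open Compare final (isomorphic (λ _ → refl) (λ _ _ → refl)) final-wellFormed
    open Edits (initial G₁) final
    open WellFormed

    -- Consecutive entries of `q` are placed on consecutive path vertices, so each link of `q` is a
    -- path edge that is also present in `final`.
    links≤kept : links G₂ q ≤ length kept
    links≤kept = go ps q (aligned ps q q-unique (subst (length q ≤_) (sym length-list) short))
      where
      go : ∀ us r → Aligned name us r → links G₂ r ≤ length (keptAlong us)
      go us              []          _                = z≤n
      go (u ∷ us)        (x ∷ [])    _                = z≤n
      go (u ∷ v ∷ us)    (x ∷ y ∷ r) (name-x ∷ al@(name-y ∷ _))
        with go (v ∷ us) (y ∷ r) al | kept? (inj₁ u , inj₁ v) | adj? G₂ x y
      ... | ih | yes _ | yes _ = s≤s ih
      ... | ih | yes _ | no _  = ℕ.m≤n⇒m≤1+n ih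
      ... | ih | no _  | no _  = ih
      ... | ih | no ¬e | yes xy = contradiction
        (subst Is-just (trans (sym (final-edge x y)) (cong₂ (edge final) name-x name-y)) xy) ¬e

    -- Covers every name present in the initial or the final state. A listed name that is absent
    -- from both yields the empty edit.
    names : List (Name n)
    names = map inj₁ (allFin n) ++ map (λ i → inj₂ (toℕ i)) (allFin m)

    names-unique : Unique names
    names-unique = Unique.++⁺
      (Unique.map⁺ inj₁-injective (Unique.allFin⁺ n))
      (Unique.map⁺ (λ eq → Fin.toℕ-injective (inj₂-injective eq)) (Unique.allFin⁺ m))
      (λ (x∈ , y∈) → apart (∈-map⁻ inj₁ x∈) (∈-map⁻ _ y∈))
      where
      apart : ∀ {x : Name n} → (∃ λ u → u ∈ allFin n × x ≡ inj₁ u) →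
        ¬ ∃ λ i → i ∈ allFin m × x ≡ inj₂ (toℕ i)
      apart (_ , _ , refl) (_ , _ , ())

    old∈names : ∀ u → inj₁ u ∈ names
    old∈names u = ∈-++⁺ˡ (∈-map⁺ inj₁ (∈-allFin u))

    name∈names : ∀ i → name i ∈ names
    name∈names i with align-fresh ps q i
    ... | inj₁ (u , eq) = subst (_∈ names) (sym eq) (old∈names u)
    ... | inj₂ eq = subst (_∈ names) (sym eq) (∈-++⁺ʳ _ (∈-map⁺ _ (∈-allFin i)))

    -- The order makes the edits applicable: obsolete edges go before the vertices, so that deleted
    -- vertices are isolated, and tree edges come last, when their ends exist.
    items₁ items₂ items₃ : List (Item n)
    items₁ = map inj₂ deleted
    items₂ = map inj₁ names
    items₃ = map inj₂ (treeEdges name)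

    ∈-deleted : ∀ {e} → e ∈ deleted → Is-just (edgeAt (initial G₁) e) × ¬ Is-just (edgeAt final e)
    ∈-deleted e∈ = let e∈path , gone = ∈-filter⁻ (¬? ∘ kept?) {xs = pathEdges} e∈ in
      ∈-pathEdges e∈path , gone

    deleted-complete : ∀ e → Is-just (edgeAt (initial G₁) e) → ¬ Is-just (edgeAt final e) →
      Any (λ f → SameEdge f e) deleted
    deleted-complete e old gone with initial-edge G₁ {e} old
    ... | u , v , refl , uv = Any.map sameEdge-sym (any-filter (¬? ∘ kept?)
      (λ same → gone ∘ subst Is-just (sym (edgeAt-cong final (symmetric final-wellFormed) same)))
      (pathEdges-complete uv))

    distinct₁ : DistinctItems {n} {s} items₁
    distinct₁ = AllPairs.map⁺ (AllPairs.filter⁺ (¬? ∘ kept?) pathEdges-distinct)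

    distinct₂ : DistinctItems {n} {s} items₂
    distinct₂ = AllPairs.map⁺ names-unique

    distinct₃ : DistinctItems {n} {s} items₃
    distinct₃ = AllPairs.map⁺ treeEdges-distinct

    distinctAll : DistinctItems {n} {s} (items₁ ++ items₂ ++ items₃)
    distinctAll = AllPairs.++⁺ distinct₁
      (AllPairs.++⁺ distinct₂ distinct₃ (All.map⁺ (All.tabulate λ _ → All.map⁺ (All.tabulate λ _ ()))))
      (All.map⁺ (All.tabulate λ e∈ → All.++⁺
        (All.map⁺ (All.tabulate λ _ ()))
        (All.map⁺ (All.tabulate λ f∈ same → proj₂ (∈-deleted e∈)
          (subst Is-just (sym (edgeAt-cong final (symmetric final-wellFormed) same)) (∈-treeEdges f∈))))))

    S₁ S₂ S₃ : State n s
    S₁ = foldl apply (initial G₁) (edits items₁)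
    S₂ = foldl apply S₁ (edits items₂)
    S₃ = foldl apply S₂ (edits items₃)

    S₁-symmetric : Symmetric S₁
    S₁-symmetric = foldl-symmetric (edits items₁) (initial G₁) (symmetric (initial-wellFormed G₁))

    S₁-vertex : ∀ x → vertex S₁ x ≡ vertex (initial G₁) x
    S₁-vertex x = edits-miss items₁ (initial G₁) {inj₁ x} (All.map⁺ (All.tabulate λ _ ()))

    S₁-deleted : ∀ e → Any (λ f → SameEdge f e) deleted → edgeAt S₁ e ≡ edgeAt final e
    S₁-deleted e any = edits-hit (symmetric final-wellFormed) (initial G₁) distinct₁
      (All.tabulate λ _ → refl) (symmetric (initial-wellFormed G₁)) {inj₂ e} (Any.map⁺ any)

    S₁-undeleted : ∀ e → All (λ f → ¬ SameEdge f e) deleted → edgeAt S₁ e ≡ edgeAt (initial G₁) e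
    S₁-undeleted e none = edits-miss items₁ (initial G₁) {inj₂ e} (All.map⁺ none)

    -- Supplies the isolation needed in the vertex phase: a vertex absent from `final` has no edge
    -- there, hence none after the deletions.
    S₁-new : ∀ e → ¬ Is-just (edgeAt final e) → edgeAt S₁ e ≡ nothing
    S₁-new e gone with anyOrAll (λ f → samePair? (proj₁ f) (proj₂ f) (proj₁ e) (proj₂ e)) deleted
    ... | inj₁ any  = trans (S₁-deleted e any) (¬just⇒nothing gone)
    ... | inj₂ none = trans (S₁-undeleted e none)
      (¬just⇒nothing λ old → All.All¬⇒¬Any none (deleted-complete e old gone))

    S₂-edge : ∀ e → edgeAt S₂ e ≡ edgeAt S₁ e
    S₂-edge e = edits-miss items₂ S₁ {inj₂ e} (All.map⁺ (All.tabulate λ _ ()))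

    S₂-vertex : ∀ {x} → x ∈ names → vertex S₂ x ≡ vertex final x
    S₂-vertex {x} x∈ = edits-hit (symmetric final-wellFormed) S₁ distinct₂
      (All.map⁺ (All.tabulate λ {y} _ → S₁-vertex y)) S₁-symmetric {inj₁ x}
      (Any.map⁺ (Any.map sym x∈))

    S₂-vertex-other : ∀ {x} → All (λ y → ¬ y ≡ x) names → vertex S₂ x ≡ vertex (initial G₁) x
    S₂-vertex-other {x} x∉ = trans (edits-miss items₂ S₁ {inj₁ x} (All.map⁺ x∉)) (S₁-vertex x)

    treeEdges-untouched : All (λ e → edgeAt S₂ e ≡ edgeAt (initial G₁) e) (treeEdges name)
    treeEdges-untouched = All.tabulate λ {e} e∈ → trans (S₂-edge e) (S₁-undeleted e
      (All.tabulate λ f∈ same → proj₂ (∈-deleted f∈)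
        (subst Is-just (sym (edgeAt-cong final (symmetric final-wellFormed) same)) (∈-treeEdges e∈))))

    editPath-applicable : AllApplicable (initial G₁) (edits items₁ ++ edits items₂ ++ edits items₃)
    editPath-applicable = allApplicable-++ (edits items₁) (initial G₁)
      (edits-applicable (initial G₁) distinct₁ (All.tabulate λ _ → refl)
        (λ T _ → All.map⁺ (All.tabulate λ {e} e∈ _ new → contradiction new (proj₂ (∈-deleted e∈)))))
      (allApplicable-++ (edits items₂) S₁
        (edits-applicable S₁ distinct₂ (All.map⁺ (All.tabulate λ {y} _ → S₁-vertex y))
          (λ T agree → All.map⁺ (All.tabulate λ {x} _ _ gone y →
            trans (agree {inj₂ (x , y)} (All.map⁺ (All.tabulate λ _ ())))
              (S₁-new (x , y) λ e → nothing⇒¬just gone (endpoints final-wellFormed e)))))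
        (edits-applicable S₂ distinct₃ (All.map⁺ treeEdges-untouched)
          (λ T agree → All.map⁺ (All.tabulate λ {e} e∈ _ _ → allowed T agree (∈-map⁻ _ e∈)))))
      where
      allowed : ∀ T → (∀ {i} → All (λ z → ¬ SameTarget {n} {s} z i) items₃ → value T i ≡ value S₂ i) →
        ∀ {x y} → (∃ λ (ij : Fin m × Fin m) → ij ∈ branches t × (x , y) ≡ (name (proj₁ ij) , name (proj₂ ij))) →
        x ≢ y × Is-just (vertex T x) × Is-just (vertex T y)
      allowed T agree ((i , j) , ij∈ , refl) =
        (λ eq → loop (subst (Graph.Adj G₂ i) (sym (align-injective ps q unique eq))
          (All.lookup (branches-adj G₂ rep) ij∈))) , present i , present j
        where
        loop : ¬ Graph.Adj G₂ i i
        loop = nothing⇒¬just (Graph.irrefl G₂ i)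
        present : ∀ i → Is-just (vertex T (name i))
        present i = subst Is-just (sym (trans (agree {inj₁ (name i)} (All.map⁺ (All.tabulate λ _ ())))
          (trans (S₂-vertex (name∈names i)) (cong (Maybe₀.map vlab₂) (preimage-name i))))) (just tt)

    S₃-vertex : ∀ x → vertex S₃ x ≡ vertex final x
    S₃-vertex x = trans (edits-miss items₃ S₂ {inj₁ x} (All.map⁺ (All.tabulate λ _ ())))
      (known (anyOrAll (_≟ x) names))
      where
      known : Any (_≡ x) names ⊎ All (λ y → ¬ y ≡ x) names → vertex S₂ x ≡ vertex final x
      known (inj₁ any) = S₂-vertex (Any.map sym any)
      known (inj₂ x∉)  = trans (S₂-vertex-other x∉) (trans (absent x x∉) (sym (¬just⇒nothing λ j →
        let i , eq = final-vertex x j in All.lookup x∉ (name∈names i) eq)))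
        where
        absent : ∀ x → All (λ y → ¬ y ≡ x) names → vertex (initial G₁) x ≡ nothing
        absent (inj₁ u) x∉ = contradiction refl (All.lookup x∉ (old∈names u))
        absent (inj₂ _) _  = refl

    S₃-edge : ∀ e → edgeAt S₃ e ≡ edgeAt final e
    S₃-edge e with anyOrAll (λ f → samePair? (proj₁ f) (proj₂ f) (proj₁ e) (proj₂ e)) (treeEdges name)
    ... | inj₁ any = edits-hit (symmetric final-wellFormed) S₂ distinct₃
      (All.map⁺ treeEdges-untouched) (foldl-symmetric (edits items₂) S₁ S₁-symmetric) {inj₂ e} (Any.map⁺ any)
    ... | inj₂ none = trans (edits-miss items₃ S₂ {inj₂ e} (All.map⁺ none))
      (trans (S₂-edge e) (trans (S₁-new e gone) (sym (¬just⇒nothing gone))))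
      where
      gone : ¬ Is-just (edgeAt final e)
      gone new = All.All¬⇒¬Any none (Any.map sameEdge-sym (treeEdges-complete {e} new))

    editPath : RestrictedEditPath G₁ G₂
    editPath = record
      { ops        = edits items₁ ++ edits items₂ ++ edits items₃
      ; applicable = editPath-applicable
      ; once       = subst EditedAtMostOnce
          (trans (List.concatMap-++ editItem items₁ (items₂ ++ items₃))
            (cong (edits items₁ ++_) (List.concatMap-++ editItem items₂ items₃)))
          (edits-once distinctAll)
      ; result     = subst (_≅ G₂)
          (sym (trans (List.foldl-++ apply (initial G₁) (edits items₁) _)
            (List.foldl-++ apply S₁ (edits items₂) (edits items₃))))
          (isomorphic S₃-vertex (λ x y → S₃-edge (x , y)))
      }

    editPath-cost : ∀ {C} → UnitEdgeCosts C → FreeRelabelling s C →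
      pathCost C (RestrictedEditPath.ops editPath) ≡ [ (pred n ∸ length kept) + (pred m ∸ length kept) ]
    editPath-cost {C} unit free = trans (pathCost-++ C (edits items₁) _)
      (trans (cong₂ _+⁺_
        (deletions-cost unit free (initial G₁) final deleted (All.tabulate ∈-deleted))
        (trans (pathCost-++ C (edits items₂) _) (cong₂ _+⁺_
          (vertexEdits-cost unit free (initial G₁) final names)
          (insertions-cost unit free (initial G₁) final (treeEdges name) (All.tabulate ∈-treeEdges)))))
        (cong [_] (cong₂ _+_ length-deleted length-inserted)))

  isGED : ∀ {C} → UnitEdgeCosts C → FreeRelabelling s C → ∀ {opt} →
    (∃ λ q → Unique q × length q ≤ n × opt ≤ links G₂ q) →
    (∀ {q} → Unique q → length q ≤ n → links G₂ q ≤ opt) →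
    IsGED C G₁ G₂ [ (pred n ∸ opt) + (pred m ∸ opt) ]
  isGED {C} unit free {opt} (q , q-unique , short , opt≤) optimal =
    (editPath q q-unique short ,
      -- The constructed path keeps at least `opt` edges, so it is no dearer than claimed; the lower
      -- bound turns this into equality.
      antisym (editPath-cost q q-unique short unit free)
        (lowerBound unit optimal (editPath q q-unique short))
        (ℕ.+-mono-≤ (ℕ.∸-monoʳ-≤ (pred n) opt≤kept) (ℕ.∸-monoʳ-≤ (pred m) opt≤kept))) ,
    lowerBound unit optimal
    where
    opt≤kept = ℕ.≤-trans opt≤ (links≤kept q q-unique short)
    antisym : ∀ {a b c} → a ≡ [ b ] → [ c ] ≤⁺ a → b ≤ c → a ≡ [ c ]
    antisym refl [ c≤b ] b≤c = cong [_] (ℕ.≤-antisym b≤c c≤b)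

-- Polynomials in one variable with natural coefficients

infixl 6 _:+_
infixl 7 _:*_
data Poly : Set where
  con       : ℕ → Poly
  X         : Poly
  _:+_ _:*_ : Poly → Poly → Poly

⟦_⟧ : Poly → ℕ → ℕ
⟦ con c ⟧  N = c
⟦ X ⟧      N = N
⟦ p :+ q ⟧ N = ⟦ p ⟧ N + ⟦ q ⟧ N
⟦ p :* q ⟧ N = ⟦ p ⟧ N * ⟦ q ⟧ N

-- A single monomial that dominates the polynomial at every N ≥ 1. The exponents of a sum are added,
-- which is crude but bounds both of them.
coefficient exponent : Poly → ℕ
coefficient (con c)  = c
coefficient X        = 1
coefficient (p :+ q) = coefficient p + coefficient q
coefficient (p :* q) = coefficient p * coefficient q
exponent (con c)  = 0
exponent X        = 1
exponent (p :+ q) = exponent p + exponent q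
exponent (p :* q) = exponent p + exponent q

poly-bound : ∀ p N .{{_ : NonZero N}} → ⟦ p ⟧ N ≤ coefficient p * N ^ exponent p
poly-bound (con c)  N = ℕ.≤-reflexive (sym (ℕ.*-identityʳ c))
poly-bound X        N = ℕ.≤-reflexive (sym (trans (ℕ.*-identityˡ _) (ℕ.*-identityʳ N)))
poly-bound (p :+ q) N = begin
  ⟦ p ⟧ N + ⟦ q ⟧ N                                      ≤⟨ ℕ.+-mono-≤ (poly-bound p N) (poly-bound q N) ⟩
  coefficient p * N ^ exponent p + coefficient q * N ^ exponent q
    ≤⟨ ℕ.+-mono-≤ (ℕ.*-monoʳ-≤ (coefficient p) (ℕ.^-monoʳ-≤ N (ℕ.m≤m+n (exponent p) (exponent q))))
                  (ℕ.*-monoʳ-≤ (coefficient q) (ℕ.^-monoʳ-≤ N (ℕ.m≤n+m (exponent q) (exponent p)))) ⟩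
  coefficient p * N ^ e + coefficient q * N ^ e          ≡⟨ ℕ.*-distribʳ-+ (N ^ e) (coefficient p) _ ⟨
  (coefficient p + coefficient q) * N ^ e                ∎
  where
  open ℕ.≤-Reasoning
  e = exponent p + exponent q
poly-bound (p :* q) N = begin
  ⟦ p ⟧ N * ⟦ q ⟧ N                                      ≤⟨ ℕ.*-mono-≤ (poly-bound p N) (poly-bound q N) ⟩
  (coefficient p * N ^ exponent p) * (coefficient q * N ^ exponent q)
                                                         ≡⟨ rearrange (coefficient p) (N ^ exponent p) _ _ ⟩
  coefficient p * coefficient q * (N ^ exponent p * N ^ exponent q)
                                                         ≡⟨ cong (coefficient p * coefficient q *_) (ℕ.^-distribˡ-+-* N (exponent p) _) ⟨
  coefficient p * coefficient q * N ^ (exponent p + exponent q) ∎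
  where
  open ℕ.≤-Reasoning
  rearrange : ∀ a b c d → (a * b) * (c * d) ≡ a * c * (b * d)
  rearrange = solve-∀

-- The program

pattern plusF   = zero
pattern maxF    = suc plusF
pattern mapF    = suc maxF
pattern mergeF  = suc mapF
pattern convF   = suc mergeF
pattern zerosF  = suc convF
pattern joinF   = suc zerosF
pattern tablesF = suc joinF
pattern lastF   = suc tablesF
pattern monusF  = suc lastF
pattern equalF  = suc monusF
pattern nthF    = suc equalF
pattern searchF = suc nthF

arities : Fin 13 → ℕ
arities = Vec.lookup (2 ∷ 2 ∷ 2 ∷ 2 ∷ 2 ∷ 1 ∷ 2 ∷ 2 ∷ 1 ∷ 2 ∷ 2 ∷ 2 ∷ 5 ∷ [])

Tm : ℕ → Set
Tm = Term arities

v0 : ∀ {k} → Tm (1 + k)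
v0 = var zero
v1 : ∀ {k} → Tm (2 + k)
v1 = var (suc zero)
v2 : ∀ {k} → Tm (3 + k)
v2 = var (suc (suc zero))
v3 : ∀ {k} → Tm (4 + k)
v3 = var (suc (suc (suc zero)))
v4 : ∀ {k} → Tm (5 + k)
v4 = var (suc (suc (suc (suc zero))))
v5 : ∀ {k} → Tm (6 + k)
v5 = var (suc (suc (suc (suc (suc zero)))))
v6 : ∀ {k} → Tm (7 + k)
v6 = var (suc (suc (suc (suc (suc (suc zero))))))
v7 : ∀ {k} → Tm (8 + k)
v7 = var (suc (suc (suc (suc (suc (suc (suc zero)))))))
v8 : ∀ {k} → Tm (9 + k)
v8 = var (suc (suc (suc (suc (suc (suc (suc (suc zero))))))))
v9 : ∀ {k} → Tm (10 + k)
v9 = var (suc (suc (suc (suc (suc (suc (suc (suc (suc zero)))))))))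

unary1 : ∀ {k} → Tm k
unary1 = cons nil nil

-- A zero table for order n consists of n + 1 entries `nil`, so it is also the unary number n + 1.
-- Two less is the number of edges of a tree on n vertices.
minusTwo : ∀ {k} → Tm k → Tm k
minusTwo t = case t nil (case v1 nil v1)

bodies : (f : Fin 13) → Tm (arities f)
bodies plusF   = case v0 v1 (cons nil (call plusF (v1 ∷ v3 ∷ [])))
bodies maxF    = case v0 v1 (case v3 v2 (cons nil (call maxF (v3 ∷ v1 ∷ []))))
bodies mapF    = case v1 nil (cons (call plusF (v2 ∷ v0 ∷ [])) (call mapF (v2 ∷ v1 ∷ [])))
bodies mergeF  = case v0 nil (case v3 v2
  (cons (call maxF (v2 ∷ v0 ∷ [])) (call mergeF (v3 ∷ v1 ∷ []))))
bodies convF   = case v0 nil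
  (call mergeF (call mapF (v0 ∷ v3 ∷ []) ∷ cons nil (call convF (v1 ∷ v3 ∷ [])) ∷ []))
bodies zerosF  = case v0 (cons nil nil) (cons nil (call zerosF (v1 ∷ [])))
-- After the four matches `v6`, `v4` are the tables `fa`, `ea`, and `v2`, `v0`, `v1` are `fb`, `eb`,
-- `ab`.
bodies joinF   = case v0 nil (case v1 nil (case v5 nil (case v1 nil
  (cons (call mergeF (call convF (v6 ∷ v2 ∷ [])
          ∷ cons nil (cons nil (call mapF (unary1 ∷ call convF (v4 ∷ v0 ∷ []) ∷ []))) ∷ []))
  (cons (call mergeF (call convF (v6 ∷ v0 ∷ [])
          ∷ cons nil (call mapF (unary1 ∷ call convF (v4 ∷ v1 ∷ []) ∷ [])) ∷ []))
        (call convF (v6 ∷ v1 ∷ [])))))))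
bodies tablesF = case v0 (cons v1 (cons v1 v1))
  (call joinF (call tablesF (v0 ∷ v3 ∷ []) ∷ call tablesF (v1 ∷ v3 ∷ []) ∷ []))
bodies lastF   = case v0 nil (case v1 v0 (call lastF (v3 ∷ [])))
bodies monusF  = case v1 v0 (case v2 nil (call monusF (v1 ∷ v3 ∷ [])))
bodies equalF  = case v0 (case v1 unary1 nil) (case v3 nil (call equalF (v3 ∷ v1 ∷ [])))
bodies nthF    = case v0 nil (case v3 v0 (call nthF (v3 ∷ v1 ∷ [])))
-- Arguments: the adjacency matrix, the rest of row u, the column where it starts, u, and the parent of u.
bodies searchF = case v1 nil
  (local (call searchF (v2 ∷ v1 ∷ cons nil v4 ∷ v5 ∷ v6 ∷ []))
    -- The rest of the row has already been turned into a tree. It is returned as it is for a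
    -- non-neighbour and for the parent `v9`; any other neighbour `v7` is searched and attached.
    (case v1 v0 (case (call equalF (v7 ∷ v9 ∷ []))
      (cons (call searchF (v5 ∷ call nthF (v5 ∷ v7 ∷ []) ∷ nil ∷ v7 ∷ v8 ∷ [])) v2)
      v4)))

program : Program
program = record
  { functions = 13
  ; arity     = arities
  ; body      = bodies
  -- The label lists serve to count vertices. The zero table of the path fixes the largest budget n,
  -- so the last entry of `free` is the number of edges that can be kept.
  ; main      = case v0 nil (case v0 nil (case v3 nil
      (local (call zerosF (v2 ∷ []))
      (local (call lastF (case (call tablesF
                (call searchF (v2 ∷ call nthF (v2 ∷ nil ∷ []) ∷ nil ∷ nil ∷ nil ∷ []) ∷ v0 ∷ [])) nil v0 ∷ []))
        (call plusF
          ( call monusF (minusTwo v1 ∷ v0 ∷ [])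
          ∷ call monusF (minusTwo (call zerosF (v2 ∷ [])) ∷ v0 ∷ []) ∷ []))))))
  }

-- Running times of the table operations

open Evaluation program

infix 4 _⊢_⇓_≤_ _⊢_⇓*_≤_

-- The rules below add up bounds as evaluation adds up steps; the constants in the running times and
-- the `budget` identities are what these derivations accumulate.
_⊢_⇓_≤_ : ∀ {k} → Vec Data k → Tm k → Data → ℕ → Set
ρ ⊢ t ⇓ v ≤ B = ∃ λ c → (ρ ⊢ t ⇓ v [ c ]) × c ≤ B

_⊢_⇓*_≤_ : ∀ {k l} → Vec Data k → Vec (Tm k) l → Vec Data l → ℕ → Set
ρ ⊢ ts ⇓* vs ≤ B = ∃ λ c → (ρ ⊢ ts ⇓* vs [ c ]) × c ≤ B

module _ {k} {ρ : Vec Data k} where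

  within-var : ∀ {x} → ρ ⊢ var x ⇓ Vec.lookup ρ x ≤ 1
  within-var = _ , var , ℕ.≤-refl

  within-nil : ρ ⊢ nil ⇓ nil ≤ 1
  within-nil = _ , nil , ℕ.≤-refl

  within-cons : ∀ {t u a b B C} → ρ ⊢ t ⇓ a ≤ B → ρ ⊢ u ⇓ b ≤ C → ρ ⊢ cons t u ⇓ a ∙ b ≤ suc (B + C)
  within-cons (_ , d , b) (_ , e , c) = _ , cons d e , s≤s (ℕ.+-mono-≤ b c)

  within-case-nil : ∀ {t e e′ v B C} → ρ ⊢ t ⇓ nil ≤ B → ρ ⊢ e ⇓ v ≤ C → ρ ⊢ case t e e′ ⇓ v ≤ suc (B + C)
  within-case-nil (_ , d , b) (_ , e , c) = _ , case-nil d e , s≤s (ℕ.+-mono-≤ b c)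

  within-case-cons : ∀ {t e e′ a b v B C} → ρ ⊢ t ⇓ a ∙ b ≤ B → (a ∷ b ∷ ρ) ⊢ e′ ⇓ v ≤ C →
    ρ ⊢ case t e e′ ⇓ v ≤ suc (B + C)
  within-case-cons (_ , d , b) (_ , e , c) = _ , case-cons d e , s≤s (ℕ.+-mono-≤ b c)

  within-local : ∀ {t u a v B C} → ρ ⊢ t ⇓ a ≤ B → (a ∷ ρ) ⊢ u ⇓ v ≤ C → ρ ⊢ local t u ⇓ v ≤ suc (B + C)
  within-local (_ , d , b) (_ , e , c) = _ , local d e , s≤s (ℕ.+-mono-≤ b c)

  within-call : ∀ {f ts vs v B C} → ρ ⊢ ts ⇓* vs ≤ B → vs ⊢ bodies f ⇓ v ≤ C →
    ρ ⊢ call f ts ⇓ v ≤ suc (B + C)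
  within-call (_ , d , b) (_ , e , c) = _ , call d e , s≤s (ℕ.+-mono-≤ b c)

  []ₐ : ρ ⊢ [] ⇓* [] ≤ 0
  []ₐ = _ , [] , ℕ.≤-refl

  infixr 5 _∷ₐ_
  _∷ₐ_ : ∀ {l t v B C} {ts : Vec (Tm k) l} {vs} → ρ ⊢ t ⇓ v ≤ B → ρ ⊢ ts ⇓* vs ≤ C →
    ρ ⊢ t ∷ ts ⇓* v ∷ vs ≤ B + C
  (_ , d , b) ∷ₐ (_ , e , c) = _ , d ∷ e , ℕ.+-mono-≤ b c

  weaken : ∀ {t v B C} → B ≤ C → ρ ⊢ t ⇓ v ≤ B → ρ ⊢ t ⇓ v ≤ C
  weaken B≤C (_ , d , b) = _ , d , ℕ.≤-trans b B≤C

  returning : ∀ {t v w B} → v ≡ w → ρ ⊢ t ⇓ v ≤ B → ρ ⊢ t ⇓ w ≤ B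
  returning refl run = run

encodeTable : List ℕ → Data
encodeTable f = encodeList (map encodeℕ f)

encodeTables : Tables → Data
encodeTables (tables f e a) = encodeTable f ∙ (encodeTable e ∙ encodeTable a)

lastEntry : List ℕ → ℕ
lastEntry []          = 0
lastEntry (x ∷ [])    = x
lastEntry (x ∷ y ∷ f) = lastEntry (y ∷ f)

plus-runs : ∀ a b → encodeℕ a ∷ encodeℕ b ∷ [] ⊢ bodies plusF ⇓ encodeℕ (a + b) ≤ 3 + a * 7
plus-runs zero    b = within-case-nil within-var within-var
plus-runs (suc a) b = within-case-cons within-var
  (within-cons within-nil (within-call (within-var ∷ₐ within-var ∷ₐ []ₐ) (plus-runs a b)))

max-runs : ∀ a b → encodeℕ a ∷ encodeℕ b ∷ [] ⊢ bodies maxF ⇓ encodeℕ (a ⊔ b) ≤ 3 + a * 9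
max-runs zero    b       = within-case-nil within-var within-var
max-runs (suc a) zero    = weaken (ℕ.m≤m+n 5 _)
  (within-case-cons within-var (within-case-nil within-var within-var))
max-runs (suc a) (suc b) = within-case-cons within-var (within-case-cons within-var
  (within-cons within-nil (within-call (within-var ∷ₐ within-var ∷ₐ []ₐ) (max-runs a b))))

zeros-runs : ∀ ds → encodeList ds ∷ [] ⊢ bodies zerosF ⇓ encodeTable (zeros (length ds)) ≤ 5 + length ds * 6
zeros-runs []       = within-case-nil within-var (within-cons within-nil within-nil)
zeros-runs (d ∷ ds) = within-case-cons within-var
  (within-cons within-nil (within-call (within-var ∷ₐ []ₐ) (zeros-runs ds)))

last-runs : ∀ f → encodeTable f ∷ [] ⊢ bodies lastF ⇓ encodeℕ (lastEntry f) ≤ 5 + length f * 6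
last-runs []          = weaken (ℕ.m≤m+n 3 _) (within-case-nil within-var within-nil)
last-runs (x ∷ [])    = weaken (ℕ.m≤m+n 5 _)
  (within-case-cons within-var (within-case-nil within-var within-var))
last-runs (x ∷ y ∷ f) = within-case-cons within-var
  (within-case-cons within-var (within-call (within-var ∷ₐ []ₐ) (last-runs (y ∷ f))))

monus-runs : ∀ a b → encodeℕ a ∷ encodeℕ b ∷ [] ⊢ bodies monusF ⇓ encodeℕ (a ∸ b) ≤ 5 + b * 7
monus-runs a       zero    = weaken (ℕ.m≤m+n 3 _) (within-case-nil within-var within-var)
monus-runs zero    (suc b) = weaken (ℕ.m≤m+n 5 _)
  (within-case-cons within-var (within-case-nil within-var within-nil))
monus-runs (suc a) (suc b) = within-case-cons within-var (within-case-cons within-var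
  (within-call (within-var ∷ₐ within-var ∷ₐ []ₐ) (monus-runs a b)))

equal-runs : ∀ i j → encodeℕ i ∷ encodeℕ j ∷ [] ⊢ bodies equalF ⇓
  encodeℕ (if i ≡ᵇ j then 1 else 0) ≤ 7 + i * 7
equal-runs zero    zero    = within-case-nil within-var (within-case-nil within-var (within-cons within-nil within-nil))
equal-runs zero    (suc j) = weaken (ℕ.m≤m+n 5 _)
  (within-case-nil within-var (within-case-cons within-var within-nil))
equal-runs (suc i) zero    = weaken (ℕ.m≤m+n 5 _)
  (within-case-cons within-var (within-case-nil within-var within-nil))
equal-runs (suc i) (suc j) = within-case-cons within-var (within-case-cons within-var
  (within-call (within-var ∷ₐ within-var ∷ₐ []ₐ) (equal-runs i j)))

nth-runs : ∀ {k} (f : Fin k → Data) i →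
  encodeList (tabulate f) ∷ encodeℕ (toℕ i) ∷ [] ⊢ bodies nthF ⇓ f i ≤ 5 + toℕ i * 7
nth-runs f zero    = within-case-cons within-var (within-case-nil within-var within-var)
nth-runs f (suc i) = within-case-cons within-var (within-case-cons within-var
  (within-call (within-var ∷ₐ within-var ∷ₐ []ₐ) (nth-runs (λ j → f (suc j)) i)))

merge-≤ : ∀ {c f g} → All (_≤ c) f → All (_≤ c) g → All (_≤ c) (merge f g)
merge-≤ []         g≤         = []
merge-≤ (x≤ ∷ f≤) []         = x≤ ∷ f≤
merge-≤ (x≤ ∷ f≤) (y≤ ∷ g≤) = ℕ.⊔-lub x≤ y≤ ∷ merge-≤ f≤ g≤

map-+-≤ : ∀ {a b x g} → x ≤ a → All (_≤ b) g → All (_≤ a + b) (map (x +_) g)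
map-+-≤ x≤ g≤ = All.map⁺ (All.map (ℕ.+-mono-≤ x≤) g≤)

conv-≤ : ∀ {a b f g} → All (_≤ a) f → All (_≤ b) g → All (_≤ a + b) (conv f g)
conv-≤ []         g≤ = []
conv-≤ (x≤ ∷ f≤) g≤ = merge-≤ (map-+-≤ x≤ g≤) (z≤n ∷ conv-≤ f≤ g≤)

record Bounded (c : ℕ) (T : Tables) : Set where
  constructor bounded-by
  open Tables T
  field
    free≤  : All (_≤ c) free
    end≤   : All (_≤ c) end
    alone≤ : All (_≤ c) alone

-- Entries count tree edges, and `conses` is the number of all of them. The bound is needed because
-- unary sums and maxima take time proportional to their values.
treeTables-bounded : ∀ n t → Bounded (conses t) (treeTables (zeros n) t)
treeTables-bounded n nil = bounded-by z≤ z≤ z≤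
  where
  z≤ : All (_≤ 0) (zeros n)
  z≤ = All.replicate⁺ (suc n) z≤n
treeTables-bounded n (a ∙ b)
  with treeTables (zeros n) a | treeTables (zeros n) b | treeTables-bounded n a | treeTables-bounded n b
... | tables fa ea _ | tables fb eb ab | bounded-by fa≤ ea≤ _ | bounded-by fb≤ eb≤ ab≤ = bounded-by
  (merge-≤ (suc≤ (conv-≤ fa≤ fb≤)) (z≤n ∷ z≤n ∷ map-+-≤ {1} ℕ.≤-refl (conv-≤ ea≤ eb≤)))
  (merge-≤ (suc≤ (conv-≤ fa≤ eb≤)) (z≤n ∷ map-+-≤ {1} ℕ.≤-refl (conv-≤ ea≤ ab≤)))
  (suc≤ (conv-≤ fa≤ ab≤))
  where
  suc≤ : ∀ {c f} → All (_≤ c) f → All (_≤ suc c) f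
  suc≤ = All.map ℕ.m≤n⇒m≤1+n

-- A recursive function costs a base amount plus `X` times the cost of one turn, where `X` bounds
-- lengths and values. One join makes five convolutions, two merges and two maps.
plusP maxP mapP mergeP convP joinP tablesP : Poly
plusP   = con 3 :+ X :* con 7
maxP    = con 3 :+ X :* con 9
mapP    = con 3 :+ X :* (con 9 :+ plusP)
mergeP  = con 5 :+ X :* (con 11 :+ maxP)
convP   = con 3 :+ X :* (con 11 :+ mapP :+ mergeP)
joinP   = con 41 :+ (con 5 :* convP :+ con 2 :* mergeP :+ con 2 :* mapP)
tablesP = con 7 :+ X :* (con 16 :+ joinP)

module Timing (N : ℕ) where

  loop : ∀ c₀ c {k} → k ≤ N → c₀ + k * c ≤ c₀ + N * c
  loop c₀ c k≤N = ℕ.+-monoʳ-≤ c₀ (ℕ.*-monoˡ-≤ c k≤N)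

  map-runs : ∀ {x} → x ≤ N → ∀ g → encodeℕ x ∷ encodeTable g ∷ [] ⊢ bodies mapF ⇓
    encodeTable (map (x +_) g) ≤ 3 + length g * (9 + ⟦ plusP ⟧ N)
  map-runs x≤N []      = within-case-nil within-var within-nil
  map-runs {x} x≤N (y ∷ g) = weaken (ℕ.≤-reflexive (budget (⟦ plusP ⟧ N) _))
    (within-case-cons within-var (within-cons
      (within-call (within-var ∷ₐ within-var ∷ₐ []ₐ) (weaken (loop 3 7 x≤N) (plus-runs x y)))
      (within-call (within-var ∷ₐ within-var ∷ₐ []ₐ) (map-runs x≤N g))))
    where
    budget : ∀ p r → 6 + (p + (3 + (3 + r))) ≡ 3 + (9 + p + r)
    budget = solve-∀

  map-runs′ : ∀ {x} → x ≤ N → ∀ g → length g ≤ N → encodeℕ x ∷ encodeTable g ∷ [] ⊢ bodies mapF ⇓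
    encodeTable (map (x +_) g) ≤ ⟦ mapP ⟧ N
  map-runs′ x≤N g ∣g∣≤N = weaken (loop 3 (9 + ⟦ plusP ⟧ N) ∣g∣≤N) (map-runs x≤N g)

  merge-runs : ∀ {f} g → All (_≤ N) f → encodeTable f ∷ encodeTable g ∷ [] ⊢ bodies mergeF ⇓
    encodeTable (merge f g) ≤ 5 + length f * (11 + ⟦ maxP ⟧ N)
  merge-runs g       []            = weaken (ℕ.m≤m+n 3 _) (within-case-nil within-var within-nil)
  merge-runs []      (x≤N ∷ f≤N)   = weaken (ℕ.m≤m+n 5 _)
    (within-case-cons within-var (within-case-nil within-var within-var))
  merge-runs {x ∷ f} (y ∷ g) (x≤N ∷ f≤N) = weaken (ℕ.≤-reflexive (budget (⟦ maxP ⟧ N) _))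
    (within-case-cons within-var (within-case-cons within-var (within-cons
      (within-call (within-var ∷ₐ within-var ∷ₐ []ₐ) (weaken (loop 3 9 x≤N) (max-runs x y)))
      (within-call (within-var ∷ₐ within-var ∷ₐ []ₐ) (merge-runs g f≤N)))))
    where
    budget : ∀ p r → 8 + (p + (3 + (5 + r))) ≡ 5 + (11 + p + r)
    budget = solve-∀

  merge-runs′ : ∀ {f g} → All (_≤ N) f → length f ≤ N → encodeTable f ∷ encodeTable g ∷ [] ⊢ bodies mergeF ⇓
    encodeTable (merge f g) ≤ ⟦ mergeP ⟧ N
  merge-runs′ {g = g} f≤N ∣f∣≤N = weaken (loop 5 (11 + ⟦ maxP ⟧ N) ∣f∣≤N) (merge-runs g f≤N)

  conv-runs : ∀ {a b} → a + b ≤ N → ∀ {f g} → All (_≤ a) f → All (_≤ b) g → length g ≤ N →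
    encodeTable f ∷ encodeTable g ∷ [] ⊢ bodies convF ⇓
    encodeTable (conv f g) ≤ 3 + length f * (11 + ⟦ mapP ⟧ N + ⟦ mergeP ⟧ N)
  conv-runs ab≤N []         g≤ ∣g∣≤N = within-case-nil within-var within-nil
  conv-runs {a} ab≤N {x ∷ f} {g} (x≤ ∷ f≤) g≤ ∣g∣≤N =
    weaken (ℕ.≤-reflexive (budget (⟦ mapP ⟧ N) (⟦ mergeP ⟧ N) _))
    (within-case-cons within-var (within-call
      (within-call (within-var ∷ₐ within-var ∷ₐ []ₐ)
        (map-runs′ (ℕ.≤-trans x≤ (ℕ.m+n≤o⇒m≤o a ab≤N)) g ∣g∣≤N) ∷ₐ
       within-cons within-nil (within-call (within-var ∷ₐ within-var ∷ₐ []ₐ) (conv-runs ab≤N f≤ g≤ ∣g∣≤N)) ∷ₐ []ₐ)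
      (merge-runs′ (All.map (λ y≤ → ℕ.≤-trans y≤ ab≤N) (map-+-≤ x≤ g≤))
        (subst (_≤ N) (sym (List.length-map (x +_) g)) ∣g∣≤N))))
    where
    budget : ∀ p q r → 6 + (p + (5 + ((3 + r) + 0)) + q) ≡ 3 + (11 + p + q + r)
    budget = solve-∀

  conv-runs′ : ∀ {a b} → a + b ≤ N → ∀ {f g} → All (_≤ a) f → All (_≤ b) g → length f ≤ N → length g ≤ N →
    encodeTable f ∷ encodeTable g ∷ [] ⊢ bodies convF ⇓ encodeTable (conv f g) ≤ ⟦ convP ⟧ N
  conv-runs′ ab≤N f≤ g≤ ∣f∣≤N ∣g∣≤N =
    weaken (loop 3 (11 + ⟦ mapP ⟧ N + ⟦ mergeP ⟧ N) ∣f∣≤N) (conv-runs ab≤N f≤ g≤ ∣g∣≤N)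

  module _ {n : ℕ} (n<N : suc n ≤ N) where

    join-runs : ∀ a b → suc (conses a + conses b) ≤ N →
      encodeTables (treeTables (zeros n) a) ∷ encodeTables (treeTables (zeros n) b) ∷ [] ⊢ bodies joinF ⇓
      encodeTables (treeTables (zeros n) (a ∙ b)) ≤ ⟦ joinP ⟧ N
    join-runs a b 1+ab≤N
      with treeTables (zeros n) a | treeTables (zeros n) b | treeTables-bounded n a | treeTables-bounded n b
         | tableLengths n a | tableLengths n b
    ... | tables fa ea _ | tables fb eb ab | bounded-by fa≤ ea≤ _ | bounded-by fb≤ eb≤ ab≤
        | ∣fa∣ , ∣ea∣ , _ | ∣fb∣ , ∣eb∣ , ∣ab∣ =
      weaken (ℕ.≤-reflexive (budget (⟦ convP ⟧ N) (⟦ mergeP ⟧ N) (⟦ mapP ⟧ N)))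
      (within-case-cons within-var (within-case-cons within-var (within-case-cons within-var (within-case-cons within-var
        (within-cons
          (within-call
            (conv-call fa≤ fb≤ ∣fa∣ ∣fb∣ ∷ₐ
             within-cons within-nil (within-cons within-nil (within-call
               (within-cons within-nil within-nil ∷ₐ conv-call ea≤ eb≤ ∣ea∣ ∣eb∣ ∷ₐ []ₐ)
               (map-runs′ (ℕ.≤-trans (s≤s z≤n) n<N) (conv ea eb) (conv-short ea eb ∣ea∣ ∣eb∣)))) ∷ₐ []ₐ)
            (merge-runs′ (conv-small fa≤ fb≤) (conv-short fa fb ∣fa∣ ∣fb∣)))
          (within-cons
            (within-call
              (conv-call fa≤ eb≤ ∣fa∣ ∣eb∣ ∷ₐ
               within-cons within-nil (within-call
                 (within-cons within-nil within-nil ∷ₐ conv-call ea≤ ab≤ ∣ea∣ ∣ab∣ ∷ₐ []ₐ)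
                 (map-runs′ (ℕ.≤-trans (s≤s z≤n) n<N) (conv ea ab) (conv-short ea ab ∣ea∣ ∣ab∣))) ∷ₐ []ₐ)
              (merge-runs′ (conv-small fa≤ eb≤) (conv-short fa eb ∣fa∣ ∣eb∣)))
            (conv-call fa≤ ab≤ ∣fa∣ ∣ab∣)))))))
      where
      ab≤N : conses a + conses b ≤ N
      ab≤N = ℕ.≤-trans (ℕ.n≤1+n _) 1+ab≤N
      fits : ∀ {f} → length f ≡ suc n → length f ≤ N
      fits eq = subst (_≤ N) (sym eq) n<N
      conv-short : ∀ f g → length f ≡ suc n → length g ≡ suc n → length (conv f g) ≤ N
      conv-short f g ∣f∣ ∣g∣ = fits {conv f g} (trans (length-conv f g ∣f∣) ∣g∣)
      conv-small : ∀ {f g} → All (_≤ conses a) f → All (_≤ conses b) g → All (_≤ N) (conv f g)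
      conv-small f≤ g≤ = All.map (λ y≤ → ℕ.≤-trans y≤ ab≤N) (conv-≤ f≤ g≤)
      -- The operands sit at different positions in the five calls; instance search discharges the
      -- two lookups by `refl`.
      conv-call : ∀ {k} {ρ : Vec Data k} {x y f g} → All (_≤ conses a) f → All (_≤ conses b) g →
        length f ≡ suc n → length g ≡ suc n →
        {{Vec.lookup ρ x ≡ encodeTable f}} → {{Vec.lookup ρ y ≡ encodeTable g}} →
        ρ ⊢ call convF (var x ∷ var y ∷ []) ⇓ encodeTable (conv f g) ≤ 3 + ⟦ convP ⟧ N
      conv-call {ρ = ρ} {x} {y} {f} {g} f≤ g≤ ∣f∣ ∣g∣ {{eqx}} {{eqy}} =
        within-call (subst (ρ ⊢ var x ⇓_≤ 1) eqx within-var ∷ₐ subst (ρ ⊢ var y ⇓_≤ 1) eqy within-var ∷ₐ []ₐ)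
          (conv-runs′ ab≤N f≤ g≤ (fits {f} ∣f∣) (fits {g} ∣g∣))
      budget : ∀ c g m → 10 + (((3 + c) + ((5 + ((3 + ((3 + c) + 0)) + m)) + 0) + g)
        + (2 + (((3 + c) + ((3 + ((3 + ((3 + c) + 0)) + m)) + 0) + g) + (3 + c)))) ≡ 41 + (5 * c + 2 * g + 2 * m)
      budget = solve-∀

    tables-runs : ∀ t → conses t ≤ N → t ∷ encodeTable (zeros n) ∷ [] ⊢ bodies tablesF ⇓
      encodeTables (treeTables (zeros n) t) ≤ 7 + conses t * (16 + ⟦ joinP ⟧ N)
    tables-runs nil     _    = within-case-nil within-var
      (within-cons within-var (within-cons within-var within-var))
    tables-runs (a ∙ b) ab≤N = weaken (ℕ.≤-reflexive (budget (⟦ joinP ⟧ N) (conses a) (conses b)))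
      (within-case-cons within-var (within-call
        (within-call (within-var ∷ₐ within-var ∷ₐ []ₐ)
           (tables-runs a (ℕ.≤-trans (ℕ.m≤m+n _ _) (ℕ.≤-trans (ℕ.n≤1+n _) ab≤N))) ∷ₐ
         within-call (within-var ∷ₐ within-var ∷ₐ []ₐ)
           (tables-runs b (ℕ.≤-trans (ℕ.m≤n+m _ (conses a)) (ℕ.≤-trans (ℕ.n≤1+n _) ab≤N))) ∷ₐ []ₐ)
        (join-runs a b ab≤N)))
      where
      budget : ∀ j a b → 3 + ((3 + (7 + a * (16 + j))) + ((3 + (7 + b * (16 + j))) + 0) + j) ≡
        7 + suc (a + b) * (16 + j)
      budget = solve-∀

-- Running time of the search

linearP entryP nodeP searchP smallP totalP : Poly
smallP  = con 5 :+ X :* con 6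
linearP = con 7 :+ X :* con 7
entryP  = con 18 :+ linearP
nodeP   = con 12 :+ linearP :+ X :* entryP
searchP = con 3 :+ X :* entryP :+ X :* nodeP
totalP  = con 39 :+ con 4 :* linearP :+ con 3 :* smallP :+ searchP :+ tablesP

equal-yes : ∀ {i j} → i ≡ j → encodeℕ i ∷ encodeℕ j ∷ [] ⊢ bodies equalF ⇓ nil ∙ nil ≤ 7 + i * 7
equal-yes {i} {j} i≡j = returning
  (cong (λ b → encodeℕ (if b then 1 else 0)) (dec-true (i ℕ.≟ j) i≡j)) (equal-runs i j)

equal-no : ∀ {i j} → i ≢ j → encodeℕ i ∷ encodeℕ j ∷ [] ⊢ bodies equalF ⇓ nil ≤ 7 + i * 7
equal-no {i} {j} i≢j = returning
  (cong (λ b → encodeℕ (if b then 1 else 0)) (dec-false (i ℕ.≟ j) i≢j)) (equal-runs i j)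

-- Ties the unary column counter of the program to the vertices still to be scanned, which form a
-- run of consecutive numbers.
data CountsFrom {m : ℕ} : ℕ → List (Fin m) → Set where
  []  : ∀ {k} → CountsFrom k []
  _∷_ : ∀ {k v vs} → toℕ v ≡ k → CountsFrom (suc k) vs → CountsFrom k (v ∷ vs)

countsFrom-tabulate : ∀ {m} k {l} (f : Fin l → Fin m) → (∀ i → toℕ (f i) ≡ k + toℕ i) →
  CountsFrom k (tabulate f)
countsFrom-tabulate k {zero}  f eq = []
countsFrom-tabulate k {suc l} f eq = trans (eq zero) (ℕ.+-identityʳ k) ∷
  countsFrom-tabulate (suc k) (λ i → f (suc i)) (λ i → trans (eq (suc i)) (ℕ.+-suc k (toℕ i)))

module Search {s : ℕ} (G : Graph s) (acyclic : Acyclic G) (N : ℕ) (order≤N : Graph.order G ≤ N) where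
  open Graph G using (order; elab; Adj)
  open Timing N

  entry : Fin order → Fin order → Data
  entry u v = encodeEntry (elab u v)

  matrix : Data
  matrix = encodeList (tabulate λ u → encodeList (tabulate (entry u)))

  private
    ℓ = ⟦ linearP ⟧ N

    toℕ≤N : ∀ (v : Fin order) → toℕ v ≤ N
    toℕ≤N v = ℕ.≤-trans (ℕ.<⇒≤ (Fin.toℕ<n v)) order≤N

  mutual
    -- Amortised over the result: each remaining entry of the row costs `entryP`, and each child
    -- found prepays in `nodeP` the scan of its own full row. The number of children in total is the
    -- number of conses of the tree produced.
    search-runs : ∀ f {u p h} → Extends G acyclic h u p → order ≤ f + length (u ∷ h) →
      ∀ {k vs} → CountsFrom k vs →
      matrix ∷ encodeList (map (entry u) vs) ∷ encodeℕ k ∷ encodeℕ (toℕ u) ∷ encodeℕ (toℕ p) ∷ []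
        ⊢ bodies searchF ⇓ shape (searchTree G f u p vs)
        ≤ 3 + length vs * ⟦ entryP ⟧ N + conses (shape (searchTree G f u p vs)) * ⟦ nodeP ⟧ N
    search-runs f ext fuel [] = within-case-nil within-var within-nil
    search-runs f {u} {p} ext fuel {vs = v ∷ vs} (refl ∷ counts)
      with child? G u p v | search-runs f ext fuel counts
    ... | yes (uv , v≢p) | rest with ext (uv , v≢p) | elab u v | uv
    ... | nb | just a | _ = weaken (ℕ.≤-reflexive
          (budget N ℓ (length vs) (conses (shape (subtree G f v u))) (conses (shape (searchTree G f u p vs)))))
        (within-case-cons within-var (within-local
          (within-call (within-var ∷ₐ within-var ∷ₐ within-cons within-nil within-var ∷ₐ within-var ∷ₐ within-var ∷ₐ []ₐ) rest)
          (within-case-cons within-var (within-case-nil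
            (within-call (within-var ∷ₐ within-var ∷ₐ []ₐ)
              (weaken (loop 7 7 (toℕ≤N v)) (equal-no (v≢p ∘ Fin.toℕ-injective))))
            (within-cons
              (within-call
                (within-var ∷ₐ
                 within-call (within-var ∷ₐ within-var ∷ₐ []ₐ)
                   (weaken (ℕ.≤-trans (loop 5 7 (toℕ≤N v)) (ℕ.m≤n+m _ 2))
                     (nth-runs (λ u → encodeList (tabulate (entry u))) v)) ∷ₐ
                 within-nil ∷ₐ within-var ∷ₐ within-var ∷ₐ []ₐ)
                (subtree-runs f nb fuel))
              within-var)))))
      where
      budget : ∀ N ℓ k a b → 3 + ((8 + (3 + k * (18 + ℓ) + b * (12 + ℓ + N * (18 + ℓ)))) +
        (3 + ((3 + ℓ) + (1 + ((1 + ((1 + ((3 + ℓ) + 3)) + (3 + N * (18 + ℓ) + a * (12 + ℓ + N * (18 + ℓ))))) + 1))))) ≡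
        3 + suc k * (18 + ℓ) + suc (a + b) * (12 + ℓ + N * (18 + ℓ))
      budget = solve-∀
    search-runs f {u} {p} ext fuel {vs = v ∷ vs} (refl ∷ counts) | no ¬c | rest with elab u v
    ... | nothing = weaken
          (budget ℓ (length vs) (conses (shape (searchTree G f u p vs)) * ⟦ nodeP ⟧ N))
        (within-case-cons within-var (within-local
          (within-call (within-var ∷ₐ within-var ∷ₐ within-cons within-nil within-var ∷ₐ within-var ∷ₐ within-var ∷ₐ []ₐ) rest)
          (within-case-nil within-var within-var)))
      where
      slack : ∀ ℓ k d → 3 + ((8 + (3 + k * (18 + ℓ) + d)) + 3) + (4 + ℓ) ≡ 3 + suc k * (18 + ℓ) + d
      slack = solve-∀
      budget : ∀ ℓ k d → 3 + ((8 + (3 + k * (18 + ℓ) + d)) + 3) ≤ 3 + suc k * (18 + ℓ) + d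
      budget ℓ k d = ℕ.≤-trans (ℕ.m≤m+n _ (4 + ℓ)) (ℕ.≤-reflexive (slack ℓ k d))
    ... | just a = weaken (ℕ.≤-reflexive
          (budget ℓ (length vs) (conses (shape (searchTree G f u p vs)) * ⟦ nodeP ⟧ N)))
        (within-case-cons within-var (within-local
          (within-call (within-var ∷ₐ within-var ∷ₐ within-cons within-nil within-var ∷ₐ within-var ∷ₐ within-var ∷ₐ []ₐ) rest)
          (within-case-cons within-var (within-case-cons
            (within-call (within-var ∷ₐ within-var ∷ₐ []ₐ)
              (weaken (loop 7 7 (toℕ≤N v)) (equal-yes (cong toℕ v≡p))))
            within-var))))
      where
      budget : ∀ ℓ k d → 3 + ((8 + (3 + k * (18 + ℓ) + d)) + (3 + ((3 + ℓ) + 1))) ≡ 3 + suc k * (18 + ℓ) + d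
      budget = solve-∀
      v≡p : v ≡ p
      v≡p = decidable-stable (v Fin.≟ p) λ v≢p → ¬c (just tt , v≢p)

    subtree-runs : ∀ f {u v h} → NonBacktracking G (v ∷ u ∷ h) → order ≤ f + length (u ∷ h) →
      matrix ∷ encodeList (tabulate (entry v)) ∷ nil ∷ encodeℕ (toℕ v) ∷ encodeℕ (toℕ u) ∷ []
        ⊢ bodies searchF ⇓ shape (subtree G f v u)
        ≤ 3 + N * ⟦ entryP ⟧ N + conses (shape (subtree G f v u)) * ⟦ nodeP ⟧ N
    subtree-runs zero    nb fuel = contradiction fuel (short-history G acyclic nb)
    subtree-runs (suc f) nb fuel =
      all-runs f (extend G acyclic nb) (subst (order ≤_) (sym (ℕ.+-suc f _)) fuel)

    all-runs : ∀ f {u p h} → Extends G acyclic h u p → order ≤ f + length (u ∷ h) →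
      matrix ∷ encodeList (tabulate (entry u)) ∷ nil ∷ encodeℕ (toℕ u) ∷ encodeℕ (toℕ p) ∷ []
        ⊢ bodies searchF ⇓ shape (searchTree G f u p (allFin order))
        ≤ 3 + N * ⟦ entryP ⟧ N + conses (shape (searchTree G f u p (allFin order))) * ⟦ nodeP ⟧ N
    all-runs f {u} {p} ext fuel = subst
      (λ es → matrix ∷ encodeList es ∷ nil ∷ encodeℕ (toℕ u) ∷ encodeℕ (toℕ p) ∷ [] ⊢ bodies searchF ⇓
        shape (searchTree G f u p (allFin order)) ≤
        3 + N * ⟦ entryP ⟧ N + conses (shape (searchTree G f u p (allFin order))) * ⟦ nodeP ⟧ N)
      (List.map-tabulate (λ i → i) (entry u))
      (weaken (ℕ.+-monoˡ-≤ _ (loop 3 (⟦ entryP ⟧ N) ∣vs∣≤N))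
        (search-runs f ext fuel (countsFrom-tabulate 0 (λ i → i) λ _ → refl)))
      where
      ∣vs∣≤N : length (allFin order) ≤ N
      ∣vs∣≤N = subst (_≤ N) (sym (List.length-tabulate (λ i → i))) order≤N

encodeTable-replicate : ∀ n → encodeTable (replicate n 0) ≡ encodeℕ n
encodeTable-replicate zero    = refl
encodeTable-replicate (suc n) = cong (nil ∙_) (encodeTable-replicate n)

minusTwo-runs : ∀ {k} {ρ : Vec Data k} {t} n {B} → 1 ≤ n →
  ρ ⊢ t ⇓ encodeTable (zeros n) ≤ B → ρ ⊢ minusTwo t ⇓ encodeℕ (pred n) ≤ 4 + B
minusTwo-runs (suc n) {B} _ t-runs = weaken (ℕ.≤-reflexive (cong suc (ℕ.+-comm B 3)))
  (within-case-cons t-runs (within-case-cons within-var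
    (returning (encodeTable-replicate n) within-var)))

lastEntry-‼ : ∀ {n} f → length f ≡ suc n → lastEntry f ≡ f ‼ n
lastEntry-‼ {zero}  (x ∷ [])    eq = refl
lastEntry-‼ {suc n} (x ∷ y ∷ f) eq = lastEntry-‼ (y ∷ f) (ℕ.suc-injective eq)

length<size : ∀ ds → suc (length ds) ≤ size (encodeList ds)
length<size []       = s≤s z≤n
length<size (d ∷ ds) = s≤s (ℕ.≤-trans (length<size ds) (ℕ.m≤n+m _ (size d)))

order<size : ∀ {s} (G : Graph s) → suc (Graph.order G) ≤ size (encodeGraph G)
order<size {s} G = ℕ.≤-trans
  (subst (λ k → suc k ≤ size (encodeList labels)) (List.length-tabulate label) (length<size labels))
  (ℕ.≤-trans (ℕ.m≤m+n _ (size (encodeList rows))) (ℕ.n≤1+n _))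
  where
  open Graph G using (order; vlab; elab)
  label : Fin order → Data
  label u = encodeLabel (vlab u)
  labels rows : List Data
  labels = tabulate label
  rows   = tabulate λ u → encodeList (tabulate λ v → encodeEntry (elab u v))

-- The program computes the distance in polynomial time

module Solution {s : ℕ} (G₁ G₂ : Graph s) (path : IsPath G₁) (tree : IsTree G₂) where
  open Graph G₁ using () renaming (order to n)
  open Graph G₂ using () renaming (order to m)

  private
    connected = proj₁ (proj₂ tree)
    acyclic   = proj₂ (proj₂ tree)
    r = fromℕ< (proj₁ tree)
    r≡0 : toℕ r ≡ 0
    r≡0 = Fin.toℕ-fromℕ< (proj₁ tree)

    N = size (encodePair (G₁ , G₂))
    t = spanningTree G₂ acyclic r

    total : ∀ x → x ∈ vertices t
    total = spanningTree-complete G₂ acyclic connected r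

    represents : Represents G₂ t
    represents = spanningTree-represents G₂ acyclic r

    opt : ℕ
    opt = lastEntry (Tables.free (treeTables (zeros n) (shape t)))

    module D = Distance G₁ G₂ (pathList G₁ path) t represents total

    n<N : suc n ≤ N
    n<N = ℕ.≤-trans (order<size G₁)
      (ℕ.≤-trans (ℕ.m≤m+n _ (size (encodeGraph G₂))) (ℕ.n≤1+n _))

    m<N : suc m ≤ N
    m<N = ℕ.≤-trans (order<size G₂)
      (ℕ.≤-trans (ℕ.m≤n+m _ (size (encodeGraph G₁))) (ℕ.n≤1+n _))

    conses≤N : conses (shape t) ≤ N
    conses≤N = ℕ.≤-trans (ℕ.≤-reflexive (trans (conses-shape t)
        -- The number of tree edges is the same under every naming, so a constant one serves here.
        (trans (sym (List.length-map _ (branches t))) (D.length-treeEdges (λ _ → inj₂ 0)))))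
      (ℕ.≤-trans ℕ.pred[n]≤n (ℕ.≤-trans (ℕ.n≤1+n m) m<N))

    opt≤N : opt ≤ N
    opt≤N = ℕ.≤-trans (last≤ (Bounded.free≤ (treeTables-bounded n (shape t)))) conses≤N
      where
      last≤ : ∀ {c f} → All (_≤ c) f → lastEntry f ≤ c
      last≤ []             = z≤n
      last≤ (x≤ ∷ [])      = x≤
      last≤ (_ ∷ y≤ ∷ f≤)  = last≤ (y≤ ∷ f≤)

    opt-‼ : opt ≡ Tables.free (treeTables (zeros n) (shape t)) ‼ n
    opt-‼ = lastEntry-‼ (Tables.free (treeTables (zeros n) (shape t))) (proj₁ (tableLengths n (shape t)))

  distance : ℕ
  distance = (pred n ∸ opt) + (pred m ∸ opt)

  distance-isGED : ∀ {C} → UnitEdgeCosts C → FreeRelabelling s C → IsGED C G₁ G₂ (just distance)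
  distance-isGED unit free = Construction.isGED G₁ G₂ (pathList G₁ path) t represents total unit free
    (let q , Optimality.within unique _ short , opt≤ = proj₁ (Optimality.attained G₂ n t represents ℕ.≤-refl) in
      q , unique , short , subst (_≤ links G₂ q) (sym opt-‼) opt≤)
    (λ {q} q-unique short → subst (links G₂ q ≤_) (sym opt-‼)
      (proj₁ (Optimality.bounded G₂ n t represents ℕ.≤-refl) (Optimality.within q-unique (All.tabulate λ {x} _ → total x) short)))

  open Timing N

  program-runs : (encodePair (G₁ , G₂)) ∷ [] ⊢ Program.main program ⇓ encodeℕ distance ≤ ⟦ totalP ⟧ N
  program-runs = weaken (ℕ.≤-reflexive (budget ⟦small⟧ (⟦ linearP ⟧ N) (⟦ searchP ⟧ N) (⟦ tablesP ⟧ N)))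
    (within-case-cons within-var (within-case-cons within-var (within-case-cons within-var
    (within-local (within-call (within-var ∷ₐ []ₐ) (zeros-of G₁ n<N))
    (within-local
      (within-call
        (within-case-cons
          (within-call
            (within-call
              (within-var ∷ₐ
               within-call (within-var ∷ₐ within-nil ∷ₐ []ₐ) root-row ∷ₐ
               within-nil ∷ₐ within-nil ∷ₐ within-nil ∷ₐ []ₐ)
              search-from-root ∷ₐ
             within-var ∷ₐ []ₐ)
            (weaken (loop 7 (16 + ⟦ joinP ⟧ N) conses≤N) (tables-runs n<N (shape t) conses≤N)))
          within-var ∷ₐ []ₐ)
        (weaken (loop 5 6 free-short) (last-runs free-table)))
      (within-call
        (within-call (minusTwo-runs n (proj₁ path) within-var ∷ₐ within-var ∷ₐ []ₐ) (monus (pred n)) ∷ₐ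
         within-call (minusTwo-runs m (proj₁ tree) (within-call (within-var ∷ₐ []ₐ) (zeros-of G₂ m<N)) ∷ₐ within-var ∷ₐ []ₐ)
           (monus (pred m)) ∷ₐ []ₐ)
        (weaken (ℕ.≤-trans (loop 3 7 n∸≤N) (ℕ.m≤n+m _ 4)) (plus-runs (pred n ∸ opt) _))))))))
    where
    ⟦small⟧ = ⟦ smallP ⟧ N
    free-table = Tables.free (treeTables (zeros n) (shape t))
    free-short : length free-table ≤ N
    free-short = subst (_≤ N) (sym (proj₁ (tableLengths n (shape t)))) n<N
    n∸≤N : pred n ∸ opt ≤ N
    n∸≤N = ℕ.≤-trans (ℕ.m∸n≤m (pred n) opt) (ℕ.≤-trans ℕ.pred[n]≤n (ℕ.≤-trans (ℕ.n≤1+n n) n<N))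
    monus : ∀ k → encodeℕ k ∷ encodeℕ opt ∷ [] ⊢ bodies monusF ⇓ encodeℕ (k ∸ opt) ≤ ⟦ linearP ⟧ N
    monus k = weaken (ℕ.≤-trans (loop 5 7 opt≤N) (ℕ.m≤n+m _ 2)) (monus-runs k opt)
    zeros-of : (G : Graph s) → suc (Graph.order G) ≤ N →
      encodeList (tabulate λ u → encodeLabel (Graph.vlab G u)) ∷ [] ⊢ bodies zerosF ⇓
      encodeTable (zeros (Graph.order G)) ≤ ⟦ smallP ⟧ N
    zeros-of G order<N = returning (cong (encodeTable ∘ zeros) ∣labels∣)
      (weaken (loop 5 6 (subst (_≤ N) (sym ∣labels∣) (ℕ.≤-trans (ℕ.n≤1+n _) order<N))) (zeros-runs labels))
      where
      labels = tabulate λ u → encodeLabel (Graph.vlab G u)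
      ∣labels∣ : length labels ≡ Graph.order G
      ∣labels∣ = List.length-tabulate λ u → encodeLabel (Graph.vlab G u)
    m≤N = ℕ.≤-trans (ℕ.n≤1+n m) m<N
    open Search G₂ acyclic N m≤N
    row = encodeList (tabulate (entry r))
    root-row : matrix ∷ nil ∷ [] ⊢ bodies nthF ⇓ row ≤ ⟦ linearP ⟧ N
    root-row = weaken (ℕ.m≤m+n 5 _) (subst
      (λ k → matrix ∷ encodeℕ k ∷ [] ⊢ bodies nthF ⇓ row ≤ 5 + k * 7) r≡0
      (nth-runs (λ u → encodeList (tabulate (entry u))) r))
    search-from-root : matrix ∷ row ∷ nil ∷ nil ∷ nil ∷ [] ⊢ bodies searchF ⇓ shape t ≤ ⟦ searchP ⟧ N
    -- The root is vertex 0 and acts as its own parent, which excludes no neighbour; hence the last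
    -- two arguments `nil`.
    search-from-root = weaken (ℕ.+-monoʳ-≤ (3 + N * ⟦ entryP ⟧ N) (ℕ.*-monoˡ-≤ (⟦ nodeP ⟧ N) conses≤N)) (subst
      (λ k → matrix ∷ row ∷ nil ∷ encodeℕ k ∷ encodeℕ k ∷ [] ⊢ bodies searchF ⇓ shape t ≤
        3 + N * ⟦ entryP ⟧ N + conses (shape t) * ⟦ nodeP ⟧ N) r≡0
      (all-runs m (extend-root G₂ acyclic) (ℕ.m≤m+n m 1)))
    budget : ∀ z l s t → 6 + (1 + ((2 + z) + (1 + (
        (1 + (((1 + ((1 + (((1 + ((1 + ((3 + l) + 3)) + s)) + 1) + t)) + 1)) + 0) + z))
      + (1 + (((1 + (6 + l)) + ((1 + ((6 + z) + 1 + l)) + 0)) + l)))))) ≡ 39 + 4 * l + 3 * z + s + t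
    budget = solve-∀

UnitEdgeCosts-C-E : UnitEdgeCosts C-E
UnitEdgeCosts-C-E = record { vIns≡0 = refl ; vDel≡0 = refl ; eIns≡1 = refl ; eDel≡1 = refl }

UnitEdgeCosts-freeRelabeling : UnitEdgeCosts C-E-freeRelabeling
UnitEdgeCosts-freeRelabeling = record { vIns≡0 = refl ; vDel≡0 = refl ; eIns≡1 = refl ; eDel≡1 = refl }

polynomialTime : ∀ {s C} → UnitEdgeCosts C → FreeRelabelling s C →
  PolynomialTime {Graph s × Graph s} {ℕ} encodePair encodeℕ PathAndTree (GEDOutput C)
polynomialTime unit free = program , coefficient totalP , exponent totalP ,
  λ { (G₁ , G₂) (path , tree) →
    let c , run , c≤ = Solution.program-runs G₁ G₂ path tree in
    Solution.distance G₁ G₂ path tree , c , Solution.distance-isGED G₁ G₂ path tree unit free , run ,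
    ℕ.≤-trans c≤ (poly-bound totalP (size (encodePair (G₁ , G₂)))) }

mainTheorem5 : PolynomialTime {UnlabeledGraph × UnlabeledGraph} {ℕ} encodePair encodeℕ PathAndTree (GEDOutput C-E)
    × (∀ (s : ℕ) → PolynomialTime {Graph s × Graph s} {ℕ} encodePair encodeℕ PathAndTree (GEDOutput C-E-freeRelabeling))
mainTheorem5 =
  polynomialTime UnitEdgeCosts-C-E (λ { {zero} {zero} a≢b → contradiction refl a≢b }) ,
  λ s → polynomialTime UnitEdgeCosts-freeRelabeling (λ _ → refl , refl)
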